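{- Let $p$ be an odd prime and $m\ge1$. Then $$\Psi^w_{\mathbb{Z}_{p^m}}(x)=\frac{2}{p^{m-1}(p-1)}\sum_{d\mid\frac{\phi(p^m)}{2}}\phi\!\left(\frac{\phi(p^m)}{2d}\right)\left(\left(1+x^{\frac{\phi(p^m)}{d}}\right)^{d}-1\right)\prod_{k=1}^{m-1}\left(1+x^{\frac{\phi(p^{m-k})}{g_k(d)}}\right)^{g_k(d)},$$ where $g_k(d)=\gcd\!\left(d,\frac{\phi(p^{m-k})}{2}\right)$, and hence $$\mathcal{E}^w(\mathbb{Z}_{p^m})=\Psi^w_{\mathbb{Z}_{p^m}}(1)=\frac{2}{p^{m-1}(p-1)}\sum_{d\mid\frac{\phi(p^m)}{2}}\phi\!\left(\frac{\phi(p^m)}{2d}\right)\left(2^d-1\right)\prod_{k=1}^{m-1}2^{g_k(d)}.$$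
   Context: $\phi$ is Euler's totient function; $d$ runs over positive divisors; empty products equal $1$. For the cyclic group $\mathbb{Z}_n$ and a generating set $\Omega$ with $\Omega=-\Omega$, $0\notin\Omega$, the Cayley graph $C(\mathbb{Z}_n,\Omega)$ has vertex set $\mathbb{Z}_n$ and edges $\{g,h\}$ with $h-g\in\Omega$, with $\mathbb{Z}_n$ acting by translation. A graph isomorphism $f$ between two such Cayley graphs is a weak equivalence if there is a group automorphism $\alpha$ of $\mathbb{Z}_n$ with $f(g+u)=\alpha(g)+f(u)$ for all $g,u$. $a^w_k(\mathbb{Z}_n)$ is the number of weak equivalence classes of Cayley graphs $C(\mathbb{Z}_n,\Omega)$ with $|\Omega|=k$, $\Psi^w_{\mathbb{Z}_n}(x)=\sum_{k=1}^{n-1}a^w_k(\mathbb{Z}_n)x^k$, and $\mathcal{E}^w(\mathbb{Z}_n)$ is the number of weak equivalence classes. -}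

module Defs where

open import Data.Nat as ℕ using (ℕ; zero; suc; _+_; _*_; _∸_; _^_)
open import Data.Nat.DivMod using (_/_; _mod_)
open import Data.Nat.GCD using (gcd)
open import Data.Nat.Divisibility using (_∣?_)
open import Data.Integer as ℤ using (ℤ; +_)
open import Data.Fin using (Fin; toℕ)
open import Data.Fin.Subset using (Subset; _∈_; _∉_)
open import Data.Vec using (Vec; lookup)
open import Data.List using (List; []; _∷_; _++_; [_]; filter; length; map; foldr; upTo; replicate)
open import Data.Nat.ListAction using (sum; product)
open import Data.Product using (Σ; _×_)
open import Function.Definitions using (Bijective)
open import Relation.Binary.PropositionalEquality using (_≡_)

range1 : ℕ → List ℕ
range1 n = map suc (upTo n)

φ : ℕ → ℕ
φ n = length (filter (λ k → gcd k n ℕ.≟ 1) (range1 n))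

divisors : ℕ → List ℕ
divisors N = filter (λ d → d ∣? N) (range1 N)

-- division with the (unused) convention a / 0 = 0
divN : ℕ → ℕ → ℕ
divN a zero = 0
divN a (suc b) = a / suc b

_⊕_ : ∀ {n} → Fin n → Fin n → Fin n
_⊕_ {suc n} a b = (toℕ a + toℕ b) mod suc n

⊖_ : ∀ {n} → Fin n → Fin n
⊖_ {suc n} a = (suc n ∸ toℕ a) mod suc n

IsZero : ∀ {n} → Fin n → Set
IsZero a = toℕ a ≡ 0

-- subgroup generated by Ω (a finite group: closure under 0 and +)
data Gen {n} (Ω : Subset n) : Fin n → Set where
  gen0 : ∀ z → IsZero z → Gen Ω z
  gen+ : ∀ a b → a ∈ Ω → Gen Ω b → Gen Ω (a ⊕ b)

IsConnSet : ∀ {n} → Subset n → Set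
IsConnSet {n} Ω =
  (∀ (a : Fin n) → a ∈ Ω → (⊖ a) ∈ Ω) ×
  (∀ (a : Fin n) → IsZero a → a ∉ Ω) ×
  (∀ (x : Fin n) → Gen Ω x)

Adj : ∀ {n} → Subset n → Fin n → Fin n → Set
Adj Ω g h = (h ⊕ (⊖ g)) ∈ Ω

Bij : ∀ {n} → (Fin n → Fin n) → Set
Bij f = Bijective _≡_ _≡_ f

IsGraphIso : ∀ {n} → Subset n → Subset n → (Fin n → Fin n) → Set
IsGraphIso Ω Ω' f =
  Bij f × (∀ g h → (Adj Ω g h → Adj Ω' (f g) (f h)) × (Adj Ω' (f g) (f h) → Adj Ω g h))

IsAut : ∀ {n} → (Fin n → Fin n) → Set
IsAut α = Bij α × (∀ a b → α (a ⊕ b) ≡ α a ⊕ α b)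

WeakEquiv : ∀ {n} → Subset n → Subset n → Set
WeakEquiv {n} Ω Ω' =
  Σ (Fin n → Fin n) λ f → IsGraphIso Ω Ω' f ×
  Σ (Fin n → Fin n) λ α → IsAut α × (∀ g u → f (g ⊕ u) ≡ α g ⊕ f u)

-- "the connection sets satisfying P fall into exactly c weak equivalence
-- classes": a system of c pairwise inequivalent representatives.
NumClasses : ∀ {n} → (Subset n → Set) → ℕ → Set
NumClasses {n} P c =
  Σ (Vec (Subset n) c) λ r →
    (∀ i → P (lookup r i)) ×
    (∀ i j → WeakEquiv (lookup r i) (lookup r j) → i ≡ j) ×
    (∀ Ω → P Ω → Σ (Fin c) λ i → WeakEquiv Ω (lookup r i))

-- Polynomials with integer coefficients (coefficient lists, x^0 first)

Poly : Set
Poly = List ℤ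

padd : Poly → Poly → Poly
padd [] q = q
padd (a ∷ p) [] = a ∷ p
padd (a ∷ p) (b ∷ q) = (a ℤ.+ b) ∷ padd p q

pscale : ℤ → Poly → Poly
pscale c = map (c ℤ.*_)

pmul : Poly → Poly → Poly
pmul [] q = []
pmul (a ∷ p) q = padd (pscale a q) (+ 0 ∷ pmul p q)

pone : Poly
pone = [ + 1 ]

psub : Poly → Poly → Poly
psub p q = padd p (pscale (ℤ.- + 1) q)

ppow : Poly → ℕ → Poly
ppow p zero = pone
ppow p (suc k) = pmul p (ppow p k)

xpow : ℕ → Poly
xpow a = replicate a (+ 0) ++ [ + 1 ]

psum : List Poly → Poly
psum = foldr padd []

pprod : List Poly → Poly
pprod = foldr pmul pone

coeff : Poly → ℕ → ℤ
coeff [] _ = + 0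
coeff (a ∷ p) zero = a
coeff (a ∷ p) (suc k) = coeff p k

-- The right-hand sides of Theorem 4.3 (without the factor 2/(p^{m-1}(p-1)))

halfφ : ℕ → ℕ → ℕ
halfφ p m = φ (p ^ m) / 2

gk : ℕ → ℕ → ℕ → ℕ → ℕ
gk p m k d = gcd d (φ (p ^ (m ∸ k)) / 2)

Ssum : ℕ → ℕ → Poly
Ssum p m = psum (map term (divisors (halfφ p m)))
  where
  term : ℕ → Poly
  term d =
    pscale (+ φ (divN (halfφ p m) d))
      (pmul (psub (ppow (padd pone (xpow (divN (φ (p ^ m)) d))) d) pone)
            (pprod (map (λ k → ppow (padd pone (xpow (divN (φ (p ^ (m ∸ k))) (gk p m k d)))) (gk p m k d))
                        (range1 (m ∸ 1)))))

Esum : ℕ → ℕ → ℕ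
Esum p m = sum (map term (divisors (halfφ p m)))
  where
  term : ℕ → ℕ
  term d = φ (divN (halfφ p m) d) * (2 ^ d ∸ 1) * product (map (λ k → 2 ^ gk p m k d) (range1 (m ∸ 1)))

-- Every automorphism of ℤ/p^m is multiplication by a unit, and a weak equivalence is an automorphism
-- followed by a translation; so the weak equivalence classes are the orbits of the unit group on the
-- symmetric, zero-free sets Ω containing a unit (for a prime power, this last condition says that Ω
-- generates). The unit group is cyclic, generated by some g, and −1 = g^h with h = φ(p^m)/2, so a
-- cyclic group of order h acts and Burnside's lemma sums, over 1 ≤ r ≤ h, the number of Ω fixed by g^r.
-- Writing the nonzero residues as p^k g^i, layer k of a fixed Ω is a sequence in i whose periods include
-- r, h and 2 h_k, where h_k = φ(p^(m−k))/2, hence also e_k = gcd(r, h, h_k); conversely the e_k classes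
-- of layer k, each of size 2 h_k / e_k, can be chosen freely. This gives the factor
-- (1 + x^(2 h_k / e_k))^(e_k), with 1 subtracted when k = 0 to force a unit into Ω. The summand depends
-- only on d = gcd(r, h), a value taken by φ(h / d) of the r.

module Submission where

open import Defs
open import Data.Bool using (Bool; true; false; if_then_else_)
open import Data.Nat as ℕ using (ℕ; zero; suc; _+_; _*_; _∸_; _^_; _≤_; _<_; z≤n; s≤s; NonZero; _≟_)
open import Data.Nat.Properties
open import Data.Nat.DivMod
open import Data.Nat.Divisibility
open import Data.Nat.GCD using (gcd; gcd[m,n]∣m; gcd[m,n]∣n; gcd-greatest; c*gcd[m,n]≡gcd[cm,cn]; module Bézout)
open import Data.Nat.Coprimality using (Coprime; coprime-divisor; coprime⇒gcd≡1)
open import Data.Nat.Primality using (Prime; euclidsLemma; prime⇒nonZero; prime⇒nonTrivial)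
open import Data.Nat.ListAction using (sum; product)
open import Data.Nat.ListAction.Properties using (sum-++; sum-↭; product-↭)
open import Data.Nat.Induction using (<-wellFounded)
open import Induction.WellFounded using (Acc; acc)
open import Data.Nat.Tactic.RingSolver using (solve-∀)
open import Data.Integer as ℤ using (ℤ)
import Data.Integer.Properties as ℤₚ
open import Data.Integer.Tactic.RingSolver using () renaming (solve-∀ to ℤ-solve-∀)
open import Data.Fin using (Fin; zero; suc; toℕ)
open import Data.Fin.Subset using (Subset; ∣_∣; _∈_)
open import Data.Product using (Σ; ∃; _×_; _,_; proj₁; proj₂)
import Data.Product.Properties as Productₚ
import Data.Fin.Properties as Finₚ
open import Data.Vec as Vec using (Vec; []; _∷_)
import Data.Vec.Properties as Vecₚ
import Data.List.Properties as Listₚ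
import Data.List.Relation.Unary.AllPairs.Properties as AllPairsₚ
open import Data.Sum using (_⊎_; inj₁; inj₂)
open import Data.Empty using (⊥; ⊥-elim)
open import Data.Unit using (⊤; tt)
open import Data.List using (List; []; _∷_; _++_; [_]; filter; length; map; upTo; replicate; allFin; applyUpTo; concatMap)
open import Data.List.Properties using (length-map; length-++; map-++; map-∘; filter-++; length-upTo; length-replicate; filter-all; filter-none)
import Data.List.Membership.Propositional
open import Data.List.Membership.Propositional using () renaming (_∈_ to _∈ˡ_; _∉_ to _∉ˡ_)
open import Data.List.Membership.Propositional.Properties
open import Data.List.Membership.Propositional.Properties.WithK using (unique∧set⇒bag)
open import Data.List.Relation.Unary.Any as Any using (Any; here; there)
open import Data.List.Relation.Unary.All as All using (All; []; _∷_)
open import Data.List.Relation.Unary.AllPairs as AllPairs using (AllPairs; []; _∷_)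
open import Data.List.Relation.Unary.Unique.Propositional using (Unique)
open import Data.Nat.Primality.Factorisation using (factorise; PrimeFactorisation)
import Data.Nat.Coprimality
import Data.Nat.Primality
import Data.Nat.GCD
import Data.List.Relation.Unary.Unique.Propositional.Properties as Unique
open import Data.List.Relation.Binary.Permutation.Propositional using (_↭_; ↭-trans; ↭-sym)
open import Data.List.Relation.Binary.Permutation.Propositional.Properties using (↭-length; ∈-resp-↭; shift) renaming (map⁺ to ↭-map⁺)
open import Data.List.Relation.Binary.BagAndSetEquality using (∼bag⇒↭)
open import Data.List.Relation.Unary.All.Properties using (¬All⇒Any¬; ¬Any⇒All¬)
open import Relation.Nullary using (¬_; Dec; yes; no; does; _×-dec_; ¬?)
open import Relation.Nullary.Decidable using () renaming (map′ to Dec-map′)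
open import Relation.Unary using (Decidable)
open import Relation.Binary.Definitions using (tri<; tri≈; tri>)
open import Relation.Binary.PropositionalEquality using (_≡_; _≢_; refl; sym; trans; cong; cong₂; subst; subst₂; module ≡-Reasoning)
open import Function using (_∘_; id; case_of_; mk⇔)

-- Counting in lists

-- All layers have to be handled by one generator: `g` is chosen primitive modulo p^(a+1) for every
-- a < m at once. Multiplication by g^j then shifts the exponent i by j in every layer
-- simultaneously, and a zero-free subset becomes a family of Boolean sequences, one per layer. In
-- layer k negation is the shift by h, and h = p^k h_k with p^k odd, so h ≡ h_k modulo the period 2
-- h_k. This is why g_k(d) contains half of φ(p^(m-k)). Only symmetric sets are fixed by g^h, so
-- Burnside's lemma is proved for an action of ℕ on a list whose members return after h steps. Sets
-- and polynomials meet in the list of all sublist sums of the class sizes: counting its entries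
-- equal to k gives a coefficient, counting all its entries gives the value at x = 1. The argument
-- therefore runs once, for any decidable condition `Q` on the size of Ω. The factor
-- 2/(p^(m-1)(p-1)) is cleared by multiplication, and the subtraction of 1 becomes a difference of
-- two such counts.

private
  variable
    A B : Set
    P Q : A → Set

set⇒↭ : {xs ys : List A} → Unique xs → Unique ys →
        (∀ {x} → x ∈ˡ xs → x ∈ˡ ys) → (∀ {x} → x ∈ˡ ys → x ∈ˡ xs) → xs ↭ ys
set⇒↭ u v f g = ∼bag⇒↭ (unique∧set⇒bag u v (mk⇔ f g))

∈-range1⁺ : ∀ {n k} → 1 ≤ k → k ≤ n → k ∈ˡ range1 n
∈-range1⁺ {k = suc k} _ k≤n = ∈-map⁺ suc (∈-upTo⁺ k≤n)

∈-range1⁻ : ∀ {n k} → k ∈ˡ range1 n → 1 ≤ k × k ≤ n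
∈-range1⁻ k∈ with ∈-map⁻ suc k∈
... | _ , j∈ , refl = s≤s z≤n , ∈-upTo⁻ j∈

range1-unique : ∀ n → Unique (range1 n)
range1-unique n = Unique.map⁺ suc-injective (Unique.upTo⁺ n)

length-range1 : ∀ n → length (range1 n) ≡ n
length-range1 n = trans (length-map suc (upTo n)) (length-upTo n)

unique-head∉ : {x : A} {xs : List A} → Unique (x ∷ xs) → x ∉ˡ xs
unique-head∉ (x≢ ∷ _) x∈ = All.lookup x≢ x∈ refl

unique-map : {f : A → B} {xs : List A} → (∀ {x y} → x ∈ˡ xs → y ∈ˡ xs → f x ≡ f y → x ≡ y) →
             Unique xs → Unique (map f xs)
unique-map {xs = []} inj [] = []
unique-map {f = f} {x ∷ xs} inj (u ∷ us) =
  All.tabulate (λ y∈ eq → case ∈-map⁻ f y∈ of λ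
    { (z , z∈ , refl) → All.lookup u z∈ (inj (here refl) (there z∈) eq) })
  ∷ unique-map (λ x∈ y∈ → inj (there x∈) (there y∈)) us

complete-↭ : {xs ys : List A} → Unique xs → (∀ {x} → x ∈ˡ xs → x ∈ˡ ys) →
             ∃ λ zs → ys ↭ xs ++ zs
complete-↭ {xs = []} {ys} _ _ = ys , ↭-sym (_↭_.refl)
complete-↭ {xs = x ∷ xs} {ys} (u ∷ us) xs⊆ys with ∈-∃++ (xs⊆ys (here refl))
... | as , bs , refl with complete-↭ {xs = xs} {as ++ bs} us ⊆rest
  where
  ⊆rest : ∀ {y} → y ∈ˡ xs → y ∈ˡ as ++ bs
  ⊆rest y∈ with ∈-resp-↭ (shift x as bs) (xs⊆ys (there y∈))
  ... | here refl = ⊥-elim (unique-head∉ (u ∷ us) y∈)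
  ... | there y∈' = y∈'
... | zs , perm = zs , ↭-trans (shift x as bs) (_↭_.prep x perm)

pigeonhole-⊇ : {xs ys : List A} → Unique xs → (∀ {x} → x ∈ˡ xs → x ∈ˡ ys) →
               length ys ≤ length xs → ∀ {y} → y ∈ˡ ys → y ∈ˡ xs
pigeonhole-⊇ {xs = xs} u xs⊆ys len y∈ with complete-↭ u xs⊆ys
... | [] , perm = subst (_ ∈ˡ_) (Listₚ.++-identityʳ xs) (∈-resp-↭ perm y∈)
... | z ∷ zs , perm = ⊥-elim (<⇒≱ longer len)
  where
  longer : length xs < _
  longer = subst (length xs <_)
    (sym (trans (↭-length perm) (length-++ xs)))
    (m<m+n (length xs) (s≤s z≤n))

-- The Iverson bracket: counting becomes summation, and double counting becomes `∑-swap`.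
⟦_⟧ : {X : Set} → Dec X → ℕ
⟦ yes _ ⟧ = 1
⟦ no  _ ⟧ = 0

⟦⟧-yes : {X : Set} (d : Dec X) → X → ⟦ d ⟧ ≡ 1
⟦⟧-yes (yes _) _ = refl
⟦⟧-yes (no ¬x) x = ⊥-elim (¬x x)

⟦⟧-no : {X : Set} (d : Dec X) → ¬ X → ⟦ d ⟧ ≡ 0
⟦⟧-no (yes x) ¬x = ⊥-elim (¬x x)
⟦⟧-no (no _) _ = refl

⟦⟧-cong : {X Y : Set} (d : Dec X) (e : Dec Y) → (X → Y) → (Y → X) → ⟦ d ⟧ ≡ ⟦ e ⟧
⟦⟧-cong d (yes y) f g = ⟦⟧-yes d (g y)
⟦⟧-cong d (no ¬y) f g = ⟦⟧-no d (¬y ∘ f)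

∑ : List A → (A → ℕ) → ℕ
∑ xs f = sum (map f xs)

∑-cong : (xs : List A) {f g : A → ℕ} → (∀ {x} → x ∈ˡ xs → f x ≡ g x) → ∑ xs f ≡ ∑ xs g
∑-cong [] _ = refl
∑-cong (x ∷ xs) eq = cong₂ _+_ (eq (here refl)) (∑-cong xs (eq ∘ there))

∑-↭ : {xs ys : List A} (f : A → ℕ) → xs ↭ ys → ∑ xs f ≡ ∑ ys f
∑-↭ f perm = sum-↭ (↭-map⁺ f perm)

∑-map : (g : A → B) (xs : List A) (f : B → ℕ) → ∑ (map g xs) f ≡ ∑ xs (f ∘ g)
∑-map g xs f = cong sum (sym (map-∘ xs))

∑-+ : (xs : List A) (f g : A → ℕ) → ∑ xs (λ x → f x + g x) ≡ ∑ xs f + ∑ xs g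
∑-+ [] f g = refl
∑-+ (x ∷ xs) f g = trans (cong (_ +_) (∑-+ xs f g)) (interchange (f x) (g x) _ _)
  where
  interchange : ∀ a b c d → a + b + (c + d) ≡ a + c + (b + d)
  interchange = solve-∀

∑-const : (xs : List A) (c : ℕ) → ∑ xs (λ _ → c) ≡ length xs * c
∑-const [] c = refl
∑-const (x ∷ xs) c = cong (c +_) (∑-const xs c)

∑-*ʳ : (xs : List A) (f : A → ℕ) (c : ℕ) → ∑ xs (λ x → f x * c) ≡ ∑ xs f * c
∑-*ʳ [] f c = refl
∑-*ʳ (x ∷ xs) f c = trans (cong (_ +_) (∑-*ʳ xs f c)) (sym (*-distribʳ-+ c (f x) _))

∑-swap : (xs : List A) (ys : List B) (f : A → B → ℕ) →
         ∑ xs (λ x → ∑ ys (f x)) ≡ ∑ ys (λ y → ∑ xs (λ x → f x y))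
∑-swap [] ys f = sym (trans (∑-const ys 0) (*-zeroʳ (length ys)))
∑-swap (x ∷ xs) ys f =
  trans (cong (_ +_) (∑-swap xs ys f)) (sym (∑-+ ys (f x) _))

∑-zero : (xs : List A) {f : A → ℕ} → (∀ {x} → x ∈ˡ xs → f x ≡ 0) → ∑ xs f ≡ 0
∑-zero xs eq = trans (∑-cong xs eq) (trans (∑-const xs 0) (*-zeroʳ (length xs)))

∑-single : {xs : List A} → Unique xs → (f : A → ℕ) {x : A} → x ∈ˡ xs →
           (∀ {y} → y ∈ˡ xs → y ≢ x → f y ≡ 0) → ∑ xs f ≡ f x
∑-single {xs = x ∷ xs} (u ∷ us) f (here refl) zero-off =
  trans (cong (f x +_) (∑-zero xs λ y∈ → zero-off (there y∈) λ { refl → unique-head∉ (u ∷ us) y∈ }))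
        (+-identityʳ (f x))
∑-single {xs = y ∷ xs} (u ∷ us) f {x} (there x∈) zero-off =
  trans (cong (_+ ∑ xs f) (zero-off (here refl) λ { refl → unique-head∉ (u ∷ us) x∈ }))
        (∑-single us f x∈ (zero-off ∘ there))

# : {P : A → Set} → Decidable P → List A → ℕ
# P? xs = length (filter P? xs)

#-∑ : (P? : Decidable P) (xs : List A) → # P? xs ≡ ∑ xs (⟦_⟧ ∘ P?)
#-∑ P? [] = refl
#-∑ P? (x ∷ xs) with P? x
... | yes _ = cong suc (#-∑ P? xs)
... | no  _ = #-∑ P? xs

#-all : (xs : List A) → # {P = λ _ → ⊤} (λ _ → yes tt) xs ≡ length xs
#-all xs = cong length (filter-all _ (All.universal (λ _ → tt) xs))

#-cong : (P? : Decidable P) (Q? : Decidable Q) (xs : List A) →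
         (∀ {x} → x ∈ˡ xs → P x → Q x) → (∀ {x} → x ∈ˡ xs → Q x → P x) → # P? xs ≡ # Q? xs
#-cong P? Q? xs f g = trans (#-∑ P? xs)
  (trans (∑-cong xs λ {x} x∈ → ⟦⟧-cong (P? x) (Q? x) (f x∈) (g x∈)) (sym (#-∑ Q? xs)))

#-++ : (P? : Decidable P) (xs ys : List A) → # P? (xs ++ ys) ≡ # P? xs + # P? ys
#-++ P? xs ys = trans (cong length (filter-++ P? xs ys)) (length-++ (filter P? xs))

#-map : (P? : Decidable P) (f : B → A) (xs : List B) → # P? (map f xs) ≡ # (P? ∘ f) xs
#-map P? f xs = trans (#-∑ P? (map f xs)) (trans (∑-map f xs _) (sym (#-∑ (P? ∘ f) xs)))

#-split : (P? : Decidable P) (Q? : Decidable Q) (xs : List A) →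
          # P? xs ≡ # (λ x → P? x ×-dec Q? x) xs + # (λ x → P? x ×-dec ¬? (Q? x)) xs
#-split P? Q? [] = refl
#-split P? Q? (x ∷ xs) with P? x | Q? x
... | yes _ | yes _ = cong suc (#-split P? Q? xs)
... | yes _ | no  _ = trans (cong suc (#-split P? Q? xs)) (sym (+-suc _ _))
... | no  _ | yes _ = #-split P? Q? xs
... | no  _ | no  _ = #-split P? Q? xs

#-bijection : (P? : Decidable P) (Q? : Decidable Q) {xs : List A} {ys : List B} (f : A → B) →
              Unique xs → Unique ys →
              (∀ {x y} → x ∈ˡ xs → y ∈ˡ xs → f x ≡ f y → x ≡ y) →
              (∀ {x} → x ∈ˡ xs → P x → f x ∈ˡ ys × Q (f x)) →
              (∀ {y} → y ∈ˡ ys → Q y → ∃ λ x → x ∈ˡ xs × P x × y ≡ f x) →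
              # P? xs ≡ # Q? ys
#-bijection P? Q? {xs} {ys} f u v inj to from =
  trans (sym (length-map f (filter P? xs)))
        (↭-length (set⇒↭ (unique-map (λ x∈ y∈ → inj (mem x∈) (mem y∈)) (Unique.filter⁺ P? u)) (Unique.filter⁺ Q? v) forth back))
  where
  mem : ∀ {x} → x ∈ˡ filter P? xs → x ∈ˡ xs
  mem x∈ = proj₁ (∈-filter⁻ P? {xs = xs} x∈)
  forth : ∀ {y} → y ∈ˡ map f (filter P? xs) → y ∈ˡ filter Q? ys
  forth y∈ with ∈-map⁻ f y∈
  ... | x , x∈ , refl with ∈-filter⁻ P? {xs = xs} x∈
  ... | x∈' , px with to x∈' px
  ... | fx∈ , q = ∈-filter⁺ Q? fx∈ q
  back : ∀ {y} → y ∈ˡ filter Q? ys → y ∈ˡ map f (filter P? xs)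
  back y∈ with ∈-filter⁻ Q? {xs = ys} y∈
  ... | y∈' , qy with from y∈' qy
  ... | x , x∈ , px , refl = ∈-map⁺ f (∈-filter⁺ P? x∈ px)

-- Congruences

infix 4 _≈_[_]

-- A multiple of n is added on each side, so nothing is subtracted: symmetry is a swap, and
-- compatibility with sums and products is a ring identity in ℕ.
record _≈_[_] (a b n : ℕ) : Set where
  constructor witness
  field
    s t : ℕ
    eq  : a + s * n ≡ b + t * n

≈-refl : ∀ {n a} → a ≈ a [ n ]
≈-refl = witness 0 0 refl

≡⇒≈ : ∀ {n a b} → a ≡ b → a ≈ b [ n ]
≡⇒≈ refl = ≈-refl

≈-sym : ∀ {n a b} → a ≈ b [ n ] → b ≈ a [ n ]
≈-sym (witness s t eq) = witness t s (sym eq)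

≈-trans : ∀ {n a b c} → a ≈ b [ n ] → b ≈ c [ n ] → a ≈ c [ n ]
≈-trans {n} {a} {b} {c} (witness s t e) (witness u v f) = witness (s + u) (v + t) (begin
  a + (s + u) * n     ≡⟨ lem₁ a s u n ⟩
  (a + s * n) + u * n ≡⟨ cong (_+ u * n) e ⟩
  (b + t * n) + u * n ≡⟨ lem₂ b t u n ⟩
  (b + u * n) + t * n ≡⟨ cong (_+ t * n) f ⟩
  (c + v * n) + t * n ≡⟨ sym (lem₁ c v t n) ⟩
  c + (v + t) * n     ∎)
  where
  open ≡-Reasoning
  lem₁ : ∀ a s u n → a + (s + u) * n ≡ (a + s * n) + u * n
  lem₁ = solve-∀
  lem₂ : ∀ b t u n → (b + t * n) + u * n ≡ (b + u * n) + t * n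
  lem₂ = solve-∀

≈-+ : ∀ {n a b c d} → a ≈ b [ n ] → c ≈ d [ n ] → a + c ≈ b + d [ n ]
≈-+ {n} {a} {b} {c} {d} (witness s t e) (witness u v f) =
  witness (s + u) (t + v) (trans (lem a c s u n) (trans (cong₂ _+_ e f) (sym (lem b d t v n))))
  where
  lem : ∀ a c s u n → a + c + (s + u) * n ≡ (a + s * n) + (c + u * n)
  lem = solve-∀

≈-* : ∀ {n a b c d} → a ≈ b [ n ] → c ≈ d [ n ] → a * c ≈ b * d [ n ]
≈-* {n} {a} {b} {c} {d} (witness s t e) (witness u v f) =
  witness (a * u + s * c + s * u * n) (b * v + t * d + t * v * n)
    (trans (lem a c s u n) (trans (cong₂ _*_ e f) (sym (lem b d t v n))))
  where
  lem : ∀ a c s u n → a * c + (a * u + s * c + s * u * n) * n ≡ (a + s * n) * (c + u * n)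
  lem = solve-∀

≈-*ˡ : ∀ {n b c} a → b ≈ c [ n ] → a * b ≈ a * c [ n ]
≈-*ˡ a = ≈-* (≈-refl {a = a})

≈-*ʳ : ∀ {n a b} c → a ≈ b [ n ] → a * c ≈ b * c [ n ]
≈-*ʳ c r = ≈-* r (≈-refl {a = c})

≈-^ : ∀ {n a b} k → a ≈ b [ n ] → a ^ k ≈ b ^ k [ n ]
≈-^ zero r = ≈-refl
≈-^ (suc k) r = ≈-* r (≈-^ k r)

≈1-^ : ∀ {n a} k → a ≈ 1 [ n ] → a ^ k ≈ 1 [ n ]
≈1-^ k r = ≈-trans (≈-^ k r) (≡⇒≈ (^-zeroˡ k))

≈-weaken : ∀ {n d a b} → d ∣ n → a ≈ b [ n ] → a ≈ b [ d ]
≈-weaken {d = d} {a} {b} (divides q refl) (witness s t e) =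
  witness (s * q) (t * q) (trans (cong (a +_) (*-assoc s q d)) (trans e (cong (b +_) (sym (*-assoc t q d)))))

∣⇒≈ : ∀ {n} a {k} → n ∣ k → a + k ≈ a [ n ]
∣⇒≈ {n} a (divides q refl) = witness 0 q (+-identityʳ _)

≈⇒∣ : ∀ {n} a {k} → a + k ≈ a [ n ] → n ∣ k
≈⇒∣ {n} a {k} (witness s t e) = ∣m+n∣m⇒∣n (subst (n ∣_) (+-comm k (s * n)) n∣) (n∣m*n s)
  where
  n∣ : n ∣ k + s * n
  n∣ = divides t (+-cancelˡ-≡ a (k + s * n) (t * n) (trans (sym (+-assoc a k _)) e))

≈0⇒∣ : ∀ {n k} → k ≈ 0 [ n ] → n ∣ k
≈0⇒∣ = ≈⇒∣ 0

∣⇒≈0 : ∀ {n k} → n ∣ k → k ≈ 0 [ n ]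
∣⇒≈0 = ∣⇒≈ 0

≈-cancel-≤ : ∀ {n a b} c → Coprime n c → a ≤ b → b * c ≈ a * c [ n ] → b ≈ a [ n ]
≈-cancel-≤ {n} {a} {b} c cop a≤b r = subst (_≈ a [ n ]) (m+[n∸m]≡n a≤b) (∣⇒≈ a (coprime-divisor cop
  (≈⇒∣ (c * a) (subst₂ (_≈_[ n ])
    (trans (cong (_* c) (sym (m+[n∸m]≡n a≤b))) (trans (*-comm _ c) (*-distribˡ-+ c a (b ∸ a))))
    (*-comm a c) r))))

≈-cancel : ∀ {n a b} c → Coprime n c → a * c ≈ b * c [ n ] → a ≈ b [ n ]
≈-cancel {n} {a} {b} c cop r with ≤-total a b
... | inj₁ a≤b = ≈-sym (≈-cancel-≤ c cop a≤b (≈-sym r))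
... | inj₂ b≤a = ≈-cancel-≤ c cop b≤a r

≈-% : ∀ a n .{{_ : NonZero n}} → a % n ≈ a [ n ]
≈-% a n = witness (a / n) 0 (trans (sym (m≡m%n+[m/n]*n a n)) (sym (+-identityʳ a)))

≈⇒%≡ : ∀ {a b} n .{{_ : NonZero n}} → a ≈ b [ n ] → a % n ≡ b % n
≈⇒%≡ {a} {b} n (witness s t e) =
  trans (sym ([m+kn]%n≡m%n a s n)) (trans (cong (_% n) e) ([m+kn]%n≡m%n b t n))

%≡⇒≈ : ∀ {a b} n .{{_ : NonZero n}} → a % n ≡ b % n → a ≈ b [ n ]
%≡⇒≈ {a} {b} n e = ≈-trans (≈-sym (≈-% a n)) (≈-trans (≡⇒≈ e) (≈-% b n))

≈⇒≡ : ∀ {a b n} → a < n → b < n → a ≈ b [ n ] → a ≡ b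
≈⇒≡ {n = suc n} a< b< r = trans (sym (m<n⇒m%n≡m a<)) (trans (≈⇒%≡ (suc n) r) (m<n⇒m%n≡m b<))

≈-resp-∣ : ∀ {n a b} d → d ∣ n → a ≈ b [ n ] → d ∣ a → d ∣ b
≈-resp-∣ d d∣n r d∣a = ≈0⇒∣ (≈-trans (≈-sym (≈-weaken d∣n r)) (∣⇒≈0 d∣a))

≈-*-mono : ∀ {n a b} k → a ≈ b [ n ] → k * a ≈ k * b [ k * n ]
≈-*-mono {n} {a} {b} k (witness s t e) =
  witness s t (trans (lem k a s n) (trans (cong (k *_) e) (sym (lem k b t n))))
  where
  lem : ∀ k a s n → k * a + s * (k * n) ≡ k * (a + s * n)
  lem = solve-∀

≈-*-cancel : ∀ {n a b} k .{{_ : NonZero k}} → k * a ≈ k * b [ k * n ] → a ≈ b [ n ]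
≈-*-cancel {n} {a} {b} k (witness s t e) =
  witness s t (*-cancelˡ-≡ _ _ k (trans (sym (lem k a s n)) (trans e (lem k b t n))))
  where
  lem : ∀ k a s n → k * a + s * (k * n) ≡ k * (a + s * n)
  lem = solve-∀

-- Coprimality and periodic sequences

^-distribʳ-* : ∀ k a b → (a * b) ^ k ≡ a ^ k * b ^ k
^-distribʳ-* zero a b = refl
^-distribʳ-* (suc k) a b = trans (cong (a * b *_) (^-distribʳ-* k a b)) (lem a b (a ^ k) (b ^ k))
  where
  lem : ∀ a b c d → a * b * (c * d) ≡ a * c * (b * d)
  lem = solve-∀

coprime-sym : ∀ {a b} → Coprime a b → Coprime b a
coprime-sym = Data.Nat.Coprimality.sym

coprime-*ˡ : ∀ {a b c} → Coprime a c → Coprime b c → Coprime (a * b) c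
coprime-*ˡ {a} {b} {c} ac bc {d} (d∣ab , d∣c) =
  bc (coprime-divisor (λ (e∣d , e∣a) → ac (e∣a , ∣-trans e∣d d∣c)) d∣ab , d∣c)

coprime-^ˡ : ∀ {a c} k → Coprime a c → Coprime (a ^ k) c
coprime-^ˡ zero _ (d∣1 , _) = ∣1⇒≡1 d∣1
coprime-^ˡ {a} {c} (suc k) ac = coprime-*ˡ ac (coprime-^ˡ k ac)

coprime-∣∣ : ∀ {a b c} → Coprime a b → a ∣ c → b ∣ c → a * b ∣ c
coprime-∣∣ {a} {b} cop (divides q refl) b∣c =
  subst (a * b ∣_) (*-comm a q) (*-monoʳ-∣ a (coprime-divisor (coprime-sym cop) (subst (b ∣_) (*-comm q a) b∣c)))

prime-coprime : ∀ {p a} → Prime p → ¬ p ∣ a → Coprime p a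
prime-coprime {p} {a} pp p∤a {d} (d∣p , d∣a) with Data.Nat.Primality.prime⇒irreducible pp d∣p
... | inj₁ d≡1 = d≡1
... | inj₂ refl = ⊥-elim (p∤a d∣a)

1<prime : ∀ {p} → Prime p → 1 < p
1<prime pp = ℕ.nonTrivial⇒n>1 _ {{prime⇒nonTrivial pp}}

Periodic : {A : Set} → ℕ → (ℕ → A) → Set
Periodic d f = ∀ i → f (i + d) ≡ f i

periodic-* : ∀ {A d} {f : ℕ → A} q → Periodic d f → Periodic (q * d) f
periodic-* {f = f} zero per i = cong f (+-identityʳ i)
periodic-* {d = d} {f} (suc q) per i =
  trans (cong f (sym (+-assoc i d _))) (trans (periodic-* q per (i + d)) (per i))

periodic-≈ : ∀ {A d i j} {f : ℕ → A} → Periodic d f → i ≈ j [ d ] → f i ≡ f j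
periodic-≈ {i = i} {j} {f} per (witness s t e) =
  trans (sym (periodic-* s per i)) (trans (cong f e) (periodic-* t per j))

-- Bézout with natural coefficients: from i + gcd, a multiple of one period leads up to i plus a
-- multiple of the other, so no backward step occurs.
periodic-gcd : ∀ {A a b} {f : ℕ → A} → Periodic a f → Periodic b f → Periodic (gcd a b) f
periodic-gcd {a = a} {b} {f} pa pb i with Bézout.identity (Data.Nat.GCD.gcd-GCD a b)
... | Bézout.+- x y eq = trans (sym (periodic-* y pb (i + gcd a b)))
  (trans (cong f (trans (+-assoc i _ _) (cong (i +_) eq))) (periodic-* x pa i))
... | Bézout.-+ x y eq = trans (sym (periodic-* x pa (i + gcd a b)))
  (trans (cong f (trans (+-assoc i _ _) (cong (i +_) eq))) (periodic-* y pb i))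

-- Primitive roots

-- Coefficients of a monic polynomial, constant term first, leading 1 omitted.
eval : List ℕ → ℕ → ℕ
eval [] x = 1
eval (c ∷ cs) x = c + x * eval cs x

-- Horner's scheme: `quot a cs` is the quotient of `c ∷ cs` by x - a, for any constant term c.
quot : ℕ → List ℕ → List ℕ
quot a [] = []
quot a (c ∷ cs) = eval (c ∷ cs) a ∷ quot a cs

length-quot : ∀ a cs → length (quot a cs) ≡ length cs
length-quot a [] = refl
length-quot a (c ∷ cs) = cong suc (length-quot a cs)

-- f(x) − f(a) = (x − a) q(x), with both sides moved so that no subtraction occurs.
eval-quot : ∀ a c cs x →
  eval (c ∷ cs) x + a * eval (quot a cs) x ≡ x * eval (quot a cs) x + eval (c ∷ cs) a
eval-quot a c [] x = lem a c x
  where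
  lem : ∀ a c x → c + x * 1 + a * 1 ≡ x * 1 + (c + a * 1)
  lem = solve-∀
eval-quot a c (c′ ∷ cs) x = begin
  c + x * g + a * (ga + x * q)  ≡⟨ lem₁ a c x g ga q ⟩
  c + a * ga + x * (g + a * q)  ≡⟨ cong (λ z → c + a * ga + x * z) (eval-quot a c′ cs x) ⟩
  c + a * ga + x * (x * q + ga) ≡⟨ lem₂ a c x ga q ⟩
  x * (ga + x * q) + (c + a * ga) ∎
  where
  open ≡-Reasoning
  g = eval (c′ ∷ cs) x
  ga = eval (c′ ∷ cs) a
  q = eval (quot a cs) x
  lem₁ : ∀ a c x g ga q → c + x * g + a * (ga + x * q) ≡ c + a * ga + x * (g + a * q)
  lem₁ = solve-∀
  lem₂ : ∀ a c x ga q → c + a * ga + x * (x * q + ga) ≡ x * (ga + x * q) + (c + a * ga)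
  lem₂ = solve-∀

module _ {p : ℕ} (pp : Prime p) where

  private
    instance
      p≢0 : NonZero p
      p≢0 = prime⇒nonZero pp

  p∤1 : ¬ p ∣ 1
  p∤1 p∣1 = <⇒≱ (1<prime pp) (∣⇒≤ p∣1)

  p∤^ : ∀ {a} k → ¬ p ∣ a → ¬ p ∣ a ^ k
  p∤^ zero p∤a = p∤1
  p∤^ {a} (suc k) p∤a d with euclidsLemma a (a ^ k) pp d
  ... | inj₁ p∣a = p∤a p∣a
  ... | inj₂ p∣a^k = p∤^ k p∤a p∣a^k

  ≈-zero-product : ∀ {x a y} → a * y ≈ x * y [ p ] → ¬ x ≈ a [ p ] → y ≈ 0 [ p ]
  ≈-zero-product {x} {a} {y} r x≉a with p ∣? y
  ... | yes p∣y = ∣⇒≈0 p∣y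
  ... | no p∤y = ⊥-elim (x≉a (≈-sym (≈-cancel y (prime-coprime pp p∤y) r)))

  -- Once a root a is split off, any root x incongruent to a satisfies (x - a) q(x) ≡ 0, hence is a
  -- root of q, whose degree is one less. The length of the coefficient list is the degree, and the
  -- constant 1 has no roots.
  lagrange : ∀ cs xs → AllPairs (λ x y → ¬ x ≈ y [ p ]) xs →
             All (λ x → eval cs x ≈ 0 [ p ]) xs → length xs ≤ length cs
  lagrange cs [] _ _ = z≤n
  lagrange [] (x ∷ xs) _ (r ∷ _) = ⊥-elim (p∤1 (≈0⇒∣ r))
  lagrange (c ∷ cs) (a ∷ xs) (a≉ ∷ d) (ra ∷ rs) =
    s≤s (subst (length xs ≤_) (length-quot a cs) (lagrange (quot a cs) xs d (All.zipWith root (a≉ , rs))))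
    where
    root : ∀ {x} → (¬ a ≈ x [ p ]) × eval (c ∷ cs) x ≈ 0 [ p ] → eval (quot a cs) x ≈ 0 [ p ]
    root {x} (a≉x , rx) = ≈-zero-product
      (≈-trans (≈-+ (≈-sym rx) ≈-refl)
        (≈-trans (≡⇒≈ (eval-quot a c cs x))
          (≈-trans (≈-+ (≈-refl {a = x * eval (quot a cs) x}) ra) (≡⇒≈ (+-identityʳ _)))))
      (a≉x ∘ ≈-sym)

  units : List ℕ
  units = range1 (p ∸ 1)

  units-< : ∀ {x} → x ∈ˡ units → x < p
  units-< x∈ = subst (_ <_) (m+[n∸m]≡n (<⇒≤ (1<prime pp))) (s≤s (proj₂ (∈-range1⁻ x∈)))

  units-∤ : ∀ {x} → x ∈ˡ units → ¬ p ∣ x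
  units-∤ {suc x} x∈ p∣x = <⇒≱ (units-< x∈) (∣⇒≤ p∣x)
  units-∤ {zero} x∈ _ with ∈-range1⁻ x∈
  ... | () , _

  units-mem : ∀ {x} → x < p → ¬ p ∣ x → x ∈ˡ units
  units-mem {zero} _ p∤0 = ⊥-elim (p∤0 (p ∣0))
  units-mem {suc x} x<p _ = ∈-range1⁺ (s≤s z≤n) (∸-monoˡ-≤ 1 x<p)

  -- Otherwise x^(d+1) - 1 would have p - 1 distinct roots, more than its degree.
  ≉1-exists : ∀ d → suc d < p ∸ 1 → ∃ λ x → (¬ p ∣ x) × ¬ x ^ suc d ≈ 1 [ p ]
  ≉1-exists d d<p-1 with All.all? (λ x → Dec-map′ (%≡⇒≈ p) (≈⇒%≡ p) (x ^ suc d % p ≟ 1 % p)) units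
  ... | no ¬all = find (Data.List.Membership.Propositional.find (¬All⇒Any¬ (λ x → Dec-map′ (%≡⇒≈ p) (≈⇒%≡ p) (x ^ suc d % p ≟ 1 % p)) units ¬all))
    where
    find : (∃ λ x → x ∈ˡ units × ¬ x ^ suc d ≈ 1 [ p ]) → _
    find (x , x∈ , x≉) = x , units-∤ x∈ , x≉
  ... | yes all = ⊥-elim (<⇒≱ d<p-1 (subst₂ _≤_ (length-range1 (p ∸ 1)) (cong suc (length-replicate d))
        (lagrange cs units distinct (All.map (λ {x} → root {x}) all))))
    where
    -- The constant term p - 1 stands for -1.
    cs = (p ∸ 1) ∷ replicate d 0
    eval-replicate : ∀ d x → eval (replicate d 0) x ≡ x ^ d
    eval-replicate zero x = refl
    eval-replicate (suc d) x = cong (λ y → x * y) (eval-replicate d x)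
    root : ∀ {x} → x ^ suc d ≈ 1 [ p ] → eval cs x ≈ 0 [ p ]
    root {x} r = ≈-trans (≈-+ (≈-refl {a = p ∸ 1}) (≈-trans (≡⇒≈ (cong (λ y → x * y) (eval-replicate d x))) r))
      (≈-trans (≡⇒≈ (m∸n+n≡m (<⇒≤ (1<prime pp)))) (∣⇒≈0 ∣-refl))
    distinct : AllPairs (λ x y → ¬ x ≈ y [ p ]) units
    distinct = tab units-< (range1-unique (p ∸ 1))
      where
      tab : ∀ {xs} → (∀ {x} → x ∈ˡ xs → x < p) → Unique xs → AllPairs (λ x y → ¬ x ≈ y [ p ]) xs
      tab _ [] = []
      tab <p (u ∷ us) = All.tabulate (λ y∈ r → All.lookup u y∈ (≈⇒≡ (<p (here refl)) (<p (there y∈)) r))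
                        ∷ tab (<p ∘ there) us

  -- Multiplication by a permutes the units. Their product is thereby multiplied by a^(p-1) yet
  -- unchanged modulo p, and being prime to p it cancels.
  fermat : ∀ {a} → ¬ p ∣ a → a ^ (p ∸ 1) ≈ 1 [ p ]
  fermat {a} p∤a = ≈-cancel (product units) (prime-coprime pp (p∤product units units-∤))
    (≈-trans (≈-sym (subst (λ l → product (map f units) ≈ a ^ l * product units [ p ])
                           (length-range1 (p ∸ 1)) (product-f units)))
      (≈-trans (≡⇒≈ (product-↭ perm)) (≡⇒≈ (sym (*-identityˡ _)))))
    where
    f : ℕ → ℕ
    f x = a * x % p
    p∤product : ∀ xs → (∀ {x} → x ∈ˡ xs → ¬ p ∣ x) → ¬ p ∣ product xs
    p∤product [] _ = p∤1
    p∤product (x ∷ xs) ∤ d with euclidsLemma x (product xs) pp d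
    ... | inj₁ d′ = ∤ (here refl) d′
    ... | inj₂ d′ = p∤product xs (∤ ∘ there) d′
    product-f : ∀ xs → product (map f xs) ≈ a ^ length xs * product xs [ p ]
    product-f [] = ≈-refl
    product-f (x ∷ xs) = ≈-trans (≈-* (≈-% (a * x) p) (product-f xs)) (≡⇒≈ (lem a x (a ^ length xs) (product xs)))
      where
      lem : ∀ a x b c → a * x * (b * c) ≡ a * b * (x * c)
      lem = solve-∀
    f∈ : ∀ {y} → y ∈ˡ map f units → y ∈ˡ units
    f∈ y∈ with ∈-map⁻ f y∈
    ... | x , x∈ , refl = units-mem (m%n<n (a * x) p) λ d → case euclidsLemma a x pp (≈-resp-∣ p ∣-refl (≈-% (a * x) p) d) of λ
      { (inj₁ d′) → p∤a d′ ; (inj₂ d′) → units-∤ x∈ d′ }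
    f-unique : Unique (map f units)
    f-unique = unique-map (λ {x} {y} x∈ y∈ eq → ≈⇒≡ (units-< x∈) (units-< y∈)
      (≈-cancel a (prime-coprime pp p∤a) (subst₂ (_≈_[ p ]) (*-comm a x) (*-comm a y) (%≡⇒≈ p eq))))
      (range1-unique (p ∸ 1))
    perm : map f units ↭ units
    perm = set⇒↭ f-unique (range1-unique (p ∸ 1)) f∈
      (pigeonhole-⊇ f-unique f∈ (≤-reflexive (sym (length-map f units))))

-- Multiplicative orders

record IsOrder (n a d : ℕ) : Set where
  field
    power≈1 : a ^ d ≈ 1 [ n ]
    divides-exponent : ∀ j → a ^ j ≈ 1 [ n ] → d ∣ j

open IsOrder

≈1-∣ : ∀ {n a d j} → a ^ d ≈ 1 [ n ] → d ∣ j → a ^ j ≈ 1 [ n ]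
≈1-∣ {n} {a} {d} r (divides q refl) =
  ≈-trans (≡⇒≈ (trans (cong (a ^_) (*-comm q d)) (sym (^-*-assoc a d q)))) (≈1-^ q r)

^-*-swap : ∀ a b j s → (a ^ s * b ^ s) ^ j ≡ a ^ (j * s) * b ^ (j * s)
^-*-swap a b j s = begin
  (a ^ s * b ^ s) ^ j         ≡⟨ ^-distribʳ-* j (a ^ s) (b ^ s) ⟩
  (a ^ s) ^ j * (b ^ s) ^ j   ≡⟨ cong₂ _*_ (^-*-assoc a s j) (^-*-assoc b s j) ⟩
  a ^ (s * j) * b ^ (s * j)   ≡⟨ cong (λ e → a ^ e * b ^ e) (*-comm s j) ⟩
  a ^ (j * s) * b ^ (j * s)   ∎
  where open ≡-Reasoning

-- If (ab)^j ≡ 1, raising to the power s removes b and leaves a^(js) ≡ 1. So r divides js, hence j;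
-- by symmetry s divides j as well.
*-order : ∀ {n a b r s} → Coprime r s → IsOrder n a r → IsOrder n b s → IsOrder n (a * b) (r * s)
*-order {n} {a} {b} {r} {s} cop oa ob = record
  { power≈1 = ≈-trans (≡⇒≈ (^-distribʳ-* (r * s) a b))
      (≈-* (≈1-∣ {a = a} {r} (power≈1 oa) (m∣m*n s)) (≈1-∣ {a = b} {s} (power≈1 ob) (n∣m*n r)))
  ; divides-exponent = λ j e → coprime-∣∣ cop
      (half cop oa ob j e)
      (half (coprime-sym cop) ob oa j (≈-trans (≡⇒≈ (cong (_^ j) (*-comm b a))) e))
  }
  where
  half : ∀ {a b r s} → Coprime r s → IsOrder n a r → IsOrder n b s → ∀ j → (a * b) ^ j ≈ 1 [ n ] → r ∣ j
  half {a} {b} {r} {s} cop oa ob j e = coprime-divisor cop (subst (r ∣_) (*-comm j s)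
    (divides-exponent oa (j * s)
      (≈-trans (≡⇒≈ (sym (*-identityʳ _)))
        (≈-trans (≈-* (≈-refl {a = a ^ (j * s)}) (≈-sym (≈1-∣ {a = b} {s} {j * s} (power≈1 ob) (n∣m*n j))))
          (≈-trans (≡⇒≈ (trans (sym (^-*-swap a b j s)) (trans (cong (_^ j) (sym (^-distribʳ-* s a b))) (trans (^-*-assoc (a * b) s j) (trans (cong ((a * b) ^_) (*-comm s j)) (sym (^-*-assoc (a * b) j s)))))))
            (≈1-^ s e))))))

-- The sequence of residues of a^k has the periods i and j, hence also their gcd; its value at 0 is
-- that of 1.
≈1-gcd : ∀ {n a i j} .{{_ : NonZero n}} → a ^ i ≈ 1 [ n ] → a ^ j ≈ 1 [ n ] → a ^ gcd i j ≈ 1 [ n ]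
≈1-gcd {n} {a} {i} {j} ri rj = %≡⇒≈ n (periodic-gcd {a = i} {j} {λ k → a ^ k % n} (periodic ri) (periodic rj) 0)
  where
  periodic : ∀ {i} → a ^ i ≈ 1 [ n ] → Periodic i (λ k → a ^ k % n)
  periodic {i} r k = ≈⇒%≡ n (≈-trans (≡⇒≈ (^-distribˡ-+-* a k i))
    (≈-trans (≈-*ˡ (a ^ k) r) (≡⇒≈ (*-identityʳ _))))

-- Look at the cofactor of d: if q divides it, one factor q cancels; if not, it is coprime to
-- q^(k+1) and divides it, so it is 1.
∣-prime-power : ∀ {q d} k → Prime q → d ∣ q ^ suc k → d ∣ q ^ k ⊎ d ≡ q ^ suc k
∣-prime-power {q} {d} k pq (divides c eq) with q ∣? c
... | yes (divides e refl) = inj₁ (divides e (*-cancelˡ-≡ _ _ q {{prime⇒nonZero pq}}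
        (trans eq (lem e q d))))
  where
  lem : ∀ e q d → e * q * d ≡ q * (e * d)
  lem = solve-∀
... | no q∤c = inj₂ (sym (trans eq (trans (cong (_* d) c≡1) (*-identityˡ d))))
  where
  c≡1 : c ≡ 1
  c≡1 = coprime-^ˡ (suc k) (prime-coprime pq q∤c) (divides d (trans eq (*-comm c d)) , ∣-refl)

-- Whenever a^j ≡ 1, the same holds for the exponent gcd(j, q^(k+1)). Were this a proper divisor of
-- q^(k+1), it would divide q^k, which is excluded.
prime-power-order : ∀ {n a q} k .{{_ : NonZero n}} → Prime q →
  a ^ (q ^ suc k) ≈ 1 [ n ] → ¬ a ^ (q ^ k) ≈ 1 [ n ] → IsOrder n a (q ^ suc k)
prime-power-order {n} {a} {q} k pq r ¬r = record
  { power≈1 = r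
  ; divides-exponent = λ j rj → case ∣-prime-power k pq (gcd[m,n]∣n j (q ^ suc k)) of λ
      { (inj₁ d) → ⊥-elim (¬r (≈1-∣ {a = a} {gcd j (q ^ suc k)} (≈1-gcd {i = j} {q ^ suc k} rj r) d))
      ; (inj₂ e) → subst (_∣ j) e (gcd[m,n]∣m j (q ^ suc k)) } }

split-power : ∀ {q} → 1 < q → ∀ d .{{_ : NonZero d}} → ∃ λ k → ∃ λ e → d ≡ q ^ k * e × ¬ q ∣ e
split-power {q} 1<q d = go d (<-wellFounded d)
  where
  go : ∀ d .{{_ : NonZero d}} → Acc _<_ d → ∃ λ k → ∃ λ e → d ≡ q ^ k * e × ¬ q ∣ e
  go d (acc rec) with q ∣? d
  ... | no q∤d = 0 , d , sym (+-identityʳ d) , q∤d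
  ... | yes q∣d with go (quotient q∣d) {{quotient≢0 q∣d}}
                        (rec (quotient-< q∣d {{ℕ.n>1⇒nonTrivial 1<q}}))
  ...   | k , e , eq , q∤e = suc k , e ,
          trans (m∣n⇒n≡m*quotient q∣d) (trans (cong (q *_) eq) (sym (*-assoc q (q ^ k) e))) , q∤e

prime-divisor : ∀ d .{{_ : NonZero d}} → d ≡ 1 ⊎ ∃ λ q → Prime q × q ∣ d
prime-divisor d = go (factorise d)
  where
  go : PrimeFactorisation d → _
  go record { factors = [] ; isFactorisation = eq } = inj₁ eq
  go record { factors = q ∷ qs ; isFactorisation = refl ; factorsPrime = pq ∷ _ } = inj₂ (q , pq , m∣m*n (product qs))

module _ {p : ℕ} (pp : Prime p) where

  private
    instance
      p≢0 : NonZero p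
      p≢0 = prime⇒nonZero pp

  private
    0<p-1 : 0 < p ∸ 1
    0<p-1 = ∸-monoˡ-≤ 1 (1<prime pp)

    instance
      p-1≢0 : NonZero (p ∸ 1)
      p-1≢0 = ℕ.>-nonZero 0<p-1

  -- If a is not a root of x^((p−1)/q) = 1 then a^((p−1)/q^(k+1)) has order q^(k+1).
  prime-power-element : ∀ {q} k → Prime q → q ^ suc k ∣ p ∸ 1 → ∃ λ a → IsOrder p a (q ^ suc k)
  -- Here c q^k = (p - 1)/q, which is below p - 1 because q > 1; `≉1-exists` takes the exponent as a
  -- successor.
  prime-power-element {q} k pq (divides c eq) = build (≉1-exists pp (ℕ.pred (c * q ^ k))
      (subst₂ _<_ (sym (suc-pred _)) (trans (lem c (q ^ k) q) (sym eq)) (m<m*n (c * q ^ k) q (1<prime pq))))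
    where
    lem : ∀ c b q → c * b * q ≡ c * (q * b)
    lem = solve-∀
    instance
      c≢0 : NonZero c
      c≢0 = ℕ.≢-nonZero λ { refl → ℕ.≢-nonZero⁻¹ (p ∸ 1) eq }
      q≢0 : NonZero q
      q≢0 = prime⇒nonZero pq
      qk≢0 : NonZero (q ^ k)
      qk≢0 = m^n≢0 q k
      cqk≢0 : NonZero (c * q ^ k)
      cqk≢0 = m*n≢0 c (q ^ k)
    build : (∃ λ x → (¬ p ∣ x) × ¬ x ^ suc (ℕ.pred (c * q ^ k)) ≈ 1 [ p ]) → _
    build (x , p∤x , ¬r) = x ^ c , prime-power-order k pq
      (≈-trans (≡⇒≈ (trans (^-*-assoc x c (q ^ suc k)) (cong (x ^_) (sym eq)))) (fermat pp p∤x))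
      (λ r → ¬r (≈-trans (≡⇒≈ (trans (cong (x ^_) (suc-pred (c * q ^ k))) (sym (^-*-assoc x c (q ^ k))))) r))

  -- Induction on d, removing the full power of one prime q at a time: the remaining factor e is
  -- coprime to it, so the two orders multiply.
  element-of-order : ∀ d .{{_ : NonZero d}} → d ∣ p ∸ 1 → ∃ λ a → IsOrder p a d
  element-of-order d = go d (<-wellFounded d)
    where
    go : ∀ d .{{_ : NonZero d}} → Acc _<_ d → d ∣ p ∸ 1 → ∃ λ a → IsOrder p a d
    go d (acc rec) d∣ with prime-divisor d
    ... | inj₁ refl = 1 , record { power≈1 = ≈-refl ; divides-exponent = λ j _ → 1∣ j }
    ... | inj₂ (q , pq , q∣d) with split-power (1<prime pq) d
    ...   | zero , e , refl , q∤e = ⊥-elim (q∤e (subst (q ∣_) (*-identityˡ e) q∣d))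
    ...   | suc k , e , refl , q∤e =
            combine (prime-power-element k pq (∣-trans (m∣m*n e) d∣)) (go e (rec e<) (∣-trans (n∣m*n (q ^ suc k)) d∣))
      where
      instance
        e≢0 : NonZero e
        e≢0 = ℕ.≢-nonZero λ { refl → q∤e (q ∣0) }
      e< : e < q ^ suc k * e
      e< = subst (e <_) (*-comm e _) (m<m*n e (q ^ suc k)
        (≤-trans (1<prime pq) (m≤m*n q (q ^ k) {{m^n≢0 q k {{prime⇒nonZero pq}}}})))
      combine : (∃ λ a → IsOrder p a (q ^ suc k)) → (∃ λ b → IsOrder p b e) → ∃ λ a → IsOrder p a (q ^ suc k * e)
      combine (a , oa) (b , ob) = a * b , *-order (coprime-^ˡ (suc k) (prime-coprime pq q∤e)) oa ob

  primitive-root : ∃ λ g → IsOrder p g (p ∸ 1)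
  primitive-root = element-of-order (p ∸ 1) ∣-refl

-- Primitive roots modulo prime powers, and sums over gcds

triangular : ℕ → ℕ
triangular zero = 0
triangular (suc n) = triangular n + n

2*triangular : ∀ n → 2 * triangular n + n ≡ n * n
2*triangular zero = refl
2*triangular (suc n) = trans (lem₁ (triangular n) n) (trans (cong (_+ (n + suc n)) (2*triangular n)) (lem₂ n))
  where
  lem₁ : ∀ t n → 2 * (t + n) + suc n ≡ 2 * t + n + (n + suc n)
  lem₁ = solve-∀
  lem₂ : ∀ n → n * n + (n + suc n) ≡ suc n * suc n
  lem₂ = solve-∀

-- The binomial theorem modulo y³; `triangular n` is n(n - 1)/2, the coefficient of y².
binomial-cubic : ∀ y n → ∃ λ z → (1 + y) ^ n ≡ 1 + n * y + triangular n * (y * y) + y * y * y * z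
binomial-cubic y zero = 0 , lem y
  where
  lem : ∀ y → 1 ≡ 1 + 0 * y + 0 * (y * y) + y * y * y * 0
  lem = solve-∀
binomial-cubic y (suc n) with binomial-cubic y n
... | z , eq = triangular n + z + y * z , trans (cong ((1 + y) *_) eq) (lem y n (triangular n) z)
  where
  lem : ∀ y n t z → (1 + y) * (1 + n * y + t * (y * y) + y * y * y * z)
        ≡ 1 + suc n * y + (t + n) * (y * y) + y * y * y * (t + z + y * z)
  lem = solve-∀

-- Sort the r by d = gcd(r, h). Writing r = d x turns this condition into gcd(x, h/d) = 1 with 1 ≤ x
-- ≤ h/d, which φ(h/d) values of x satisfy.
∑-gcd : ∀ h .{{_ : NonZero h}} (F : ℕ → ℕ) →
        ∑ (range1 h) (λ r → F (gcd r h)) ≡ ∑ (divisors h) (λ d → φ (divN h d) * F d)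
∑-gcd h F = begin
  ∑ (range1 h) (λ r → F (gcd r h))
    ≡⟨ ∑-cong (range1 h) (λ r∈ → sym (pick r∈)) ⟩
  ∑ (range1 h) (λ r → ∑ (divisors h) (λ d → ⟦ gcd r h ≟ d ⟧ * F d))
    ≡⟨ ∑-swap (range1 h) (divisors h) _ ⟩
  ∑ (divisors h) (λ d → ∑ (range1 h) (λ r → ⟦ gcd r h ≟ d ⟧ * F d))
    ≡⟨ ∑-cong (divisors h) (λ {d} d∈ → trans (∑-*ʳ (range1 h) _ (F d))
         (cong (_* F d) (trans (sym (#-∑ (λ r → gcd r h ≟ d) (range1 h))) (sym (φ-count d d∈))))) ⟩
  ∑ (divisors h) (λ d → φ (divN h d) * F d) ∎
  where
  open ≡-Reasoning
  pick : ∀ {r} → r ∈ˡ range1 h → ∑ (divisors h) (λ d → ⟦ gcd r h ≟ d ⟧ * F d) ≡ F (gcd r h)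
  pick {r} r∈ = trans
    (∑-single (Unique.filter⁺ (_∣? h) (range1-unique h)) _
      (∈-filter⁺ (_∣? h) (∈-range1⁺ 1≤g (∣⇒≤ (gcd[m,n]∣n r h))) (gcd[m,n]∣n r h))
      (λ {d} _ d≢ → cong (_* F d) (⟦⟧-no (gcd r h ≟ d) (d≢ ∘ sym))))
    (trans (cong (_* F (gcd r h)) (⟦⟧-yes (gcd r h ≟ gcd r h) refl)) (*-identityˡ _))
    where
    1≤g : 1 ≤ gcd r h
    1≤g = n≢0⇒n>0 (Data.Nat.GCD.gcd[m,n]≢0 r h (inj₂ (ℕ.≢-nonZero⁻¹ h)))
  φ-count : ∀ d → d ∈ˡ divisors h → φ (divN h d) ≡ # (λ r → gcd r h ≟ d) (range1 h)
  φ-count d d∈ with ∈-filter⁻ (_∣? h) {xs = range1 h} d∈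
  φ-count zero d∈ | d∈' , _ with ∈-range1⁻ d∈'
  ... | () , _
  φ-count d@(suc _) d∈ | _ , d∣h =
    #-bijection (λ k → gcd k e ≟ 1) (λ r → gcd r h ≟ d) (d *_) (range1-unique e) (range1-unique h)
      (λ {x} {y} _ _ → *-cancelˡ-≡ x y d)
      to from
    where
    e = h / d
    d*e : d * e ≡ h
    d*e = m*[n/m]≡n d∣h
    to : ∀ {x} → x ∈ˡ range1 e → gcd x e ≡ 1 → d * x ∈ˡ range1 h × gcd (d * x) h ≡ d
    to {x} x∈ g with ∈-range1⁻ x∈
    ... | 1≤x , x≤e =
      ∈-range1⁺ (*-mono-≤ {1} {d} {1} {x} (s≤s z≤n) 1≤x) (≤-trans (*-monoʳ-≤ d x≤e) (≤-reflexive d*e)) ,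
      trans (cong (gcd (d * x)) (sym d*e)) (trans (sym (c*gcd[m,n]≡gcd[cm,cn] d x e)) (trans (cong (d *_) g) (*-identityʳ d)))
    from : ∀ {y} → y ∈ˡ range1 h → gcd y h ≡ d → ∃ λ x → x ∈ˡ range1 e × gcd x e ≡ 1 × y ≡ d * x
    from {y} y∈ g with subst (_∣ y) g (gcd[m,n]∣m y h) | ∈-range1⁻ y∈
    ... | divides x refl | 1≤y , y≤h = x ,
      ∈-range1⁺ (n≢0⇒n>0 λ { refl → <⇒≱ 1≤y z≤n })
        (*-cancelˡ-≤ d (≤-trans (≤-reflexive (*-comm d x)) (≤-trans y≤h (≤-reflexive (sym d*e))))) ,
      *-cancelˡ-≡ _ _ d (trans (c*gcd[m,n]≡gcd[cm,cn] d x e)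
        (trans (cong₂ gcd (*-comm d x) d*e) (trans g (sym (*-identityʳ d))))) ,
      *-comm x d

module _ {p : ℕ} (pp : Prime p) (p≢2 : p ≢ 2) where

  private
    instance
      p≢0 : NonZero p
      p≢0 = prime⇒nonZero pp

  p∤2 : ¬ p ∣ 2
  p∤2 d = p≢2 (≤-antisym (∣⇒≤ d) (1<prime pp))

  -- From 2 · `triangular p` + p = p², since p is odd. For p = 2 the value is 1.
  p∣triangular : p ∣ triangular p
  p∣triangular = coprime-divisor (prime-coprime pp p∤2)
    (∣m+n∣m⇒∣n (subst (p ∣_) (trans (sym (2*triangular p)) (+-comm _ p)) (m∣m*n p)) ∣-refl)

  -- With y = p^(a+1) t the linear term p y is the main term. The quadratic term has the further
  -- factor p of `triangular p`, so it is divisible by p^(2a+3), and the rest by p^(3a+3); both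
  -- exponents are at least a + 3.
  lift-power : ∀ a t → ∃ λ s → (1 + p ^ suc a * t) ^ p ≡ 1 + p ^ suc (suc a) * (t + p * s)
  lift-power a t with binomial-cubic (p ^ suc a * t) p | p∣triangular
  ... | z , eq | divides T eqT = t * y′ * (T + y′ * z) ,
    trans eq (trans (cong (λ x → 1 + p * (p ^ suc a * t) + x * (p ^ suc a * t * (p ^ suc a * t)) + p ^ suc a * t * (p ^ suc a * t) * (p ^ suc a * t) * z) eqT)
      (lem p (p ^ a) t T z))
    where
    y′ = p ^ a * t
    lem : ∀ p q t T z → 1 + p * (p * q * t) + T * p * (p * q * t * (p * q * t)) + p * q * t * (p * q * t) * (p * q * t) * z
          ≡ 1 + p * (p * q) * (t + p * (t * (q * t) * (T + q * t * z)))
    lem = solve-∀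

  lift-powers : ∀ t b → ∃ λ s → (1 + p * t) ^ (p ^ b) ≡ 1 + p ^ suc b * (t + p * s)
  lift-powers t zero = 0 , lem p t
    where
    lem : ∀ p t → (1 + p * t) * 1 ≡ 1 + p * 1 * (t + p * 0)
    lem = solve-∀
  lift-powers t (suc b) with lift-powers t b
  ... | s , eq with lift-power b (t + p * s)
  ... | s′ , eq′ = s + s′ , (begin
    (1 + p * t) ^ (p * p ^ b)           ≡⟨ cong ((1 + p * t) ^_) (*-comm p (p ^ b)) ⟩
    (1 + p * t) ^ (p ^ b * p)           ≡⟨ sym (^-*-assoc (1 + p * t) (p ^ b) p) ⟩
    ((1 + p * t) ^ (p ^ b)) ^ p         ≡⟨ cong (_^ p) eq ⟩
    (1 + p ^ suc b * (t + p * s)) ^ p   ≡⟨ eq′ ⟩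
    1 + p ^ suc (suc b) * (t + p * s + p * s′) ≡⟨ cong (λ x → 1 + p ^ suc (suc b) * x) (lem t p s s′) ⟩
    1 + p ^ suc (suc b) * (t + p * (s + s′)) ∎)
    where
    open ≡-Reasoning
    lem : ∀ t p s s′ → t + p * s + p * s′ ≡ t + p * (s + s′)
    lem = solve-∀

  ≈1-lift : ∀ {x} b → x ≈ 1 [ p ] → x ^ (p ^ b) ≈ 1 [ p ^ suc b ]
  ≈1-lift {zero} b r = ⊥-elim (p∤1 pp (≈0⇒∣ (≈-sym r)))
  ≈1-lift {suc x} b r with ≈⇒∣ 1 r
  ... | divides t refl with lift-powers t b
  ... | s , eq = ≈-trans (≡⇒≈ (trans (cong (λ z → (1 + z) ^ (p ^ b)) (*-comm t p)) eq)) (∣⇒≈ 1 (m∣m*n _))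

  -- By `lift-powers`, (1 + p)^(p^a) = 1 + p^(a+1) (1 + p s). The factor 1 + p s is prime to p, so
  -- this power is 1 modulo p^(a+1) but not modulo p^(a+2).
  order-1+p : ∀ a → IsOrder (p ^ suc a) (1 + p) (p ^ a)
  order-1+p zero = record
    { power≈1 = subst (λ n → (1 + p) ^ 1 ≈ 1 [ n ]) (sym (*-identityʳ p)) (≈-trans (≡⇒≈ (*-identityʳ _)) (∣⇒≈ 1 ∣-refl))
    ; divides-exponent = λ j _ → 1∣ j }
  order-1+p (suc a) = prime-power-order a {{m^n≢0 p (suc (suc a))}} pp
    (≈1-lift (suc a) (∣⇒≈ 1 ∣-refl)) λ r → absurd r (lift-powers 1 a)
    where
    absurd : (1 + p) ^ (p ^ a) ≈ 1 [ p ^ suc (suc a) ] →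
          ¬ ∃ λ s → (1 + p * 1) ^ (p ^ a) ≡ 1 + p ^ suc a * (1 + p * s)
    absurd r (s , eq) = p∤1 pp (∣m+n∣m⇒∣n (subst (p ∣_) (+-comm 1 (p * s))
      (*-cancelˡ-∣ (p ^ suc a) {{m^n≢0 p (suc a)}}
        (subst (_∣ p ^ suc a * (1 + p * s)) (*-comm p (p ^ suc a))
          (≈⇒∣ 1 (≈-trans (≡⇒≈ (trans (sym eq) (cong (λ z → (1 + z) ^ (p ^ a)) (*-identityʳ p)))) r)))))
      (m∣m*n s))

  -- The generator is the product of a lift of order p − 1 and 1 + p.
  primitive-root-power : ∀ m → ∃ λ g → ∀ a → a ≤ m → IsOrder (p ^ suc a) g (p ^ a * (p ∸ 1))
  primitive-root-power m = from (primitive-root pp)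
    where
    coprime-p-1 : Coprime p (p ∸ 1)
    coprime-p-1 = prime-coprime pp λ d → <⇒≱ (∸-monoʳ-< {p} {1} {0} (s≤s z≤n) (<⇒≤ (1<prime pp)))
      (∣⇒≤ {{ℕ.>-nonZero (∸-monoˡ-≤ 1 (1<prime pp))}} d)
    from : (∃ λ g → IsOrder p g (p ∸ 1)) → _
    -- The exponent p^m makes the (p - 1)-th power 1 modulo p^(m+1), hence modulo every smaller
    -- p^(a+1). Being prime to p - 1, it does not lower the order p - 1 of g modulo p.
    from (g , og) = (1 + p) * g ^ (p ^ m) , λ a a≤m →
      *-order (coprime-^ˡ a coprime-p-1) (order-1+p a) record
        { power≈1 = ≈-weaken (subst (p ^ suc a ∣_) (trans (sym (^-distribˡ-+-* p (suc a) (m ∸ a))) (cong (λ e → p ^ suc e) (m+[n∸m]≡n a≤m))) (m∣m*n (p ^ (m ∸ a))))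
            (≈-trans (≡⇒≈ (trans (^-*-assoc g (p ^ m) (p ∸ 1)) (trans (cong (g ^_) (*-comm (p ^ m) (p ∸ 1))) (sym (^-*-assoc g (p ∸ 1) (p ^ m))))))
              (≈1-lift m (IsOrder.power≈1 og)))
        ; divides-exponent = λ j r → coprime-divisor (coprime-sym (coprime-^ˡ m coprime-p-1))
            (IsOrder.divides-exponent og (p ^ m * j)
              (≈-trans (≡⇒≈ (sym (^-*-assoc g (p ^ m) j))) (≈-weaken (m∣m*n (p ^ a)) r))) }

  -- Each of 1, ..., p^(a+1) is either a multiple of p or coprime to p^(a+1), and p^a of them are
  -- multiples.
  φ-prime-power : ∀ a → φ (p ^ suc a) ≡ p ^ a * (p ∸ 1)
  φ-prime-power a = begin
    φ (p * M)                 ≡⟨ sym (m+n∸m≡n M (φ (p * M))) ⟩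
    M + φ (p * M) ∸ M         ≡⟨ cong (_∸ M) total ⟩
    p * M ∸ M                 ≡⟨ cong₂ _∸_ (*-comm p M) (sym (*-identityʳ M)) ⟩
    M * p ∸ M * 1             ≡⟨ sym (*-distribˡ-∸ M p 1) ⟩
    M * (p ∸ 1)               ∎
    where
    open ≡-Reasoning
    M = p ^ a
    coprime-iff : ∀ {k} → ¬ p ∣ k → gcd k (p * M) ≡ 1
    coprime-iff p∤k = coprime⇒gcd≡1 (coprime-sym (coprime-^ˡ (suc a) (prime-coprime pp p∤k)))
    multiples : # (p ∣?_) (range1 (p * M)) ≡ M
    multiples = trans (sym (#-bijection (λ _ → yes tt) (p ∣?_) {range1 M} (p *_)
        (range1-unique M) (range1-unique (p * M)) (λ {x} {y} _ _ → *-cancelˡ-≡ x y p) to from))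
      (trans (#-all (range1 M)) (length-range1 M))
      where
      to : ∀ {x} → x ∈ˡ range1 M → ⊤ → p * x ∈ˡ range1 (p * M) × p ∣ p * x
      to {x} x∈ _ = ∈-range1⁺ (*-mono-≤ (ℕ.>-nonZero⁻¹ p) (proj₁ (∈-range1⁻ x∈))) (*-monoʳ-≤ p (proj₂ (∈-range1⁻ x∈))) , m∣m*n x
      from : ∀ {y} → y ∈ˡ range1 (p * M) → p ∣ y → ∃ λ x → x ∈ˡ range1 M × ⊤ × y ≡ p * x
      from y∈ (divides x refl) = x , ∈-range1⁺ (n≢0⇒n>0 λ { refl → <⇒≱ (proj₁ (∈-range1⁻ y∈)) z≤n })
        (*-cancelˡ-≤ p (≤-trans (≤-reflexive (*-comm p x)) (proj₂ (∈-range1⁻ y∈)))) , tt , *-comm x p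
    total : M + φ (p * M) ≡ p * M
    total = begin
      M + φ (p * M) ≡⟨ cong₂ _+_
          (trans (sym multiples) (#-∑ (p ∣?_) (range1 (p * M))))
          (#-∑ (λ k → gcd k (p * M) ≟ 1) (range1 (p * M))) ⟩
      _ ≡⟨ sym (∑-+ (range1 (p * M)) _ _) ⟩
      _ ≡⟨ ∑-cong (range1 (p * M)) (λ {k} _ → one k) ⟩
      _ ≡⟨ ∑-const (range1 (p * M)) 1 ⟩
      length (range1 (p * M)) * 1 ≡⟨ *-identityʳ _ ⟩
      length (range1 (p * M)) ≡⟨ length-range1 (p * M) ⟩
      p * M ∎
      where
      one : ∀ k → ⟦ p ∣? k ⟧ + ⟦ gcd k (p * M) ≟ 1 ⟧ ≡ 1
      one k with p ∣? k
      ... | yes p∣k = cong suc (⟦⟧-no (gcd k (p * M) ≟ 1)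
              λ g → p∤1 pp (subst (p ∣_) g (gcd-greatest p∣k (m∣m*n M))))
      ... | no p∤k = ⟦⟧-yes (gcd k (p * M) ≟ 1) (coprime-iff p∤k)

-- Generating functions

-- One entry per sublist, repetitions kept: the generating function of this list is the product of
-- the factors 1 + x^s.
subsums : List ℕ → List ℕ
subsums [] = [ 0 ]
subsums (s ∷ ss) = subsums ss ++ map (λ x → s + x) (subsums ss)

length-subsums : ∀ ss → length (subsums ss) ≡ 2 ^ length ss
length-subsums [] = refl
length-subsums (s ∷ ss) = trans (length-++ (subsums ss))
  (cong₂ _+_ (length-subsums ss)
    (trans (length-map _ (subsums ss)) (trans (length-subsums ss) (sym (+-identityʳ _)))))

-- Formal power series and coefficients of polynomials

Series : Set
Series = ℕ → ℤ

infix 4 _≗ˢ_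
_≗ˢ_ : Series → Series → Set
f ≗ˢ g = ∀ k → f k ≡ g k

-- The Cauchy product, unrolled along the first factor to match the recursion of `pmul`.
conv : Series → Series → Series
conv f g zero = f 0 ℤ.* g 0
conv f g (suc k) = f 0 ℤ.* g (suc k) ℤ.+ conv (f ∘ suc) g k

conv-cong : ∀ {f f′ g g′} → f ≗ˢ f′ → g ≗ˢ g′ → conv f g ≗ˢ conv f′ g′
conv-cong ef eg zero = cong₂ ℤ._*_ (ef 0) (eg 0)
conv-cong ef eg (suc k) = cong₂ ℤ._+_ (cong₂ ℤ._*_ (ef 0) (eg (suc k))) (conv-cong (ef ∘ suc) eg k)

conv-+ : ∀ f f′ g → conv (λ k → f k ℤ.+ f′ k) g ≗ˢ (λ k → conv f g k ℤ.+ conv f′ g k)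
conv-+ f f′ g zero = ℤₚ.*-distribʳ-+ (g 0) (f 0) (f′ 0)
conv-+ f f′ g (suc k) = trans
  (cong₂ ℤ._+_ (ℤₚ.*-distribʳ-+ (g (suc k)) (f 0) (f′ 0)) (conv-+ (f ∘ suc) (f′ ∘ suc) g k))
  (interchange (f 0 ℤ.* g (suc k)) (f′ 0 ℤ.* g (suc k)) _ _)
  where
  interchange : ∀ a b c d → (a ℤ.+ b) ℤ.+ (c ℤ.+ d) ≡ (a ℤ.+ c) ℤ.+ (b ℤ.+ d)
  interchange = ℤ-solve-∀

conv-*ˡ : ∀ c f g → conv (λ k → c ℤ.* f k) g ≗ˢ (λ k → c ℤ.* conv f g k)
conv-*ˡ c f g zero = ℤₚ.*-assoc c (f 0) (g 0)
conv-*ˡ c f g (suc k) = trans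
  (cong₂ ℤ._+_ (ℤₚ.*-assoc c (f 0) (g (suc k))) (conv-*ˡ c (f ∘ suc) g k))
  (sym (ℤₚ.*-distribˡ-+ c _ _))

conv-zero : ∀ g → conv (λ _ → ℤ.+ 0) g ≗ˢ (λ _ → ℤ.+ 0)
conv-zero g zero = ℤₚ.*-zeroˡ (g 0)
conv-zero g (suc k) = cong₂ ℤ._+_ (ℤₚ.*-zeroˡ (g (suc k))) (conv-zero g k)

δ : Series
δ zero = ℤ.+ 1
δ (suc _) = ℤ.+ 0

conv-δ : ∀ g → conv δ g ≗ˢ g
conv-δ g zero = ℤₚ.*-identityˡ (g 0)
conv-δ g (suc k) = trans (cong₂ ℤ._+_ (ℤₚ.*-identityˡ (g (suc k))) (conv-zero g k)) (ℤₚ.+-identityʳ _)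

-- Multiplication by x^s.
delay : ℕ → Series → Series
delay zero f = f
delay (suc s) f zero = ℤ.+ 0
delay (suc s) f (suc k) = delay s f k

delay-cong : ∀ s {f g} → f ≗ˢ g → delay s f ≗ˢ delay s g
delay-cong zero e = e
delay-cong (suc s) e zero = refl
delay-cong (suc s) e (suc k) = delay-cong s e k

conv-delay : ∀ s f g → conv (delay s f) g ≗ˢ delay s (conv f g)
conv-delay zero f g k = refl
conv-delay (suc s) f g zero = ℤₚ.*-zeroˡ (g 0)
conv-delay (suc s) f g (suc k) =
  trans (cong₂ ℤ._+_ (ℤₚ.*-zeroˡ (g (suc k))) (conv-delay s f g k)) (ℤₚ.+-identityˡ _)

multiplicity : List ℕ → Series
multiplicity ws k = ℤ.+ # (_≟ k) ws

multiplicity-shift : ∀ s ws → multiplicity (map (λ x → s + x) ws) ≗ˢ delay s (multiplicity ws)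
multiplicity-shift s ws k = trans (cong ℤ.+_ (#-map (_≟ k) (λ x → s + x) ws)) (go s k)
  where
  go : ∀ s k → ℤ.+ # (λ x → s + x ≟ k) ws ≡ delay s (multiplicity ws) k
  go zero k = refl
  go (suc s) zero = cong (ℤ.+_ ∘ length) (filter-none (λ x → suc s + x ≟ 0) (All.universal (λ _ ()) ws))
  go (suc s) (suc k) = trans
    (cong ℤ.+_ (#-cong (λ x → suc s + x ≟ suc k) (λ x → s + x ≟ k) ws (λ _ → suc-injective) (λ _ → cong suc)))
    (go s k)

sumSeries : List ℕ → Series
sumSeries ss = multiplicity (subsums ss)

sumSeries-[] : sumSeries [] ≗ˢ δ
sumSeries-[] zero = refl
sumSeries-[] (suc k) = refl

sumSeries-∷ : ∀ s ss → sumSeries (s ∷ ss) ≗ˢ (λ k → sumSeries ss k ℤ.+ delay s (sumSeries ss) k)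
sumSeries-∷ s ss k = trans (cong ℤ.+_ (#-++ (_≟ k) (subsums ss) _))
  (cong (λ z → sumSeries ss k ℤ.+ z) (multiplicity-shift s (subsums ss) k))

-- A head s contributes the factor 1 + x^s, that is one plain and one delayed copy of the series of
-- the tail, and `conv` respects both sums and delays of its first argument.
conv-sumSeries : ∀ ss ts → conv (sumSeries ss) (sumSeries ts) ≗ˢ sumSeries (ss ++ ts)
conv-sumSeries [] ts k = trans (conv-cong sumSeries-[] (λ _ → refl) k) (conv-δ (sumSeries ts) k)
conv-sumSeries (s ∷ ss) ts k = begin
  conv (sumSeries (s ∷ ss)) (sumSeries ts) k
    ≡⟨ conv-cong (sumSeries-∷ s ss) (λ _ → refl) k ⟩
  conv (λ k → sumSeries ss k ℤ.+ delay s (sumSeries ss) k) (sumSeries ts) k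
    ≡⟨ conv-+ (sumSeries ss) (delay s (sumSeries ss)) (sumSeries ts) k ⟩
  conv (sumSeries ss) (sumSeries ts) k ℤ.+ conv (delay s (sumSeries ss)) (sumSeries ts) k
    ≡⟨ cong₂ ℤ._+_ (conv-sumSeries ss ts k)
        (trans (conv-delay s (sumSeries ss) (sumSeries ts) k) (delay-cong s (conv-sumSeries ss ts) k)) ⟩
  sumSeries (ss ++ ts) k ℤ.+ delay s (sumSeries (ss ++ ts)) k
    ≡⟨ sym (sumSeries-∷ s (ss ++ ts) k) ⟩
  sumSeries (s ∷ ss ++ ts) k ∎
  where open ≡-Reasoning

coeff-padd : ∀ p q k → coeff (padd p q) k ≡ coeff p k ℤ.+ coeff q k
coeff-padd [] q k = sym (ℤₚ.+-identityˡ _)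
coeff-padd (a ∷ p) [] k = sym (ℤₚ.+-identityʳ _)
coeff-padd (a ∷ p) (b ∷ q) zero = refl
coeff-padd (a ∷ p) (b ∷ q) (suc k) = coeff-padd p q k

coeff-pscale : ∀ c p k → coeff (pscale c p) k ≡ c ℤ.* coeff p k
coeff-pscale c [] k = sym (ℤₚ.*-zeroʳ c)
coeff-pscale c (a ∷ p) zero = refl
coeff-pscale c (a ∷ p) (suc k) = coeff-pscale c p k

coeff-pmul : ∀ p q → coeff (pmul p q) ≗ˢ conv (coeff p) (coeff q)
coeff-pmul [] q k = sym (conv-zero (coeff q) k)
coeff-pmul (a ∷ p) q zero = trans (coeff-padd (pscale a q) _ 0) (trans (ℤₚ.+-identityʳ _) (coeff-pscale a q 0))
coeff-pmul (a ∷ p) q (suc k) = trans (coeff-padd (pscale a q) _ (suc k))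
  (cong₂ ℤ._+_ (coeff-pscale a q (suc k)) (coeff-pmul p q k))

coeff-pone : coeff pone ≗ˢ δ
coeff-pone zero = refl
coeff-pone (suc k) = refl

coeff-xpow : ∀ s → coeff (xpow s) ≗ˢ delay s δ
coeff-xpow zero = coeff-pone
coeff-xpow (suc s) zero = refl
coeff-xpow (suc s) (suc k) = coeff-xpow s k

coeff-psub-one : ∀ p k → coeff (psub p pone) k ≡ coeff p k ℤ.+ (ℤ.- ℤ.+ 1) ℤ.* δ k
coeff-psub-one p k = trans (coeff-padd p _ k)
  (cong (λ z → coeff p k ℤ.+ z) (trans (coeff-pscale (ℤ.- ℤ.+ 1) pone k) (cong (λ z → (ℤ.- ℤ.+ 1) ℤ.* z) (coeff-pone k))))

coeff-psum : ∀ {A : Set} (f : A → Poly) (g : A → ℕ) xs k → (∀ {x} → x ∈ˡ xs → coeff (f x) k ≡ ℤ.+ g x) →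
             coeff (psum (map f xs)) k ≡ ℤ.+ ∑ xs g
coeff-psum f g [] k e = refl
coeff-psum f g (x ∷ xs) k e = trans (coeff-padd (f x) _ k) (cong₂ ℤ._+_ (e (here refl)) (coeff-psum f g xs k (e ∘ there)))

coeff-binomial : ∀ s → coeff (padd pone (xpow s)) ≗ˢ sumSeries [ s ]
coeff-binomial s k = trans (coeff-padd pone (xpow s) k) (trans
  (cong₂ ℤ._+_ (trans (coeff-pone k) (sym (sumSeries-[] k)))
    (trans (coeff-xpow s k) (sym (delay-cong s sumSeries-[] k))))
  (sym (sumSeries-∷ s [] k)))

coeff-ppow : ∀ s e → coeff (ppow (padd pone (xpow s)) e) ≗ˢ sumSeries (replicate e s)
coeff-ppow s zero k = trans (coeff-pone k) (sym (sumSeries-[] k))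
coeff-ppow s (suc e) k = trans (coeff-pmul (padd pone (xpow s)) _ k)
  (trans (conv-cong (coeff-binomial s) (coeff-ppow s e) k) (conv-sumSeries [ s ] (replicate e s) k))

coeff-pprod : ∀ {A : Set} (s e : A → ℕ) xs →
  coeff (pprod (map (λ x → ppow (padd pone (xpow (s x))) (e x)) xs))
    ≗ˢ sumSeries (concatMap (λ x → replicate (e x) (s x)) xs)
coeff-pprod s e [] k = trans (coeff-pone k) (sym (sumSeries-[] k))
coeff-pprod s e (x ∷ xs) k = trans (coeff-pmul (ppow (padd pone (xpow (s x))) (e x)) _ k)
  (trans (conv-cong (coeff-ppow (s x) (e x)) (coeff-pprod s e xs) k)
    (conv-sumSeries (replicate (e x) (s x)) _ k))

-- This is (A - 1) B = A B - B. In terms of sums, the choices that take nothing from `ss` are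
-- removed.
coeff-pmul-psub-one : ∀ p q ss ts → coeff p ≗ˢ sumSeries ss → coeff q ≗ˢ sumSeries ts → ∀ k →
  coeff (pmul (psub p pone) q) k ≡ sumSeries (ss ++ ts) k ℤ.- sumSeries ts k
coeff-pmul-psub-one p q ss ts ep eq k = begin
  coeff (pmul (psub p pone) q) k
    ≡⟨ coeff-pmul (psub p pone) q k ⟩
  conv (coeff (psub p pone)) (coeff q) k
    ≡⟨ conv-cong (λ k → trans (coeff-psub-one p k) (cong (ℤ._+ (ℤ.- ℤ.+ 1) ℤ.* δ k) (ep k))) eq k ⟩
  conv (λ k → sumSeries ss k ℤ.+ (ℤ.- ℤ.+ 1) ℤ.* δ k) (sumSeries ts) k
    ≡⟨ conv-+ (sumSeries ss) _ (sumSeries ts) k ⟩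
  conv (sumSeries ss) (sumSeries ts) k ℤ.+ conv (λ k → (ℤ.- ℤ.+ 1) ℤ.* δ k) (sumSeries ts) k
    ≡⟨ cong₂ ℤ._+_ (conv-sumSeries ss ts k)
        (trans (conv-*ˡ (ℤ.- ℤ.+ 1) δ (sumSeries ts) k)
          (trans (cong (λ z → (ℤ.- ℤ.+ 1) ℤ.* z) (conv-δ (sumSeries ts) k)) (ℤₚ.-1*i≡-i _))) ⟩
  sumSeries (ss ++ ts) k ℤ.- sumSeries ts k ∎
  where open ≡-Reasoning

-- Subsets that are unions of classes

bit : Bool → ℕ
bit true = 1
bit false = 0

∣tabulate∣ : ∀ {n} (f : Fin n → Bool) → ∣ Vec.tabulate f ∣ ≡ ∑ (allFin n) (bit ∘ f)
∣tabulate∣ f = trans (go f) (cong sum (sym (Listₚ.map-tabulate id (bit ∘ f))))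
  where
  go : ∀ {n} (f : Fin n → Bool) → ∣ Vec.tabulate f ∣ ≡ sum (Data.List.tabulate (bit ∘ f))
  go {zero} f = refl
  go {suc n} f with f zero
  ... | true  = cong suc (go (f ∘ suc))
  ... | false = go (f ∘ suc)

allSubsets : ∀ n → List (Subset n)
allSubsets zero = [ [] ]
allSubsets (suc n) = map (false ∷_) (allSubsets n) ++ map (true ∷_) (allSubsets n)

allSubsets-unique : ∀ n → Unique (allSubsets n)
allSubsets-unique zero = [] ∷ []
allSubsets-unique (suc n) = Unique.++⁺
  (Unique.map⁺ Vecₚ.∷-injectiveʳ (allSubsets-unique n)) (Unique.map⁺ Vecₚ.∷-injectiveʳ (allSubsets-unique n))
  λ (x∈ , y∈) → case (∈-map⁻ (false ∷_) x∈ , ∈-map⁻ (true ∷_) y∈) of λ { ((_ , _ , refl) , (_ , _ , ())) }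

∈-allSubsets : ∀ {n} (Ω : Subset n) → Ω ∈ˡ allSubsets n
∈-allSubsets [] = here refl
∈-allSubsets (false ∷ Ω) = ∈-++⁺ˡ (∈-map⁺ (false ∷_) (∈-allSubsets Ω))
∈-allSubsets {suc n} (true ∷ Ω) = ∈-++⁺ʳ (map (false ∷_) (allSubsets n)) (∈-map⁺ (true ∷_) (∈-allSubsets Ω))

module Labelling {n : ℕ} {L : Set} (_≟ᴸ_ : (s t : L) → Dec (s ≡ t)) (label : Fin n → L) where

  activate : L → (L → Bool) → L → Bool
  activate t f l = if does (l ≟ᴸ t) then true else f l

  activate-same : ∀ t f → activate t f t ≡ true
  activate-same t f with t ≟ᴸ t
  ... | yes _ = refl
  ... | no t≢t = ⊥-elim (t≢t refl)

  activate-other : ∀ {t l} f → l ≢ t → activate t f l ≡ f l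
  activate-other {t} {l} f l≢t with l ≟ᴸ t
  ... | yes l≡t = ⊥-elim (l≢t l≡t)
  ... | no _ = refl

  -- Enumerated in the same order as `subsums`, so that `union-sizes` is an equality of lists.
  indicators : List L → List (L → Bool)
  indicators [] = [ (λ _ → false) ]
  indicators (t ∷ ts) = indicators ts ++ map (activate t) (indicators ts)

  union : (L → Bool) → Subset n
  union f = Vec.tabulate (f ∘ label)

  classSize : L → ℕ
  classSize t = # (λ x → label x ≟ᴸ t) (allFin n)

  indicators-false : ∀ ts {f l} → f ∈ˡ indicators ts → l ∉ˡ ts → f l ≡ false
  indicators-false [] (here refl) _ = refl
  indicators-false (t ∷ ts) f∈ l∉ with ∈-++⁻ (indicators ts) f∈
  ... | inj₁ f∈′ = indicators-false ts f∈′ (l∉ ∘ there)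
  ... | inj₂ f∈′ with ∈-map⁻ (activate t) f∈′
  ... | f , f∈″ , refl = trans (activate-other f (l∉ ∘ here)) (indicators-false ts f∈″ (l∉ ∘ there))

  indicators-complete : ∀ {ts} → Unique ts → (b : L → Bool) → (∀ {l} → l ∉ˡ ts → b l ≡ false) →
                        ∃ λ f → f ∈ˡ indicators ts × (∀ l → f l ≡ b l)
  indicators-complete {[]} _ b off = _ , here refl , λ l → sym (off λ ())
  indicators-complete {t ∷ ts} (u ∷ us) b off = extend (indicators-complete us b′ off′)
    where
    b′ : L → Bool
    b′ l = if does (l ≟ᴸ t) then false else b l
    off′ : ∀ {l} → l ∉ˡ ts → b′ l ≡ false
    off′ {l} l∉ with l ≟ᴸ t
    ... | yes _ = refl
    ... | no l≢t = off λ { (here l≡t) → l≢t l≡t ; (there l∈) → l∉ l∈ }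
    extend : (∃ λ f → f ∈ˡ indicators ts × (∀ l → f l ≡ b′ l)) →
             ∃ λ f → f ∈ˡ indicators (t ∷ ts) × (∀ l → f l ≡ b l)
    extend (f , f∈ , f≗b′) with b t in bt
    ... | true = activate t f , ∈-++⁺ʳ (indicators ts) (∈-map⁺ (activate t) f∈) , agree
      where
      agree : ∀ l → activate t f l ≡ b l
      agree l with l ≟ᴸ t | f≗b′ l
      ... | yes refl | _ = sym bt
      ... | no _ | e = e
    ... | false = f , ∈-++⁺ˡ f∈ , agree
      where
      agree : ∀ l → f l ≡ b l
      agree l with l ≟ᴸ t | f≗b′ l
      ... | yes refl | e = trans e (sym bt)
      ... | no _ | e = e

  ∣union-activate∣ : ∀ t f → f t ≡ false → ∣ union (activate t f) ∣ ≡ classSize t + ∣ union f ∣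
  ∣union-activate∣ t f ft = begin
    ∣ union (activate t f) ∣                            ≡⟨ ∣tabulate∣ (activate t f ∘ label) ⟩
    ∑ (allFin n) (λ x → bit (activate t f (label x)))   ≡⟨ ∑-cong (allFin n) (λ {x} _ → split x) ⟩
    ∑ (allFin n) (λ x → ⟦ label x ≟ᴸ t ⟧ + bit (f (label x))) ≡⟨ ∑-+ (allFin n) _ _ ⟩
    _ ≡⟨ cong₂ _+_ (sym (#-∑ (λ x → label x ≟ᴸ t) (allFin n))) (sym (∣tabulate∣ (f ∘ label))) ⟩
    classSize t + ∣ union f ∣ ∎
    where
    open ≡-Reasoning
    split : ∀ x → bit (activate t f (label x)) ≡ ⟦ label x ≟ᴸ t ⟧ + bit (f (label x))
    split x with label x ≟ᴸ t
    ... | yes refl = cong suc (sym (cong bit ft))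
    ... | no _ = refl

  union-sizes : ∀ {ts} → Unique ts → map (∣_∣ ∘ union) (indicators ts) ≡ subsums (map classSize ts)
  union-sizes {[]} _ = cong [_] (trans (∣tabulate∣ {n} (λ _ → false)) (∑-zero (allFin n) λ _ → refl))
  union-sizes {t ∷ ts} (u ∷ us) = trans (map-++ _ (indicators ts) _)
    (cong₂ _++_ (union-sizes us)
      (trans (sym (map-∘ (indicators ts)))
        (trans (Listₚ.map-cong-local (All.tabulate λ {f} f∈ →
                  ∣union-activate∣ t f (indicators-false ts f∈ (unique-head∉ (u ∷ us)))))
          (trans (map-∘ (indicators ts)) (cong (map (λ x → classSize t + x)) (union-sizes us))))))

  -- Distinctness comes with a label at which the values differ: an element carrying that label then
  -- separates the two unions.
  indicators-distinct : ∀ {ts} → Unique ts →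
    AllPairs (λ f g → ∃ λ t → t ∈ˡ ts × f t ≢ g t) (indicators ts)
  indicators-distinct {[]} _ = [] ∷ []
  indicators-distinct {t ∷ ts} (u ∷ us) = AllPairsₚ.++⁺
    (AllPairs.map (λ (l , l∈ , ne) → l , there l∈ , ne) ih)
    (AllPairsₚ.map⁺ (AllPairs.map keep ih))
    (All.tabulate λ {f} f∈ → All.tabulate λ {g} g∈ → t , here refl , differ f∈ (∈-map⁻ (activate t) g∈))
    where
    t∉ : t ∉ˡ ts
    t∉ = unique-head∉ (u ∷ us)
    ih = indicators-distinct us
    keep : ∀ {f g} → (∃ λ l → l ∈ˡ ts × f l ≢ g l) →
           ∃ λ l → l ∈ˡ t ∷ ts × activate t f l ≢ activate t g l
    keep {f} {g} (l , l∈ , ne) = l , there l∈ , λ e →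
      ne (trans (sym (activate-other f l≢t)) (trans e (activate-other g l≢t)))
      where
      l≢t : l ≢ t
      l≢t refl = t∉ l∈
    differ : ∀ {f g} → f ∈ˡ indicators ts → (∃ λ g′ → g′ ∈ˡ indicators ts × g ≡ activate t g′) → f t ≢ g t
    differ f∈ (g′ , _ , refl) e with trans (sym (indicators-false ts f∈ t∉)) (trans e (activate-same t g′))
    ... | ()

  -- The subsets satisfying P are put in bijection with `indicators ts`, whose sizes are known from
  -- `union-sizes`. The hypothesis `realised` excludes empty classes, which would make different
  -- indicators give the same union.
  union-count : ∀ {ts} → Unique ts → (∀ {t} → t ∈ˡ ts → ∃ λ x → label x ≡ t) →
    {P : Subset n → Set} (P? : Decidable P) {Q : ℕ → Set} (Q? : Decidable Q) →
    (∀ f → (∀ {l} → l ∉ˡ ts → f l ≡ false) → P (union f)) →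
    (∀ Ω → P Ω → ∃ λ b → (∀ x → Vec.lookup Ω x ≡ b (label x)) × (∀ {l} → l ∉ˡ ts → b l ≡ false)) →
    # (λ Ω → P? Ω ×-dec Q? ∣ Ω ∣) (allSubsets n) ≡ # Q? (subsums (map classSize ts))
  union-count {ts} uts realised {P} P? {Q} Q? sound complete = begin
    # (λ Ω → P? Ω ×-dec Q? ∣ Ω ∣) (allSubsets n)
      ≡⟨ #-bijection _ (Q? ∘ ∣_∣) id (allSubsets-unique n) unions-unique (λ _ _ → id) to from ⟩
    # (Q? ∘ ∣_∣) (map union (indicators ts))
      ≡⟨ #-map (Q? ∘ ∣_∣) union (indicators ts) ⟩
    # (Q? ∘ ∣_∣ ∘ union) (indicators ts)
      ≡⟨ sym (#-map Q? (∣_∣ ∘ union) (indicators ts)) ⟩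
    # Q? (map (∣_∣ ∘ union) (indicators ts))
      ≡⟨ cong (# Q?) (union-sizes uts) ⟩
    # Q? (subsums (map classSize ts)) ∎
    where
    open ≡-Reasoning
    unions-unique : Unique (map union (indicators ts))
    unions-unique = AllPairsₚ.map⁺ (AllPairs.map ne (indicators-distinct uts))
      where
      ne : ∀ {f g} → (∃ λ t → t ∈ˡ ts × f t ≢ g t) → union f ≢ union g
      ne {f} {g} (t , t∈ , f≢g) e with realised t∈
      ... | x , refl = f≢g (trans (sym (Vecₚ.lookup∘tabulate (f ∘ label) x))
        (trans (cong (λ Ω → Vec.lookup Ω x) e) (Vecₚ.lookup∘tabulate (g ∘ label) x)))
    to : ∀ {Ω} → Ω ∈ˡ allSubsets n → P Ω × Q ∣ Ω ∣ → Ω ∈ˡ map union (indicators ts) × Q ∣ Ω ∣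
    to {Ω} _ (pΩ , q) with complete Ω pΩ
    ... | b , Ω≗b , off with indicators-complete uts b off
    ... | f , f∈ , f≗b = subst (_∈ˡ map union (indicators ts))
          (trans (Vecₚ.tabulate-cong (λ x → trans (f≗b (label x)) (sym (Ω≗b x)))) (Vecₚ.tabulate∘lookup Ω))
          (∈-map⁺ union f∈) , q
    from : ∀ {Ω} → Ω ∈ˡ map union (indicators ts) → Q ∣ Ω ∣ →
           ∃ λ Ω′ → Ω′ ∈ˡ allSubsets n × (P Ω′ × Q ∣ Ω′ ∣) × Ω ≡ Ω′
    from {Ω} Ω∈ q with ∈-map⁻ union Ω∈
    ... | f , f∈ , refl = _ , ∈-allSubsets _ , (sound f (indicators-false ts f∈) , q) , refl

-- Burnside's lemma for a cyclic group

module Representatives {A : Set} {_~_ : A → A → Set} (_~?_ : (x y : A) → Dec (x ~ y)) where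

  representatives : List A → List A
  representatives [] = []
  representatives (x ∷ xs) with Any.any? (x ~?_) (representatives xs)
  ... | yes _ = representatives xs
  ... | no  _ = x ∷ representatives xs

  representatives-⊆ : ∀ xs {x} → x ∈ˡ representatives xs → x ∈ˡ xs
  representatives-⊆ (x ∷ xs) y∈ with Any.any? (x ~?_) (representatives xs)
  representatives-⊆ (x ∷ xs) y∈ | yes _ = there (representatives-⊆ xs y∈)
  representatives-⊆ (x ∷ xs) (here eq) | no _ = here eq
  representatives-⊆ (x ∷ xs) (there y∈) | no _ = there (representatives-⊆ xs y∈)

  representatives-distinct : ∀ xs → AllPairs (λ x y → ¬ x ~ y) (representatives xs)
  representatives-distinct [] = []
  representatives-distinct (x ∷ xs) with Any.any? (x ~?_) (representatives xs)
  ... | yes _ = representatives-distinct xs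
  ... | no ¬any = ¬Any⇒All¬ _ ¬any ∷ representatives-distinct xs

  representatives-cover : ∀ xs → (∀ {x} → x ∈ˡ xs → x ~ x) →
                          ∀ {x} → x ∈ˡ xs → ∃ λ y → y ∈ˡ representatives xs × x ~ y
  representatives-cover (x ∷ xs) refl~ y∈ with Any.any? (x ~?_) (representatives xs)
  representatives-cover (x ∷ xs) refl~ (here refl) | yes any = Data.List.Membership.Propositional.find any
  representatives-cover (x ∷ xs) refl~ (there y∈) | yes _ = representatives-cover xs (refl~ ∘ there) y∈
  representatives-cover (x ∷ xs) refl~ (here refl) | no _ = x , here refl , refl~ (here refl)
  representatives-cover (x ∷ xs) refl~ (there y∈) | no _ with representatives-cover xs (refl~ ∘ there) y∈
  ... | z , z∈ , y~z = z , there z∈ , y~z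

-- Both sides are the sum of G over 1, ..., n + 1.
∑-range1-shift : ∀ n (G : ℕ → ℕ) → G 1 + ∑ (range1 n) (G ∘ suc) ≡ ∑ (range1 n) G + G (suc n)
∑-range1-shift n G = begin
  G 1 + ∑ (range1 n) (G ∘ suc)
    ≡⟨ cong (λ l → G 1 + ∑ l (G ∘ suc)) (Listₚ.map-upTo suc n) ⟩
  G 1 + ∑ (applyUpTo suc n) (G ∘ suc)
    ≡⟨ cong (λ l → G 1 + l) (sym (∑-map suc (applyUpTo suc n) G)) ⟩
  ∑ (range1 (suc n)) G
    ≡⟨ cong (λ l → ∑ (map suc l) G) (sym (Listₚ.upTo-∷ʳ n)) ⟩
  ∑ (map suc (upTo n ++ [ n ])) G
    ≡⟨ trans (cong (λ l → ∑ l G) (map-++ suc (upTo n) [ n ]))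
        (trans (cong sum (map-++ G (range1 n) _)) (sum-++ (map G (range1 n)) _)) ⟩
  ∑ (range1 n) G + (G (suc n) + 0)
    ≡⟨ cong (λ z → ∑ (range1 n) G + z) (+-identityʳ _) ⟩
  ∑ (range1 n) G + G (suc n) ∎
  where open ≡-Reasoning

∑-periodic : ∀ n {G : ℕ → ℕ} → Periodic n G → ∀ j → ∑ (range1 n) (λ r → G (r + j)) ≡ ∑ (range1 n) G
∑-periodic n {G} per zero = ∑-cong (range1 n) λ {r} _ → cong G (+-identityʳ r)
∑-periodic n {G} per (suc j) = trans (∑-cong (range1 n) λ {r} _ → cong G (+-suc r j))
  (trans (+-cancelˡ-≡ (G (1 + j)) _ _ (trans (∑-range1-shift n (λ r → G (r + j)))
      (trans (+-comm (∑ (range1 n) (λ r → G (r + j))) (G (suc n + j))) (cong (_+ ∑ (range1 n) (λ r → G (r + j))) (trans (cong G (lem n j)) (per (1 + j)))))))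
    (∑-periodic n per j))
  where
  lem : ∀ n j → suc n + j ≡ 1 + j + n
  lem = solve-∀

-- A cyclic group of order h is presented as an action of ℕ whose h-th step is trivial on `X`.
-- Triviality is asked on `X` only, because g^h fixes just the symmetric sets.
module Burnside {A : Set} (_≟ᴬ_ : (x y : A) → Dec (x ≡ y)) (h : ℕ) .{{_ : NonZero h}}
  (σ : ℕ → A → A) (X : List A) (X-unique : Unique X)
  (σ-+ : ∀ i j x → σ (i + j) x ≡ σ i (σ j x))
  (σ-0 : ∀ x → σ 0 x ≡ x)
  (σ-h : ∀ {x} → x ∈ˡ X → σ h x ≡ x)
  (σ-closed : ∀ j {x} → x ∈ˡ X → σ j x ∈ˡ X) where

  σ-periodic : ∀ {x} → x ∈ˡ X → Periodic h (λ j → σ j x)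
  σ-periodic {x} x∈ i = trans (σ-+ i h x) (cong (σ i) (σ-h x∈))

  -- The exponent is bounded by h to make the relation decidable; `∃⇒~` admits every exponent.
  _~_ : A → A → Set
  x ~ y = Any (λ r → σ r y ≡ x) (range1 h)

  _~?_ : ∀ x y → Dec (x ~ y)
  x ~? y = Any.any? (λ r → σ r y ≟ᴬ x) (range1 h)

  ~⇒∃ : ∀ {x y} → x ~ y → ∃ λ j → σ j y ≡ x
  ~⇒∃ x~y with Data.List.Membership.Propositional.find x~y
  ... | r , _ , e = r , e

  ∃⇒~ : ∀ {x y} → y ∈ˡ X → ∀ j → σ j y ≡ x → x ~ y
  ∃⇒~ {x} {y} y∈ j e = Data.List.Membership.Propositional.lose r∈
    (trans (periodic-≈ {i = r} {j} {λ j → σ j y} (σ-periodic y∈) r≈j) e)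
    where
    -- The representative of j in 1, ..., h: one less is j + (h - 1) modulo h, and `suc` restores
    -- it.
    r = suc ((j + ℕ.pred h) % h)
    r∈ : r ∈ˡ range1 h
    r∈ = ∈-range1⁺ (s≤s z≤n) (m%n<n (j + ℕ.pred h) h)
    r≈j : r ≈ j [ h ]
    r≈j = ≈-trans (≈-+ (≈-refl {a = 1}) (≈-% (j + ℕ.pred h) h))
      (≈-trans (≡⇒≈ (trans (sym (+-suc j _)) (cong (λ z → j + z) (suc-pred h)))) (∣⇒≈ j ∣-refl))

  σ-inverse : ∀ j {x} → x ∈ˡ X → σ (ℕ.pred h * j) (σ j x) ≡ x
  σ-inverse j {x} x∈ = trans (sym (σ-+ (ℕ.pred h * j) j x))
    (trans (periodic-≈ {i = ℕ.pred h * j + j} {0} {λ j → σ j x} (σ-periodic x∈)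
      (∣⇒≈0 (subst (h ∣_) (trans (cong (_* j) (sym (suc-pred h))) (+-comm j _)) (m∣m*n j))))
    (σ-0 x))

  ~-sym : ∀ {x y} → x ∈ˡ X → y ∈ˡ X → x ~ y → y ~ x
  ~-sym x∈ y∈ x~y with ~⇒∃ x~y
  ... | j , refl = ∃⇒~ x∈ (ℕ.pred h * j) (σ-inverse j y∈)

  ~-trans : ∀ {x y z} → z ∈ˡ X → x ~ y → y ~ z → x ~ z
  ~-trans z∈ x~y y~z with ~⇒∃ x~y | ~⇒∃ y~z
  ... | i , refl | j , refl = ∃⇒~ z∈ (i + j) (σ-+ i j _)

  ~-refl : ∀ {x} → x ∈ˡ X → x ~ x
  ~-refl x∈ = ∃⇒~ x∈ 0 (σ-0 _)

  open Representatives _~?_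

  reps : List A
  reps = representatives X

  reps-∈ : ∀ {x} → x ∈ˡ reps → x ∈ˡ X
  reps-∈ = representatives-⊆ X

  reps-unique : Unique reps
  reps-unique = unique reps-∈ (representatives-distinct X)
    where
    unique : ∀ {R} → (∀ {x} → x ∈ˡ R → x ∈ˡ X) → AllPairs (λ x y → ¬ x ~ y) R → Unique R
    unique _ [] = []
    unique sub (¬~ ∷ d) = All.map (λ { ¬x~y refl → ¬x~y (~-refl (sub (here refl))) }) ¬~ ∷ unique (sub ∘ there) d

  reps-inequivalent : ∀ {x y} → x ∈ˡ reps → y ∈ˡ reps → x ~ y → x ≡ y
  reps-inequivalent = inequivalent reps-∈ (representatives-distinct X)
    where
    inequivalent : ∀ {R} → (∀ {x} → x ∈ˡ R → x ∈ˡ X) → AllPairs (λ x y → ¬ x ~ y) R →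
                   ∀ {x y} → x ∈ˡ R → y ∈ˡ R → x ~ y → x ≡ y
    inequivalent _ (_ ∷ _) (here refl) (here refl) _ = refl
    inequivalent _ (¬~ ∷ _) (here refl) (there y∈) x~y = ⊥-elim (All.lookup ¬~ y∈ x~y)
    inequivalent sub (¬~ ∷ _) (there x∈) (here refl) x~y =
      ⊥-elim (All.lookup ¬~ x∈ (~-sym (sub (there x∈)) (sub (here refl)) x~y))
    inequivalent sub (_ ∷ d) (there x∈) (there y∈) = inequivalent (sub ∘ there) d x∈ y∈

  reps-cover : ∀ {x} → x ∈ˡ X → ∃ λ y → y ∈ˡ reps × x ~ y
  reps-cover = representatives-cover X ~-refl

  transporters : A → A → ℕ
  transporters x y = ∑ (range1 h) (λ r → ⟦ σ r x ≟ᴬ y ⟧)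

  transporters-total : ∀ {x} → x ∈ˡ X → ∑ X (transporters x) ≡ h
  transporters-total {x} x∈ = begin
    ∑ X (transporters x)
      ≡⟨ ∑-swap X (range1 h) _ ⟩
    ∑ (range1 h) (λ r → ∑ X (λ y → ⟦ σ r x ≟ᴬ y ⟧))
      ≡⟨ ∑-cong (range1 h) (λ {r} _ → trans
           (∑-single X-unique _ (σ-closed r x∈) (λ {y} _ y≢ → ⟦⟧-no (σ r x ≟ᴬ y) (y≢ ∘ sym)))
           (⟦⟧-yes (σ r x ≟ᴬ σ r x) refl)) ⟩
    ∑ (range1 h) (λ _ → 1)
      ≡⟨ trans (∑-const (range1 h) 1) (trans (*-identityʳ _) (length-range1 h)) ⟩
    h ∎
    where open ≡-Reasoning

  -- If y = σ j x, then σ r y = σ (r + j) x, and a sum over a full period does not change under the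
  -- shift by j. This plays the part of the orbit-stabiliser theorem.
  transporters-stabiliser : ∀ {x y} → x ∈ˡ X → y ~ x → transporters x y ≡ transporters y y
  transporters-stabiliser {x} x∈ y~x with ~⇒∃ y~x
  ... | j , refl = trans
    (sym (∑-periodic h {λ r → ⟦ σ r x ≟ᴬ σ j x ⟧} (λ i → cong (λ z → ⟦ z ≟ᴬ σ j x ⟧) (σ-periodic x∈ i)) j))
    (∑-cong (range1 h) λ {r} _ → cong (λ z → ⟦ z ≟ᴬ σ j x ⟧) (σ-+ r j x))

  transporters-none : ∀ {x y} → x ∈ˡ X → ¬ y ~ x → transporters x y ≡ 0
  transporters-none {x} {y} x∈ ¬~ = ∑-zero (range1 h) λ {r} _ → ⟦⟧-no (σ r x ≟ᴬ y) (¬~ ∘ ∃⇒~ x∈ r)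

  transporters-reps : ∀ {y} → y ∈ˡ X → ∑ reps (λ x → transporters x y) ≡ transporters y y
  transporters-reps {y} y∈ with reps-cover y∈
  ... | x , x∈ , y~x = trans
    (∑-single reps-unique _ x∈ λ {z} z∈ z≢x → transporters-none (reps-∈ z∈)
      λ y~z → z≢x (reps-inequivalent z∈ x∈ (~-trans (reps-∈ x∈) (~-sym y∈ (reps-∈ z∈) y~z) y~x)))
    (transporters-stabiliser (reps-∈ x∈) y~x)

  -- Count the triples of a representative x, an element y of `X` and an r with σ r x = y. Each x
  -- contributes h, one for each r; each y is reached only from the representative of its orbit, as
  -- often as it is fixed itself.
  burnside : length reps * h ≡ ∑ (range1 h) (λ r → # (λ x → σ r x ≟ᴬ x) X)
  burnside = begin
    length reps * h
      ≡⟨ sym (∑-const reps h) ⟩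
    ∑ reps (λ _ → h)
      ≡⟨ ∑-cong reps (λ x∈ → sym (transporters-total (reps-∈ x∈))) ⟩
    ∑ reps (λ x → ∑ X (transporters x))
      ≡⟨ ∑-swap reps X _ ⟩
    ∑ X (λ y → ∑ reps (λ x → transporters x y))
      ≡⟨ ∑-cong X transporters-reps ⟩
    ∑ X (λ y → transporters y y)
      ≡⟨ ∑-swap X (range1 h) _ ⟩
    ∑ (range1 h) (λ r → ∑ X (λ y → ⟦ σ r y ≟ᴬ y ⟧))
      ≡⟨ ∑-cong (range1 h) (λ {r} _ → sym (#-∑ (λ x → σ r x ≟ᴬ x) X)) ⟩
    ∑ (range1 h) (λ r → # (λ x → σ r x ≟ᴬ x) X) ∎
    where open ≡-Reasoning

-- Residues as elements of Fin n

module _ {n : ℕ} where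

  fin-≈ : {a b : Fin n} → toℕ a ≈ toℕ b [ n ] → a ≡ b
  fin-≈ {a} {b} r = Finₚ.toℕ-injective (≈⇒≡ (Finₚ.toℕ<n a) (Finₚ.toℕ<n b) r)

  toℕ-mod : .{{_ : NonZero n}} → ∀ x → toℕ (x mod n) ≈ x [ n ]
  toℕ-mod x = ≈-trans (≡⇒≈ (Finₚ.toℕ-fromℕ< (m%n<n x n))) (≈-% x n)

  abstract
    residue : .{{_ : NonZero n}} → ℕ → Fin n
    residue x = x mod n

    toℕ-residue : .{{_ : NonZero n}} → ∀ x → toℕ (residue x) ≈ x [ n ]
    toℕ-residue = toℕ-mod

  residue-≈ : .{{_ : NonZero n}} → ∀ {x y} → x ≈ y [ n ] → residue x ≡ residue y
  residue-≈ {x} {y} r = fin-≈ (≈-trans (toℕ-residue x) (≈-trans r (≈-sym (toℕ-residue y))))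

  residue-≈⁻ : .{{_ : NonZero n}} → ∀ {x y} → residue x ≡ residue y → x ≈ y [ n ]
  residue-≈⁻ {x} {y} e = ≈-trans (≈-sym (toℕ-residue x)) (≈-trans (≡⇒≈ (cong toℕ e)) (toℕ-residue y))

  residue-toℕ : .{{_ : NonZero n}} → ∀ a → residue (toℕ a) ≡ a
  residue-toℕ a = fin-≈ (toℕ-residue (toℕ a))

toℕ-⊕ : ∀ {n} (a b : Fin n) → toℕ (a ⊕ b) ≈ toℕ a + toℕ b [ n ]
toℕ-⊕ {suc n} a b = toℕ-mod (toℕ a + toℕ b)

toℕ-⊖ : ∀ {n} (a : Fin n) → toℕ (⊖ a) + toℕ a ≈ 0 [ n ]
toℕ-⊖ {suc n} a = ≈-trans (≈-+ (toℕ-mod (suc n ∸ toℕ a)) (≈-refl {a = toℕ a}))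
  (≈-trans (≡⇒≈ (m∸n+n≡m (<⇒≤ (Finₚ.toℕ<n a)))) (∣⇒≈0 ∣-refl))

≈-+-cancelʳ : ∀ {n a b} c → a + c ≈ b + c [ n ] → a ≈ b [ n ]
≈-+-cancelʳ {n} {a} {b} c (witness s t e) = witness s t (+-cancelʳ-≡ c _ _
  (trans (lem a s n c) (trans e (sym (lem b t n c)))))
  where
  lem : ∀ a s n c → a + s * n + c ≡ a + c + s * n
  lem = solve-∀

⊖-unique : ∀ {n} {a b : Fin n} → toℕ b + toℕ a ≈ 0 [ n ] → ⊖ a ≡ b
⊖-unique {a = a} r = fin-≈ (≈-+-cancelʳ (toℕ a) (≈-trans (toℕ-⊖ a) (≈-sym r)))

sub-≈ : ∀ {n} {a b c : Fin n} → toℕ a ≈ toℕ b + toℕ c [ n ] → a ⊕ (⊖ c) ≡ b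
sub-≈ {n} {a} {b} {c} r = fin-≈ (≈-trans (toℕ-⊕ a (⊖ c)) (≈-trans (≈-+ r ≈-refl)
  (≈-trans (≡⇒≈ (+-assoc (toℕ b) (toℕ c) _))
    (≈-trans (≈-+ (≈-refl {a = toℕ b}) (≈-trans (≡⇒≈ (+-comm (toℕ c) _)) (toℕ-⊖ c))) (≡⇒≈ (+-identityʳ _))))))

sub-+ : ∀ {n} (a c : Fin n) → toℕ a ≈ toℕ (a ⊕ (⊖ c)) + toℕ c [ n ]
sub-+ {n} a c = ≈-sym (≈-trans (≈-+ (toℕ-⊕ a (⊖ c)) ≈-refl)
  (≈-trans (≡⇒≈ (+-assoc (toℕ a) _ _)) (≈-trans (≈-+ (≈-refl {a = toℕ a}) (toℕ-⊖ c)) (≡⇒≈ (+-identityʳ _)))))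

∈⇒lookup : ∀ {n} {Ω : Subset n} {x} → x ∈ Ω → Vec.lookup Ω x ≡ true
∈⇒lookup = Vecₚ.[]=⇒lookup

lookup⇒∈ : ∀ {n} {Ω : Subset n} {x} → Vec.lookup Ω x ≡ true → x ∈ Ω
lookup⇒∈ {Ω = Ω} {x} = Vecₚ.lookup⇒[]= x Ω

subset-ext : ∀ {n} {Ω Ω′ : Subset n} → (∀ x → Vec.lookup Ω x ≡ Vec.lookup Ω′ x) → Ω ≡ Ω′
subset-ext {Ω = Ω} {Ω′} e = trans (sym (Vecₚ.tabulate∘lookup Ω)) (trans (Vecₚ.tabulate-cong e) (Vecₚ.tabulate∘lookup Ω′))

iff⇒≡ : ∀ {a b : Bool} → (a ≡ true → b ≡ true) → (b ≡ true → a ≡ true) → a ≡ b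
iff⇒≡ {false} {false} f g = refl
iff⇒≡ {false} {true} f g = g refl
iff⇒≡ {true} {false} f g = sym (f refl)
iff⇒≡ {true} {true} f g = refl

module Multiplication {n : ℕ} .{{_ : NonZero n}} where

  infixr 7 _·_
  _·_ : ℕ → Fin n → Fin n
  u · x = residue (u * toℕ x)

  toℕ-· : ∀ u x → toℕ (u · x) ≈ u * toℕ x [ n ]
  toℕ-· u x = toℕ-residue (u * toℕ x)

  ·-residue : ∀ u x → u · residue x ≡ residue (u * x)
  ·-residue u x = residue-≈ (≈-*ˡ u (toℕ-residue x))

  ·-assoc : ∀ u v x → u · v · x ≡ (u * v) · x
  ·-assoc u v x = trans (·-residue u (v * toℕ x)) (cong residue (sym (*-assoc u v (toℕ x))))

  ·-cong : ∀ {u v} x → u ≈ v [ n ] → u · x ≡ v · x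
  ·-cong x r = residue-≈ (≈-*ʳ (toℕ x) r)

  1· : ∀ {u} x → u ≈ 1 [ n ] → u · x ≡ x
  1· {u} x r = trans (·-cong x r) (trans (cong residue (*-identityˡ (toℕ x))) (residue-toℕ x))

  ·-⊕ : ∀ u a b → u · (a ⊕ b) ≡ (u · a) ⊕ (u · b)
  ·-⊕ u a b = fin-≈ (≈-trans (toℕ-· u (a ⊕ b)) (≈-trans (≈-*ˡ u (toℕ-⊕ a b))
    (≈-trans (≡⇒≈ (*-distribˡ-+ u (toℕ a) (toℕ b)))
      (≈-sym (≈-trans (toℕ-⊕ (u · a) (u · b)) (≈-+ (toℕ-· u a) (toℕ-· u b)))))))

  ·-bij : ∀ {u v} → u * v ≈ 1 [ n ] → Bij (u ·_)
  ·-bij {u} {v} r = (λ {x} {y} e → trans (sym (back x)) (trans (cong (v ·_) e) (back y))) ,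
    λ y → v · y , λ { refl → trans (·-assoc u v y) (1· y r) }
    where
    back : ∀ x → v · u · x ≡ x
    back x = trans (·-assoc v u x) (1· x (≈-trans (≡⇒≈ (*-comm v u)) r))

  -- Put u = α(1). Additivity gives α(k) = k u, and a preimage of 1 is an inverse of u.
  aut-multiplier : ∀ {α : Fin n → Fin n} → IsAut α →
    ∃ λ u → (∃ λ v → u * v ≈ 1 [ n ]) × (∀ x → α x ≡ u · x)
  aut-multiplier {α} ((_ , surj) , hom) = u , invertible , α≡
    where
    u = toℕ (α (residue 1))
    at-residue : ∀ k → toℕ (α (residue k)) ≈ k * u [ n ]
    at-residue zero = ≈-+-cancelʳ (toℕ (α (residue 0)))
      (≈-sym (≈-trans (≡⇒≈ (cong (toℕ ∘ α) 0≡0+0)) (≈-trans (≡⇒≈ (cong toℕ (hom (residue 0) (residue 0)))) (toℕ-⊕ _ _))))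
      where
      0≡0+0 : residue 0 ≡ residue 0 ⊕ residue 0
      0≡0+0 = fin-≈ (≈-sym (≈-trans (toℕ-⊕ (residue 0) (residue 0)) (≈-trans (≈-+ (toℕ-residue 0) ≈-refl) ≈-refl)))
    at-residue (suc k) = ≈-trans (≡⇒≈ (cong (toℕ ∘ α) suc≡)) (≈-trans (≡⇒≈ (cong toℕ (hom (residue 1) (residue k))))
      (≈-trans (toℕ-⊕ _ _) (≈-+ (≈-refl {a = u}) (at-residue k))))
      where
      suc≡ : residue (suc k) ≡ residue 1 ⊕ residue k
      suc≡ = fin-≈ (≈-trans (toℕ-residue (suc k)) (≈-sym (≈-trans (toℕ-⊕ (residue 1) (residue k)) (≈-+ (toℕ-residue 1) (toℕ-residue k)))))
    α≡ : ∀ x → α x ≡ u · x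
    α≡ x = fin-≈ (≈-trans (≡⇒≈ (cong (toℕ ∘ α) (sym (residue-toℕ x)))) (≈-trans (at-residue (toℕ x))
      (≈-trans (≡⇒≈ (*-comm (toℕ x) u)) (≈-sym (toℕ-· u x)))))
    invertible : ∃ λ v → u * v ≈ 1 [ n ]
    invertible with surj (residue 1)
    ... | x , eq = toℕ x , ≈-trans (≈-sym (toℕ-· u x))
      (≈-trans (≡⇒≈ (cong toℕ (trans (sym (α≡ x)) (eq refl)))) (toℕ-residue 1))

  -- Since f(x) = α(x) + f(0), the edge condition between 0 and x becomes α(x) ∈ Ω′: the translation
  -- f(0) cancels in the difference.
  WeakEquiv⇒multiplier : ∀ {Ω Ω′ : Subset n} → WeakEquiv Ω Ω′ →
    ∃ λ u → (∃ λ v → u * v ≈ 1 [ n ]) × (∀ x → Vec.lookup Ω x ≡ Vec.lookup Ω′ (u · x))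
  WeakEquiv⇒multiplier {Ω} {Ω′} (f , (_ , adj) , α , aut , f-α) = u , proj₁ (proj₂ multiplier) , λ x → iff⇒≡
    (λ e → ∈⇒lookup (subst (_∈ Ω′) (diff′ x) (proj₁ (adj 0ᶠ (x ⊕ 0ᶠ)) (subst (_∈ Ω) (sym (diff x)) (lookup⇒∈ e)))))
    (λ e → ∈⇒lookup (subst (_∈ Ω) (diff x) (proj₂ (adj 0ᶠ (x ⊕ 0ᶠ)) (subst (_∈ Ω′) (sym (diff′ x)) (lookup⇒∈ e)))))
    where
    multiplier : ∃ λ u → (∃ λ v → u * v ≈ 1 [ n ]) × (∀ x → α x ≡ u · x)
    multiplier = aut-multiplier aut
    u = proj₁ multiplier
    α≡ = proj₂ (proj₂ multiplier)
    0ᶠ : Fin n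
    0ᶠ = residue 0
    diff : ∀ x → (x ⊕ 0ᶠ) ⊕ (⊖ 0ᶠ) ≡ x
    diff x = sub-≈ (toℕ-⊕ x 0ᶠ)
    diff′ : ∀ x → f (x ⊕ 0ᶠ) ⊕ (⊖ f 0ᶠ) ≡ u · x
    diff′ x = sub-≈ (≈-trans (≡⇒≈ (cong toℕ (trans (f-α x 0ᶠ) (cong (_⊕ f 0ᶠ) (α≡ x))))) (toℕ-⊕ _ _))

  multiplier⇒WeakEquiv : ∀ {Ω Ω′ : Subset n} {u v} → u * v ≈ 1 [ n ] →
    (∀ x → Vec.lookup Ω x ≡ Vec.lookup Ω′ (u · x)) → WeakEquiv Ω Ω′
  multiplier⇒WeakEquiv {Ω} {Ω′} {u} {v} r e =
    (u ·_) , (·-bij {u} {v} r , λ g h →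
      (λ a → lookup⇒∈ (trans (cong (Vec.lookup Ω′) (diff g h)) (trans (sym (e (h ⊕ (⊖ g)))) (∈⇒lookup a)))) ,
      (λ a → lookup⇒∈ (trans (e (h ⊕ (⊖ g))) (trans (cong (Vec.lookup Ω′) (sym (diff g h))) (∈⇒lookup a))))) ,
    (u ·_) , (·-bij {u} {v} r , ·-⊕ u) , ·-⊕ u
    where
    diff : ∀ g h → (u · h) ⊕ (⊖ (u · g)) ≡ u · (h ⊕ (⊖ g))
    diff g h = sub-≈ (≈-trans (toℕ-· u h) (≈-trans (≈-*ˡ u (sub-+ h g))
      (≈-trans (≡⇒≈ (*-distribˡ-+ u _ (toℕ g))) (≈-sym (≈-+ (toℕ-· u (h ⊕ (⊖ g))) (toℕ-· u g))))))

-- The layers of ℤ/p^m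

IsOrder⇒≈-≤ : ∀ {n a d} → Coprime n a → IsOrder n a d → ∀ {i j} → i ≤ j → a ^ j ≈ a ^ i [ n ] → j ≈ i [ d ]
IsOrder⇒≈-≤ {n} {a} {d} cop o {i} {j} i≤j r = subst (_≈ i [ d ]) (m+[n∸m]≡n i≤j)
  (∣⇒≈ i (IsOrder.divides-exponent o (j ∸ i)
    (≈-cancel (a ^ i) (coprime-sym (coprime-^ˡ i (coprime-sym cop)))
      (≈-trans (≡⇒≈ (trans (sym (^-distribˡ-+-* a (j ∸ i) i)) (cong (a ^_) (m∸n+n≡m i≤j))))
        (≈-trans r (≡⇒≈ (sym (*-identityˡ _))))))))

IsOrder⇒≈ : ∀ {n a d} → Coprime n a → IsOrder n a d → ∀ {i j} → a ^ i ≈ a ^ j [ n ] → i ≈ j [ d ]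
IsOrder⇒≈ cop o {i} {j} r with ≤-total i j
... | inj₁ i≤j = ≈-sym (IsOrder⇒≈-≤ cop o i≤j (≈-sym r))
... | inj₂ j≤i = IsOrder⇒≈-≤ cop o j≤i r

IsOrder⇒periodic : ∀ {n a d} → IsOrder n a d → ∀ i → a ^ (i + d) ≈ a ^ i [ n ]
IsOrder⇒periodic {n} {a} {d} o i = ≈-trans (≡⇒≈ (^-distribˡ-+-* a i d))
  (≈-trans (≈-*ˡ (a ^ i) (IsOrder.power≈1 o)) (≡⇒≈ (*-identityʳ _)))

odd-prime : ∀ {p} → Prime p → p ≢ 2 → ∃ λ q → p ≡ 1 + q * 2
odd-prime {p} pp p≢2 = go (p % 2) refl (m%n<n p 2)
  where
  go : ∀ r → p % 2 ≡ r → r < 2 → ∃ λ q → p ≡ 1 + q * 2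
  go zero e _ with Data.Nat.Primality.prime⇒irreducible pp (m%n≡0⇒n∣m p 2 e)
  ... | inj₁ ()
  ... | inj₂ 2≡p = ⊥-elim (p≢2 (sym 2≡p))
  go (suc zero) e _ = p / 2 , trans (m≡m%n+[m/n]*n p 2) (cong (_+ p / 2 * 2) e)
  go (suc (suc _)) _ (s≤s (s≤s ()))

odd-^ : ∀ q k → ∃ λ q′ → (1 + q * 2) ^ k ≡ 1 + q′ * 2
odd-^ q zero = 0 , refl
odd-^ q (suc k) with odd-^ q k
... | q′ , e = q + q′ + q * q′ * 2 , trans (cong ((1 + q * 2) *_) e) (lem q q′)
  where
  lem : ∀ q q′ → (1 + q * 2) * (1 + q′ * 2) ≡ 1 + (q + q′ + q * q′ * 2) * 2
  lem = solve-∀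

module PrimePower (p : ℕ) (pp : Prime p) (p≢2 : p ≢ 2) (m′ : ℕ)
  (g : ℕ) (g-order : ∀ a → a ≤ m′ → IsOrder (p ^ suc a) g (p ^ a * (p ∸ 1))) where

  n : ℕ
  n = p ^ suc m′

  instance
    p≢0 : NonZero p
    p≢0 = prime⇒nonZero pp

    n≢0 : NonZero n
    n≢0 = m^n≢0 p (suc m′)

  -- The nonzero residues p^k u (p ∤ u) form layer k, on which the units act through a
  -- cyclic group of order N k, and modulo ±1 through one of order h k.
  N : ℕ → ℕ
  N k = φ (p ^ (suc m′ ∸ k))

  h : ℕ → ℕ
  h k = N k / 2

  exponent : ∀ {k} → k ≤ m′ → suc m′ ∸ k ≡ suc (m′ ∸ k)
  exponent k≤m′ = +-∸-assoc 1 k≤m′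

  N-value : ∀ {k} → k ≤ m′ → N k ≡ p ^ (m′ ∸ k) * (p ∸ 1)
  N-value {k} k≤m′ = trans (cong (λ e → φ (p ^ e)) (exponent k≤m′)) (φ-prime-power pp p≢2 (m′ ∸ k))

  order : ∀ {k} → k ≤ m′ → IsOrder (p ^ (suc m′ ∸ k)) g (N k)
  order {k} k≤m′ = subst₂ (λ e d → IsOrder (p ^ e) g d) (sym (exponent k≤m′)) (sym (N-value k≤m′))
    (g-order (m′ ∸ k) (m∸n≤m m′ k))

  N-scale : ∀ {k} → k ≤ m′ → N 0 ≡ p ^ k * N k
  N-scale {k} k≤m′ = begin
    N 0                                ≡⟨ N-value z≤n ⟩
    p ^ m′ * (p ∸ 1)                   ≡⟨ cong (λ e → p ^ e * (p ∸ 1)) (sym (m+[n∸m]≡n k≤m′)) ⟩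
    p ^ (k + (m′ ∸ k)) * (p ∸ 1)       ≡⟨ cong (_* (p ∸ 1)) (^-distribˡ-+-* p k (m′ ∸ k)) ⟩
    p ^ k * p ^ (m′ ∸ k) * (p ∸ 1)     ≡⟨ *-assoc (p ^ k) _ _ ⟩
    p ^ k * (p ^ (m′ ∸ k) * (p ∸ 1))   ≡⟨ cong (p ^ k *_) (sym (N-value k≤m′)) ⟩
    p ^ k * N k                        ∎
    where open ≡-Reasoning

  n-scale : ∀ {k} → k ≤ m′ → n ≡ p ^ k * p ^ (suc m′ ∸ k)
  n-scale {k} k≤m′ = trans (cong (p ^_) (sym (m+[n∸m]≡n (m≤n⇒m≤1+n k≤m′)))) (^-distribˡ-+-* p k (suc m′ ∸ k))

  2∣N : ∀ {k} → k ≤ m′ → 2 ∣ N k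
  2∣N {k} k≤m′ = subst (2 ∣_) (sym (N-value k≤m′)) (∣n⇒∣m*n (p ^ (m′ ∸ k)) (2∣p-1 (odd-prime pp p≢2)))
    where
    2∣p-1 : (∃ λ q → p ≡ 1 + q * 2) → 2 ∣ p ∸ 1
    2∣p-1 (q , e) = divides q (cong (_∸ 1) e)

  N≡h*2 : ∀ {k} → k ≤ m′ → N k ≡ h k * 2
  N≡h*2 k≤m′ = sym (m/n*n≡m (2∣N k≤m′))

  N>0 : ∀ {k} → k ≤ m′ → 0 < N k
  N>0 {k} k≤m′ = subst (0 <_) (sym (N-value k≤m′))
    (*-mono-< {0} {p ^ (m′ ∸ k)} {0} (ℕ.>-nonZero⁻¹ _ {{m^n≢0 p (m′ ∸ k)}}) (∸-monoˡ-≤ 1 (1<prime pp)))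

  h>0 : ∀ {k} → k ≤ m′ → 0 < h k
  h>0 {k} k≤m′ = n≢0⇒n>0 λ h≡0 → <⇒≢ (N>0 k≤m′) (sym (trans (N≡h*2 k≤m′) (cong (_* 2) h≡0)))

  h-scale : ∀ {k} → k ≤ m′ → h 0 ≡ p ^ k * h k
  h-scale {k} k≤m′ = *-cancelʳ-≡ (h 0) (p ^ k * h k) 2 (trans (sym (N≡h*2 z≤n))
    (trans (N-scale k≤m′) (trans (cong (p ^ k *_) (N≡h*2 k≤m′)) (sym (*-assoc (p ^ k) (h k) 2)))))

  -- An odd multiple of h k is congruent to h k modulo 2 h k = N k, and h 0 is p^k times h k. So on
  -- layer k negation is the shift by h k.
  h0≈h : ∀ {k} → k ≤ m′ → h 0 ≈ h k [ N k ]
  h0≈h {k} k≤m′ = go (odd-prime pp p≢2)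
    where
    go : (∃ λ q → p ≡ 1 + q * 2) → _
    go (q , e) = go′ (odd-^ q k)
      where
      lem : ∀ q h → (1 + q * 2) * h ≡ h + q * (h * 2)
      lem = solve-∀
      go′ : (∃ λ q′ → (1 + q * 2) ^ k ≡ 1 + q′ * 2) → _
      go′ (q′ , e′) = witness 0 q′ (trans (+-identityʳ _) (trans (h-scale k≤m′)
        (trans (cong (λ x → x ^ k * h k) e) (trans (cong (_* h k) e′)
          (trans (lem q′ (h k)) (cong (λ x → h k + q′ * x) (sym (N≡h*2 k≤m′))))))))

  p∤g : ¬ p ∣ g
  p∤g p∣g = p∤1 pp (≈-resp-∣ p (m∣m*n _) (IsOrder.power≈1 (order {0} z≤n)) (p∣power (N 0) (N>0 z≤n)))
    where
    p∣power : ∀ e → 0 < e → p ∣ g ^ e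
    p∣power (suc e) _ = ∣m⇒∣m*n (g ^ e) p∣g

  coprime-g : ∀ e → Coprime (p ^ e) g
  coprime-g e = coprime-^ˡ e (prime-coprime pp p∤g)

  g-inverse : ∀ j → g ^ j * g ^ (ℕ.pred (N 0) * j) ≈ 1 [ n ]
  g-inverse j = ≈-trans (≡⇒≈ (trans (sym (^-distribˡ-+-* g j _))
      (cong (λ e → g ^ (e * j)) (suc-pred (N 0) {{ℕ.>-nonZero (N>0 z≤n)}}))))
    (≈1-∣ {a = g} {N 0} (IsOrder.power≈1 (order z≤n)) (m∣m*n j))

  -- The square of z = g^(h 0) is 1, so n divides (z - 1)(z + 1). The odd prime p divides at most
  -- one factor, so n divides the other one entirely. It cannot divide z - 1, because h 0 is smaller
  -- than the order N 0.
  g^h≈-1 : g ^ h 0 + 1 ≈ 0 [ n ]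
  g^h≈-1 = go (g ^ h 0) refl
    where
    square : g ^ h 0 * g ^ h 0 ≈ 1 [ n ]
    square = ≈-trans (≡⇒≈ (trans (sym (^-distribˡ-+-* g (h 0) (h 0))) (cong (g ^_) (trans (lem (h 0)) (sym (N≡h*2 {0} z≤n))))))
      (IsOrder.power≈1 (order z≤n))
      where
      lem : ∀ h → h + h ≡ h * 2
      lem = solve-∀
    ≉1 : ¬ g ^ h 0 ≈ 1 [ n ]
    ≉1 r = <⇒≱ (subst (h 0 <_) (sym (N≡h*2 {0} z≤n)) (m<m*n (h 0) 2 {{ℕ.>-nonZero (h>0 z≤n)}} (s≤s (s≤s z≤n))))
      (∣⇒≤ {{ℕ.>-nonZero (h>0 z≤n)}} (IsOrder.divides-exponent (order z≤n) (h 0) r))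
    go : ∀ y → g ^ h 0 ≡ y → y + 1 ≈ 0 [ n ]
    go zero e = ⊥-elim (p∤^ pp (h 0) p∤g (subst (p ∣_) (sym e) (p ∣0)))
    -- Here y = z - 1, so the two factors are y and 2 + y.
    go (suc y) e with p ∣? y
    ... | no p∤y = ∣⇒≈0 (subst (n ∣_) (lem y) (coprime-divisor (coprime-^ˡ (suc m′) (prime-coprime pp p∤y)) n∣))
      where
      lem : ∀ y → 2 + y ≡ suc y + 1
      lem = solve-∀
      lem′ : ∀ y → 1 + y * (2 + y) ≡ suc y * suc y
      lem′ = solve-∀
      n∣ : n ∣ y * (2 + y)
      n∣ = ≈⇒∣ 1 (≈-trans (≡⇒≈ (trans (lem′ y) (cong₂ _*_ (sym e) (sym e)))) square)
    ... | yes p∣y = ⊥-elim (≉1 (≈-trans (≡⇒≈ e) (∣⇒≈ 1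
          (coprime-divisor (coprime-^ˡ (suc m′) (prime-coprime pp p∤2+y)) n∣))))
      where
      p∤2+y : ¬ p ∣ 2 + y
      p∤2+y d = p∤2 pp p≢2 (∣m+n∣m⇒∣n (subst (p ∣_) (+-comm 2 y) d) p∣y)
      lem′ : ∀ y → 1 + (2 + y) * y ≡ suc y * suc y
      lem′ = solve-∀
      n∣ : n ∣ (2 + y) * y
      n∣ = ≈⇒∣ 1 (≈-trans (≡⇒≈ (trans (lem′ y) (cong₂ _*_ (sym e) (sym e)))) square)

  -- The N k powers of g are distinct units modulo p^(m−k), hence all of them.
  unit-is-power : ∀ {k} → k ≤ m′ → ∀ {y} → ¬ p ∣ y → ∃ λ i → y ≈ g ^ i [ p ^ (suc m′ ∸ k) ]
  unit-is-power {k} k≤m′ {y} p∤y = find (pigeonhole-⊇ powers-unique powers⊆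
      (≤-reflexive (sym (trans (length-map _ (upTo (N k))) (length-upTo (N k))))) y∈)
    where
    e = suc m′ ∸ k
    M = p ^ e
    p∣M : p ∣ M
    p∣M = subst (λ e → p ∣ p ^ e) (sym (exponent k≤m′)) (m∣m*n _)
    instance
      M≢0 : NonZero M
      M≢0 = m^n≢0 p e
    powers = map (λ i → g ^ i % M) (upTo (N k))
    units′ = filter (λ x → gcd x M ≟ 1) (range1 M)
    is-unit : ∀ {x} → ¬ p ∣ x → x % M ∈ˡ units′
    is-unit {x} p∤x = ∈-filter⁺ (λ x → gcd x M ≟ 1)
      (∈-range1⁺ (n≢0⇒n>0 λ r≡0 → p∤r (subst (p ∣_) (sym r≡0) (p ∣0))) (<⇒≤ (m%n<n x M)))
      (coprime⇒gcd≡1 (coprime-sym (coprime-^ˡ e (prime-coprime pp p∤r))))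
      where
      p∤r : ¬ p ∣ x % M
      p∤r d = p∤x (≈-resp-∣ p p∣M (≈-% x M) d)
    y∈ : y % M ∈ˡ units′
    y∈ = is-unit p∤y
    powers-unique : Unique powers
    powers-unique = unique-map (λ i∈ j∈ eq → ≈⇒≡ (∈-upTo⁻ i∈) (∈-upTo⁻ j∈)
      (IsOrder⇒≈ (coprime-g e) (order k≤m′) (%≡⇒≈ M eq))) (Unique.upTo⁺ (N k))
    powers⊆ : ∀ {x} → x ∈ˡ powers → x ∈ˡ units′
    powers⊆ x∈ with ∈-map⁻ (λ i → g ^ i % M) x∈
    ... | i , _ , refl = is-unit (p∤^ pp i p∤g)
    find : y % M ∈ˡ powers → ∃ λ i → y ≈ g ^ i [ M ]
    find y∈ with ∈-map⁻ (λ i → g ^ i % M) y∈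
    ... | i , _ , eq = i , %≡⇒≈ M eq

  nonzero-is-layered : ∀ x → x ≢ 0 → x < n → ∃ λ k → k ≤ m′ × ∃ λ i → x ≈ p ^ k * g ^ i [ n ]
  nonzero-is-layered x x≢0 x<n = go (split-power (1<prime pp) x {{ℕ.≢-nonZero x≢0}})
    where
    go : (∃ λ k → ∃ λ y → x ≡ p ^ k * y × ¬ p ∣ y) → _
    go (k , y , x≡ , p∤y) = k , k≤m′ , layer (unit-is-power k≤m′ p∤y)
      where
      y>0 : 0 < y
      y>0 = n≢0⇒n>0 λ { refl → p∤y (p ∣0) }
      k≤m′ : k ≤ m′
      k≤m′ with k ≤? m′
      ... | yes le = le
      ... | no ¬le = ⊥-elim (<⇒≱ x<n (≤-trans (^-monoʳ-≤ p (≰⇒> ¬le))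
              (subst (p ^ k ≤_) (sym x≡) (m≤m*n (p ^ k) y {{ℕ.>-nonZero y>0}}))))
      layer : (∃ λ i → y ≈ g ^ i [ p ^ (suc m′ ∸ k) ]) → ∃ λ i → x ≈ p ^ k * g ^ i [ n ]
      layer (i , r) = i , ≈-trans (≡⇒≈ x≡)
        (subst (p ^ k * y ≈ p ^ k * g ^ i [_]) (sym (n-scale k≤m′)) (≈-*-mono (p ^ k) r))

  p^k∤ : ∀ {k i j} → k < j → ¬ p ^ j ∣ p ^ k * g ^ i
  p^k∤ {k} {i} {j} k<j d = p∤^ pp i p∤g (*-cancelˡ-∣ (p ^ k) {{m^n≢0 p k}}
    (∣-trans (subst (p ^ k * p ∣_) (trans (sym (^-distribˡ-+-* p (suc k) (j ∸ suc k))) (cong (p ^_) (m+[n∸m]≡n k<j)))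
      (subst (_∣ p ^ suc k * p ^ (j ∸ suc k)) (*-comm p (p ^ k)) (m∣m*n _))) d))

  layer-unique : ∀ {k k′ i i′} → k ≤ m′ → k′ ≤ m′ → p ^ k * g ^ i ≈ p ^ k′ * g ^ i′ [ n ] → k ≡ k′
  layer-unique {k} {k′} {i} {i′} k≤ k′≤ r with <-cmp k k′
  ... | tri≈ _ e _ = e
  ... | tri< lt _ _ = ⊥-elim (p^k∤ {k} {i} lt (≈-resp-∣ (p ^ k′)
          (subst (p ^ k′ ∣_) (sym (n-scale k′≤)) (m∣m*n _)) (≈-sym r) (m∣m*n _)))
  ... | tri> _ _ gt = ⊥-elim (p^k∤ {k′} {i′} gt (≈-resp-∣ (p ^ k)
          (subst (p ^ k ∣_) (sym (n-scale k≤)) (m∣m*n _)) r (m∣m*n _)))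

  layer-exponent : ∀ {k i i′} → k ≤ m′ → p ^ k * g ^ i ≈ p ^ k * g ^ i′ [ n ] → i ≈ i′ [ N k ]
  layer-exponent {k} {i} {i′} k≤ r = IsOrder⇒≈ (coprime-g (suc m′ ∸ k)) (order k≤)
    (≈-*-cancel (p ^ k) {{m^n≢0 p k}} (subst (p ^ k * g ^ i ≈ p ^ k * g ^ i′ [_]) (n-scale k≤) r))

  layer-periodic : ∀ {k} → k ≤ m′ → ∀ i → p ^ k * g ^ (i + N k) ≈ p ^ k * g ^ i [ n ]
  layer-periodic {k} k≤ i = subst (p ^ k * g ^ (i + N k) ≈ p ^ k * g ^ i [_]) (sym (n-scale k≤))
    (≈-*-mono (p ^ k) (IsOrder⇒periodic (order k≤) i))

-- Connection sets and the action of the unit group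

module Circulant (p : ℕ) (pp : Prime p) (p≢2 : p ≢ 2) (m′ : ℕ)
  (g : ℕ) (g-order : ∀ a → a ≤ m′ → IsOrder (p ^ suc a) g (p ^ a * (p ∸ 1))) where

  open PrimePower p pp p≢2 m′ g g-order public
  open Multiplication {n} public

  p∣n : p ∣ n
  p∣n = m∣m*n (p ^ m′)

  0ᶠ : Fin n
  0ᶠ = residue 0

  toℕ-0ᶠ : toℕ 0ᶠ ≡ 0
  toℕ-0ᶠ = ≈⇒≡ (Finₚ.toℕ<n 0ᶠ) (ℕ.>-nonZero⁻¹ n) (toℕ-residue 0)

  ·-0ᶠ : ∀ u → u · 0ᶠ ≡ 0ᶠ
  ·-0ᶠ u = trans (·-residue u 0) (cong residue (*-zeroʳ u))

  -- The inverse image g^(-j) Ω, whose membership can be read off directly; orbits and fixed sets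
  -- are those of the forward action.
  act : ℕ → Subset n → Subset n
  act j Ω = Vec.tabulate (λ x → Vec.lookup Ω (g ^ j · x))

  lookup-act : ∀ j Ω x → Vec.lookup (act j Ω) x ≡ Vec.lookup Ω (g ^ j · x)
  lookup-act j Ω = Vecₚ.lookup∘tabulate (λ x → Vec.lookup Ω (g ^ j · x))

  act-+ : ∀ i j Ω → act (i + j) Ω ≡ act i (act j Ω)
  act-+ i j Ω = Vecₚ.tabulate-cong λ x → trans (cong (Vec.lookup Ω) (shift-power x)) (sym (lookup-act j Ω (g ^ i · x)))
    where
    shift-power : ∀ x → g ^ (i + j) · x ≡ g ^ j · g ^ i · x
    shift-power x = trans (cong (_· x) (trans (cong (g ^_) (+-comm i j)) (^-distribˡ-+-* g j i))) (sym (·-assoc (g ^ j) (g ^ i) x))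

  act-0 : ∀ Ω → act 0 Ω ≡ Ω
  act-0 Ω = subset-ext λ x → trans (lookup-act 0 Ω x) (cong (Vec.lookup Ω) (1· x ≈-refl))

  el : ℕ → ℕ → Fin n
  el k i = residue (p ^ k * g ^ i)

  ·-el : ∀ j k i → g ^ j · el k i ≡ el k (i + j)
  ·-el j k i = trans (·-residue (g ^ j) (p ^ k * g ^ i)) (cong residue (trans (lem (g ^ j) (p ^ k) (g ^ i))
    (cong (p ^ k *_) (sym (^-distribˡ-+-* g i j)))))
    where
    lem : ∀ a b c → a * (b * c) ≡ b * (c * a)
    lem = solve-∀

  Layered : Fin n → Set
  Layered x = x ≡ 0ᶠ ⊎ (∃ λ k → k ≤ m′ × ∃ λ i → x ≡ el k i)

  abstract
    layered : ∀ x → Layered x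
    layered x with toℕ x ≟ 0
    ... | yes x≡0 = inj₁ (Finₚ.toℕ-injective (trans x≡0 (sym toℕ-0ᶠ)))
    ... | no x≢0 = inj₂ (lift (nonzero-is-layered (toℕ x) x≢0 (Finₚ.toℕ<n x)))
      where
      lift : (∃ λ k → k ≤ m′ × ∃ λ i → toℕ x ≈ p ^ k * g ^ i [ n ]) → ∃ λ k → k ≤ m′ × ∃ λ i → x ≡ el k i
      lift (k , k≤ , i , r) = k , k≤ , i , trans (sym (residue-toℕ x)) (residue-≈ r)

  el≢0ᶠ : ∀ {k i} → k ≤ m′ → el k i ≢ 0ᶠ
  el≢0ᶠ {k} {i} k≤ e = p^k∤ {k} {i} (s≤s k≤) (≈0⇒∣ (residue-≈⁻ e))

  el-layer : ∀ {k k′ i i′} → k ≤ m′ → k′ ≤ m′ → el k i ≡ el k′ i′ → k ≡ k′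
  el-layer {k} {k′} {i} {i′} k≤ k′≤ e = layer-unique {k} {k′} {i} {i′} k≤ k′≤ (residue-≈⁻ e)

  el-exponent : ∀ {k i i′} → k ≤ m′ → el k i ≡ el k i′ → i ≈ i′ [ N k ]
  el-exponent {k} {i} {i′} k≤ e = layer-exponent {k} {i} {i′} k≤ (residue-≈⁻ e)

  el-periodic : ∀ {k} → k ≤ m′ → Periodic (N k) (el k)
  el-periodic k≤ i = residue-≈ (layer-periodic k≤ i)

  ⊖-power : ∀ x → ⊖ x ≡ g ^ h 0 · x
  ⊖-power x = ⊖-unique (≈-trans (≈-+ (toℕ-· (g ^ h 0) x) ≈-refl)
    (≈-trans (≡⇒≈ (lem (g ^ h 0) (toℕ x))) (≈-*ʳ (toℕ x) g^h≈-1)))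
    where
    lem : ∀ a x → a * x + x ≡ (a + 1) * x
    lem = solve-∀

  ⊖-involutive : ∀ (x : Fin n) → ⊖ (⊖ x) ≡ x
  ⊖-involutive x = ⊖-unique (≈-trans (≡⇒≈ (+-comm (toℕ x) _)) (toℕ-⊖ x))

  -- Closure under negation in the form of invariance under g^(h 0) = -1, so that it yields a period
  -- in the same way as invariance under g^r.
  Symmetric : Subset n → Set
  Symmetric Ω = act (h 0) Ω ≡ Ω

  ZeroFree : Subset n → Set
  ZeroFree Ω = Vec.lookup Ω 0ᶠ ≡ false

  HasUnit : Subset n → Set
  HasUnit Ω = ∃ λ x → Vec.lookup Ω x ≡ true × ¬ p ∣ toℕ x

  _≟ˢ_ : (Ω Ω′ : Subset n) → Dec (Ω ≡ Ω′)
  _≟ˢ_ = Vecₚ.≡-dec Data.Bool._≟_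

  hasUnit? : Decidable HasUnit
  hasUnit? Ω = Finₚ.any? λ x → (Vec.lookup Ω x Data.Bool.≟ true) ×-dec ¬? (p ∣? toℕ x)

  Connection : Subset n → Set
  Connection Ω = (Symmetric Ω × ZeroFree Ω) × HasUnit Ω

  symmetric∧zeroFree? : Decidable (λ Ω → Symmetric Ω × ZeroFree Ω)
  symmetric∧zeroFree? Ω = (act (h 0) Ω ≟ˢ Ω) ×-dec (Vec.lookup Ω 0ᶠ Data.Bool.≟ false)

  connection? : Decidable Connection
  connection? Ω = symmetric∧zeroFree? Ω ×-dec hasUnit? Ω

  isZero : ∀ {z : Fin n} → IsZero z → z ≡ 0ᶠ
  isZero e = Finₚ.toℕ-injective (trans e (sym toℕ-0ᶠ))

  ¬true⇒false : ∀ {b : Bool} → b ≢ true → b ≡ false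
  ¬true⇒false {false} _ = refl
  ¬true⇒false {true} ne = ⊥-elim (ne refl)

  symmetric-⊖ : ∀ {Ω} → Symmetric Ω → ∀ x → Vec.lookup Ω (⊖ x) ≡ Vec.lookup Ω x
  symmetric-⊖ {Ω} s x = trans (cong (Vec.lookup Ω) (⊖-power x))
    (trans (sym (lookup-act (h 0) Ω x)) (cong (λ Ω → Vec.lookup Ω x) s))

  -- For the unit: if p divided every element of Ω, it would divide everything that Ω generates,
  -- including 1.
  IsConnSet⇒Connection : ∀ {Ω} → IsConnSet Ω → Connection Ω
  IsConnSet⇒Connection {Ω} (neg , no-zero , gen) = (symmetric , zero-free) , has-unit (hasUnit? Ω)
    where
    symmetric : Symmetric Ω
    symmetric = subset-ext λ x → trans (lookup-act (h 0) Ω x) (trans (cong (Vec.lookup Ω) (sym (⊖-power x)))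
      (iff⇒≡ (λ e → ∈⇒lookup (subst (_∈ Ω) (⊖-involutive x) (neg (⊖ x) (lookup⇒∈ e))))
             (λ e → ∈⇒lookup (neg x (lookup⇒∈ e)))))
    zero-free : ZeroFree Ω
    zero-free = ¬true⇒false λ e → no-zero 0ᶠ toℕ-0ᶠ (lookup⇒∈ e)
    has-unit : Dec (HasUnit Ω) → HasUnit Ω
    has-unit (yes u) = u
    has-unit (no ¬u) = ⊥-elim (p∤1 pp (≈-resp-∣ p p∣n (toℕ-residue 1) (p∣gen (gen (residue 1)))))
      where
      p∣Ω : ∀ {a} → a ∈ Ω → p ∣ toℕ a
      p∣Ω {a} a∈ with p ∣? toℕ a
      ... | yes d = d
      ... | no ∤a = ⊥-elim (¬u (a , ∈⇒lookup a∈ , ∤a))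
      p∣gen : ∀ {x} → Gen Ω x → p ∣ toℕ x
      p∣gen (gen0 z z≡0) = subst (p ∣_) (sym z≡0) (p ∣0)
      p∣gen (gen+ a b a∈ b∈) = ≈-resp-∣ p p∣n (≈-sym (toℕ-⊕ a b)) (∣m∣n⇒∣m+n (p∣Ω a∈) (p∣gen b∈))

  -- A single unit u of Ω generates everything: x is the sum of x u^(-1) copies of u.
  Connection⇒IsConnSet : ∀ {Ω} → Connection Ω → IsConnSet Ω
  Connection⇒IsConnSet {Ω} ((s , z) , u , u∈ , p∤u) =
    (λ a a∈ → lookup⇒∈ (trans (symmetric-⊖ s a) (∈⇒lookup a∈))) ,
    (λ a a≡0 a∈ → case trans (sym z) (trans (cong (Vec.lookup Ω) (sym (isZero a≡0))) (∈⇒lookup a∈)) of λ ()) ,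
    (λ x → reach x (unit-is-power {0} z≤n p∤u))
    where
    multiples : ∀ t → Gen Ω (residue (t * toℕ u))
    multiples zero = gen0 0ᶠ toℕ-0ᶠ
    multiples (suc t) = subst (Gen Ω) (fin-≈ (≈-trans (toℕ-⊕ u (residue (t * toℕ u)))
      (≈-trans (≈-+ (≈-refl {a = toℕ u}) (toℕ-residue (t * toℕ u))) (≈-sym (toℕ-residue (suc t * toℕ u))))))
      (gen+ u _ (lookup⇒∈ u∈) (multiples t))
    reach : ∀ x → (∃ λ i → toℕ u ≈ g ^ i [ n ]) → Gen Ω x
    reach x (i , r) = subst (Gen Ω) (trans (residue-≈ t*u≈x) (residue-toℕ x)) (multiples t)
      where
      inv = g ^ (ℕ.pred (N 0) * i)
      t = toℕ x * inv
      t*u≈x : t * toℕ u ≈ toℕ x [ n ]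
      t*u≈x = ≈-trans (≈-*ˡ t r) (≈-trans (≡⇒≈ (lem (toℕ x) inv (g ^ i)))
        (≈-trans (≈-*ˡ (toℕ x) (g-inverse i)) (≡⇒≈ (*-identityʳ (toℕ x)))))
        where
        lem : ∀ a b c → a * b * c ≡ a * (c * b)
        lem = solve-∀

  WeakEquiv⇒act : ∀ {Ω Ω′ : Subset n} → WeakEquiv Ω Ω′ → ∃ λ j → act j Ω′ ≡ Ω
  WeakEquiv⇒act {Ω} {Ω′} w = go (WeakEquiv⇒multiplier w)
    where
    go : (∃ λ u → (∃ λ v → u * v ≈ 1 [ n ]) × (∀ x → Vec.lookup Ω x ≡ Vec.lookup Ω′ (u · x))) → _
    go (u , (v , r) , e) = power (unit-is-power {0} z≤n {u} λ p∣u →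
      p∤1 pp (≈-resp-∣ p p∣n r (∣m⇒∣m*n v p∣u)))
      where
      power : (∃ λ j → u ≈ g ^ j [ n ]) → ∃ λ j → act j Ω′ ≡ Ω
      power (j , r) = j , subset-ext λ x → trans (lookup-act j Ω′ x)
        (trans (cong (Vec.lookup Ω′) (·-cong x (≈-sym r))) (sym (e x)))

  act⇒WeakEquiv : ∀ {Ω Ω′ : Subset n} j → act j Ω′ ≡ Ω → WeakEquiv Ω Ω′
  act⇒WeakEquiv {Ω} {Ω′} j e = multiplier⇒WeakEquiv {Ω} {Ω′} {g ^ j} (g-inverse j)
    λ x → trans (cong (λ Ω → Vec.lookup Ω x) (sym e)) (lookup-act j Ω′ x)

  act-inverse : ∀ j x → g ^ j · g ^ (ℕ.pred (N 0) * j) · x ≡ x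
  act-inverse j x = trans (·-assoc (g ^ j) _ x) (1· x (g-inverse j))

  ·-perm : ∀ j → map (g ^ j ·_) (allFin n) ↭ allFin n
  ·-perm j = set⇒↭ (Unique.map⁺ (proj₁ (·-bij {g ^ j} (g-inverse j))) (Unique.allFin⁺ n)) (Unique.allFin⁺ n)
    (λ {x} _ → ∈-allFin x)
    (λ {x} _ → subst (_∈ˡ map (g ^ j ·_) (allFin n)) (act-inverse j x) (∈-map⁺ (g ^ j ·_) (∈-allFin _)))

  ∣act∣ : ∀ j Ω → ∣ act j Ω ∣ ≡ ∣ Ω ∣
  ∣act∣ j Ω = begin
    ∣ act j Ω ∣                                          ≡⟨ ∣tabulate∣ (λ x → Vec.lookup Ω (g ^ j · x)) ⟩
    ∑ (allFin n) (λ x → bit (Vec.lookup Ω (g ^ j · x)))  ≡⟨ sym (∑-map (g ^ j ·_) (allFin n) _) ⟩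
    ∑ (map (g ^ j ·_) (allFin n)) (bit ∘ Vec.lookup Ω)   ≡⟨ ∑-↭ (bit ∘ Vec.lookup Ω) (·-perm j) ⟩
    ∑ (allFin n) (bit ∘ Vec.lookup Ω)                    ≡⟨ sym (∣tabulate∣ (Vec.lookup Ω)) ⟩
    ∣ Vec.tabulate (Vec.lookup Ω) ∣                      ≡⟨ cong ∣_∣ (Vecₚ.tabulate∘lookup Ω) ⟩
    ∣ Ω ∣                                                ∎
    where open ≡-Reasoning

  Connection-act : ∀ j {Ω} → Connection Ω → Connection (act j Ω)
  Connection-act j {Ω} ((s , z) , u , u∈ , p∤u) =
    (trans (sym (act-+ (h 0) j Ω)) (trans (cong (λ e → act e Ω) (+-comm (h 0) j)) (trans (act-+ j (h 0) Ω) (cong (act j) s))) ,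
     trans (lookup-act j Ω 0ᶠ) (trans (cong (Vec.lookup Ω) (·-0ᶠ (g ^ j))) z)) ,
    v , trans (lookup-act j Ω v) (trans (cong (Vec.lookup Ω) (act-inverse j u)) u∈) ,
    λ p∣v → p∤u (subst (λ x → p ∣ toℕ x) (act-inverse j u)
      (≈-resp-∣ p p∣n (≈-sym (toℕ-· (g ^ j) v)) (∣n⇒∣m*n (g ^ j) p∣v)))
    where
    v = g ^ (ℕ.pred (N 0) * j) · u

map-constant : {A B : Set} {f : A → B} {c : B} (xs : List A) → (∀ {x} → x ∈ˡ xs → f x ≡ c) →
               map f xs ≡ replicate (length xs) c
map-constant [] _ = refl
map-constant (x ∷ xs) eq = cong₂ _∷_ (eq (here refl)) (map-constant xs (eq ∘ there))

divN-/ : ∀ a b .{{_ : NonZero b}} → divN a b ≡ a / b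
divN-/ a (suc b) = refl

%-≈ : ∀ {n d i j} .{{_ : NonZero d}} → d ∣ n → i ≈ j [ n ] → i % d ≡ j % d
%-≈ {d = d} d∣n r = ≈⇒%≡ d (≈-weaken d∣n r)

-- The symmetric subsets fixed by multiplication by g^r are the unions of the classes of nonzero
-- residues p^k g^i with i taken modulo e k = gcd(r, h 0, h k).
module FixedSubsets (p : ℕ) (pp : Prime p) (p≢2 : p ≢ 2) (m′ : ℕ)
  (g : ℕ) (g-order : ∀ a → a ≤ m′ → IsOrder (p ^ suc a) g (p ^ a * (p ∸ 1)))
  (r : ℕ) (e : ℕ → ℕ) (e≡ : ∀ k → e k ≡ gk p (suc m′) k (gcd r (halfφ p (suc m′)))) where

  open Circulant p pp p≢2 m′ g g-order

  d : ℕ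
  d = gcd r (h 0)

  instance
    e≢0 : ∀ {k} → NonZero (e k)
    e≢0 {k} = ℕ.≢-nonZero λ e≡0 → Data.Nat.GCD.gcd[m,n]≢0 d (h k) (inj₁
      (Data.Nat.GCD.gcd[m,n]≢0 r (h 0) (inj₂ (n>0⇒n≢0 (h>0 z≤n))))) (trans (sym (e≡ k)) e≡0)

  e∣h : ∀ k → e k ∣ h k
  e∣h k = subst (_∣ h k) (sym (e≡ k)) (gcd[m,n]∣n d (h k))

  e∣d : ∀ k → e k ∣ d
  e∣d k = subst (_∣ d) (sym (e≡ k)) (gcd[m,n]∣m d (h k))

  e∣h0 : ∀ k → e k ∣ h 0
  e∣h0 k = ∣-trans (e∣d k) (gcd[m,n]∣n r (h 0))

  e∣r : ∀ k → e k ∣ r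
  e∣r k = ∣-trans (e∣d k) (gcd[m,n]∣m r (h 0))

  e∣N : ∀ {k} → k ≤ m′ → e k ∣ N k
  e∣N {k} k≤ = subst (e k ∣_) (sym (N≡h*2 k≤)) (∣m⇒∣m*n 2 (e∣h k))

  -- Zero gets the label (m, 0), beyond the layers 0, ..., m - 1, so no list of layers can select
  -- it.
  label′ : ∀ {x} → Layered x → ℕ × ℕ
  label′ (inj₁ _) = suc m′ , 0
  label′ (inj₂ (k , _ , i , _)) = k , i % e k

  label : Fin n → ℕ × ℕ
  label x = label′ (layered x)

  -- The exponent stored by `layered` need not be i, but it agrees with i modulo N k, hence modulo
  -- the divisor e k.
  label-el : ∀ {k} → k ≤ m′ → ∀ i → label (el k i) ≡ (k , i % e k)
  label-el {k} k≤ i = go (layered (el k i)) refl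
    where
    go : ∀ {x} (l : Layered x) → x ≡ el k i → label′ l ≡ (k , i % e k)
    go (inj₁ x≡0) eq = ⊥-elim (el≢0ᶠ {k} {i} k≤ (trans (sym eq) x≡0))
    go (inj₂ (k′ , k′≤ , i′ , x≡)) eq = go′ (el-layer {k′} {k} {i′} {i} k′≤ k≤ (trans (sym x≡) eq))
      where
      go′ : k′ ≡ k → (k′ , i′ % e k′) ≡ (k , i % e k)
      go′ refl = cong (k ,_) (%-≈ {d = e k} (e∣N k≤) (el-exponent {k} {i′} {i} k≤ (trans (sym x≡) eq)))

  label-0ᶠ : label 0ᶠ ≡ (suc m′ , 0)
  label-0ᶠ = go (layered 0ᶠ) refl
    where
    go : ∀ {x} (l : Layered x) → x ≡ 0ᶠ → label′ l ≡ (suc m′ , 0)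
    go (inj₁ _) _ = refl
    go (inj₂ (k , k≤ , i , x≡)) x≡0 = ⊥-elim (el≢0ᶠ {k} {i} k≤ (trans (sym x≡) x≡0))

  label-· : ∀ j → (∀ k → e k ∣ j) → ∀ x → label (g ^ j · x) ≡ label x
  label-· j e∣j x = go (layered x)
    where
    go : Layered x → label (g ^ j · x) ≡ label x
    go (inj₁ refl) = cong label (·-0ᶠ (g ^ j))
    go (inj₂ (k , k≤ , i , refl)) = trans (cong label (·-el j k i)) (trans (label-el k≤ (i + j))
      (trans (cong (k ,_) (%-remove-+ʳ i (e∣j k))) (sym (label-el k≤ i))))

  layerLabels : ℕ → List (ℕ × ℕ)
  layerLabels k = map (k ,_) (upTo (e k))

  labels : List ℕ → List (ℕ × ℕ)
  labels = concatMap layerLabels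

  _≟ᴸ_ : (s t : ℕ × ℕ) → Dec (s ≡ t)
  _≟ᴸ_ = Productₚ.≡-dec _≟_ _≟_

  open Labelling _≟ᴸ_ label public

  ∈-labels⁺ : ∀ {ks k i} → k ∈ˡ ks → i < e k → (k , i) ∈ˡ labels ks
  ∈-labels⁺ {k′ ∷ ks} {k} (here refl) i< = ∈-++⁺ˡ (∈-map⁺ (k ,_) (∈-upTo⁺ i<))
  ∈-labels⁺ {k′ ∷ ks} (there k∈) i< = ∈-++⁺ʳ (layerLabels k′) (∈-labels⁺ k∈ i<)

  ∈-labels⁻ : ∀ ks {l} → l ∈ˡ labels ks → proj₁ l ∈ˡ ks × proj₂ l < e (proj₁ l)
  ∈-labels⁻ (k ∷ ks) l∈ with ∈-++⁻ (layerLabels k) l∈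
  ... | inj₂ l∈′ with ∈-labels⁻ ks l∈′
  ...   | k∈ , i< = there k∈ , i<
  ∈-labels⁻ (k ∷ ks) l∈ | inj₁ l∈′ with ∈-map⁻ (k ,_) l∈′
  ... | i , i∈ , refl = here refl , ∈-upTo⁻ i∈

  labels-unique : ∀ {ks} → Unique ks → Unique (labels ks)
  labels-unique {[]} _ = []
  labels-unique {k ∷ ks} (u ∷ us) = Unique.++⁺ (Unique.map⁺ Productₚ.,-injectiveʳ (Unique.upTo⁺ (e k))) (labels-unique us)
    λ (l∈ , l∈′) → unique-head∉ (u ∷ us) (subst (_∈ˡ ks) (first l∈) (proj₁ (∈-labels⁻ ks l∈′)))
    where
    first : ∀ {l} → l ∈ˡ layerLabels k → proj₁ l ≡ k
    first l∈ with ∈-map⁻ (k ,_) l∈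
    ... | _ , _ , refl = refl

  -- The class is listed by the exponents i + j e k with j < N k / e k. All of them lie below the
  -- period N k, so the elements are distinct.
  classSize-label : ∀ {k i} → k ≤ m′ → i < e k → classSize (k , i) ≡ divN (N k) (e k)
  classSize-label {k} {i} k≤ i< = trans
    (sym (#-bijection (λ _ → yes tt) (λ x → label x ≟ᴸ (k , i)) (λ j → el k (i + j * e k))
      (Unique.upTo⁺ q) (Unique.allFin⁺ n) inj to from))
    (trans (#-all (upTo q)) (trans (length-upTo q) (sym (divN-/ (N k) (e k)))))
    where
    q = N k / e k
    q*e : q * e k ≡ N k
    q*e = m/n*n≡m (e∣N k≤)
    instance
      N≢0 : NonZero (N k)
      N≢0 = ℕ.>-nonZero (N>0 k≤)
    bound : ∀ {j} → j < q → i + j * e k < N k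
    bound {j} j<q = ≤-trans (+-monoˡ-< (j * e k) i<) (≤-trans (*-monoˡ-≤ (e k) j<q) (≤-reflexive q*e))
    inj : ∀ {x y} → x ∈ˡ upTo q → y ∈ˡ upTo q → el k (i + x * e k) ≡ el k (i + y * e k) → x ≡ y
    inj {x} {y} x∈ y∈ eq = *-cancelʳ-≡ x y (e k) (+-cancelˡ-≡ i _ _
      (≈⇒≡ (bound (∈-upTo⁻ x∈)) (bound (∈-upTo⁻ y∈)) (el-exponent {k} {i + x * e k} {i + y * e k} k≤ eq)))
    to : ∀ {j} → j ∈ˡ upTo q → ⊤ → el k (i + j * e k) ∈ˡ allFin n × label (el k (i + j * e k)) ≡ (k , i)
    to {j} _ _ = ∈-allFin _ , trans (label-el k≤ (i + j * e k))
      (cong (k ,_) (trans ([m+kn]%n≡m%n i j (e k)) (m<n⇒m%n≡m i<)))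
    from : ∀ {x} → x ∈ˡ allFin n → label x ≡ (k , i) → ∃ λ j → j ∈ˡ upTo q × ⊤ × x ≡ el k (i + j * e k)
    from {x} _ lx = go (layered x)
      where
      go : Layered x → ∃ λ j → j ∈ˡ upTo q × ⊤ × x ≡ el k (i + j * e k)
      go (inj₁ refl) = ⊥-elim (<-irrefl (cong proj₁ (trans (sym lx) label-0ᶠ)) (s≤s k≤))
      go (inj₂ (k′ , k′≤ , i′ , refl)) = go′ (trans (sym (label-el k′≤ i′)) lx)
        where
        go′ : (k′ , i′ % e k′) ≡ (k , i) → ∃ λ j → j ∈ˡ upTo q × ⊤ × el k′ i′ ≡ el k (i + j * e k)
        go′ refl = i″ / e k , ∈-upTo⁺ (m<n*o⇒m/o<n (subst (i″ <_) (sym q*e) (m%n<n i′ (N k)))) , tt ,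
          periodic-≈ {f = el k} (el-periodic k≤) (≈-trans (≈-sym (≈-% i′ (N k)))
            (≡⇒≈ (trans (m≡m%n+[m/n]*n i″ (e k)) (cong (_+ i″ / e k * e k) (m∣n⇒o%n%m≡o%m (e k) (N k) i′ (e∣N k≤))))))
          where
          i″ = i′ % N k

  weights : List ℕ → List ℕ
  weights = concatMap (λ k → replicate (e k) (divN (N k) (e k)))

  map-classSize : ∀ ks → All (_≤ m′) ks → map classSize (labels ks) ≡ weights ks
  map-classSize [] _ = refl
  map-classSize (k ∷ ks) (k≤ ∷ ks≤) = trans (map-++ classSize (layerLabels k) (labels ks))
    (cong₂ _++_ layer (map-classSize ks ks≤))
    where
    layer : map classSize (layerLabels k) ≡ replicate (e k) (divN (N k) (e k))
    layer = trans (sym (map-∘ (upTo (e k))))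
      (trans (map-constant (upTo (e k)) (λ i∈ → classSize-label k≤ (∈-upTo⁻ i∈)))
        (cong (λ l → replicate l (divN (N k) (e k))) (length-upTo (e k))))

  -- With the layers 1, ..., m - 1 this expresses, for zero-free sets, the absence of a unit.
  SupportedOn : List ℕ → Subset n → Set
  SupportedOn ks Ω = ∀ k → k ≤ m′ → k ∉ˡ ks → ∀ i → Vec.lookup Ω (el k i) ≡ false

  Fixed : List ℕ → Subset n → Set
  Fixed ks Ω = (Symmetric Ω × ZeroFree Ω) × act r Ω ≡ Ω × SupportedOn ks Ω

  union-fixed : ∀ {ks} → All (_≤ m′) ks → ∀ f → (∀ {l} → l ∉ˡ labels ks → f l ≡ false) → Fixed ks (union f)
  union-fixed {ks} ks≤ f off = (invariant (h 0) e∣h0 , trans (lookup-union 0ᶠ) (off zero∉)) , invariant r e∣r ,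
    λ k k≤ k∉ i → trans (lookup-union (el k i)) (off λ l∈ →
      k∉ (subst (_∈ˡ ks) (cong proj₁ (label-el k≤ i)) (proj₁ (∈-labels⁻ ks l∈))))
    where
    lookup-union : ∀ x → Vec.lookup (union f) x ≡ f (label x)
    lookup-union = Vecₚ.lookup∘tabulate (f ∘ label)
    zero∉ : label 0ᶠ ∉ˡ labels ks
    zero∉ l∈ = <⇒≱ (s≤s (All.lookup ks≤ (proj₁ (∈-labels⁻ ks l∈)))) (≤-reflexive (cong proj₁ (sym label-0ᶠ)))
    invariant : ∀ j → (∀ k → e k ∣ j) → act j (union f) ≡ union f
    invariant j e∣j = subset-ext λ x → trans (lookup-act j (union f) x)
      (trans (lookup-union (g ^ j · x)) (trans (cong f (label-· j e∣j x)) (sym (lookup-union x))))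

  -- Invariance under g^r and under -1 gives the periods r and h 0. The latter is also the period h
  -- k, by `h0≈h` and the period N k of the layer; `periodic-gcd` combines the three.
  fixed-periodic : ∀ {ks Ω} → Fixed ks Ω → ∀ {k} → k ≤ m′ → Periodic (e k) (λ i → Vec.lookup Ω (el k i))
  fixed-periodic {Ω = Ω} ((s , _) , fix , _) {k} k≤ =
    subst (λ c → Periodic c (λ i → Vec.lookup Ω (el k i))) (sym (e≡ k)) (periodic-gcd {a = d} {h k} (periodic-gcd {a = r} {h 0} (acts r fix) (acts (h 0) s)) λ i →
      trans (cong (Vec.lookup Ω) (periodic-≈ {f = el k} (el-periodic k≤) (≈-+ (≈-refl {a = i}) (≈-sym (h0≈h k≤)))))
        (acts (h 0) s i))
    where
    acts : ∀ j → act j Ω ≡ Ω → Periodic j (λ i → Vec.lookup Ω (el k i))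
    acts j fix i = trans (cong (Vec.lookup Ω) (sym (·-el j k i)))
      (trans (sym (lookup-act j Ω (el k i))) (cong (λ Ω → Vec.lookup Ω (el k i)) fix))

  fixed-is-union : ∀ {ks Ω} → Fixed ks Ω →
    ∃ λ b → (∀ x → Vec.lookup Ω x ≡ b (label x)) × (∀ {l} → l ∉ˡ labels ks → b l ≡ false)
  fixed-is-union {ks} {Ω} fx@((_ , z) , _ , supp) = b , (λ x → agree (layered x)) , λ {l} l∉ → off l l∉ (Any.any? (l ≟ᴸ_) (labels ks))
    where
    select : ∀ {X : Set} → Dec X → Bool → Bool
    select (yes _) v = v
    select (no _) _ = false
    b : ℕ × ℕ → Bool
    b l = select (Any.any? (l ≟ᴸ_) (labels ks)) (Vec.lookup Ω (el (proj₁ l) (proj₂ l)))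
    off : ∀ l → l ∉ˡ labels ks → (D : Dec (l ∈ˡ labels ks)) →
          select D (Vec.lookup Ω (el (proj₁ l) (proj₂ l))) ≡ false
    off l l∉ (yes l∈) = ⊥-elim (l∉ l∈)
    off l l∉ (no _) = refl
    agree : ∀ {x} → Layered x → Vec.lookup Ω x ≡ b (label x)
    agree (inj₁ refl) = trans z (sym (trans (cong b label-0ᶠ) (zero-off (Any.any? ((suc m′ , 0) ≟ᴸ_) (labels ks)))))
      where
      zero-off : (D : Dec ((suc m′ , 0) ∈ˡ labels ks)) → select D (Vec.lookup Ω (el (suc m′) 0)) ≡ false
      zero-off (no _) = refl
      -- The label (m, 0) read as an exponent pair denotes p^m = 0, where Ω is `false` as well.
      zero-off (yes _) = trans (cong (Vec.lookup Ω) (residue-≈ (∣⇒≈0 (m∣m*n (g ^ 0))))) z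
    agree (inj₂ (k , k≤ , i , refl)) = trans (at (Any.any? ((k , i % e k) ≟ᴸ_) (labels ks))) (cong b (sym (label-el k≤ i)))
      where
      at : (D : Dec ((k , i % e k) ∈ˡ labels ks)) → Vec.lookup Ω (el k i) ≡ select D (Vec.lookup Ω (el k (i % e k)))
      at (yes _) = periodic-≈ {f = λ i → Vec.lookup Ω (el k i)} (fixed-periodic fx k≤) (≈-sym (≈-% i (e k)))
      at (no l∉) = supp k k≤ (λ k∈ → l∉ (∈-labels⁺ k∈ (m%n<n i (e k)))) i

  fixed-count : ∀ {ks} → Unique ks → All (_≤ m′) ks →
    {P : Subset n → Set} (P? : Decidable P) {Q : ℕ → Set} (Q? : Decidable Q) →
    (∀ {Ω} → P Ω → Fixed ks Ω) → (∀ {Ω} → Fixed ks Ω → P Ω) →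
    # (λ Ω → P? Ω ×-dec Q? ∣ Ω ∣) (allSubsets n) ≡ # Q? (subsums (weights ks))
  fixed-count {ks} uks ks≤ P? Q? to from = trans
    (union-count (labels-unique uks) realised P? Q?
      (λ f off → from (union-fixed ks≤ f off)) (λ Ω pΩ → fixed-is-union (to pΩ)))
    (cong (# Q? ∘ subsums) (map-classSize ks ks≤))
    where
    realised : ∀ {t} → t ∈ˡ labels ks → ∃ λ x → label x ≡ t
    realised {k , i} t∈ with ∈-labels⁻ ks t∈
    ... | k∈ , i< = el k i , trans (label-el (All.lookup ks≤ k∈) i) (cong (k ,_) (m<n⇒m%n≡m i<))

  allLayers : List ℕ
  allLayers = 0 ∷ range1 m′

  el-p∤ : ∀ i → ¬ p ∣ toℕ (el 0 i)
  el-p∤ i d = p∤^ pp i p∤g (subst (p ∣_) (+-identityʳ (g ^ i)) (≈-resp-∣ p p∣n (toℕ-residue (p ^ 0 * g ^ i)) d))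

  supported-no-unit : ∀ {Ω} → SupportedOn (range1 m′) Ω → ZeroFree Ω → ¬ HasUnit Ω
  supported-no-unit {Ω} supp z (x , x∈ , p∤x) = go (layered x) x∈ p∤x
    where
    go : ∀ {x} → Layered x → Vec.lookup Ω x ≡ true → ¬ p ∣ toℕ x → ⊥
    go (inj₁ refl) x∈ _ = case trans (sym z) x∈ of λ ()
    go (inj₂ (zero , k≤ , i , refl)) x∈ _ = case trans (sym (supp 0 z≤n (λ 0∈ → case proj₁ (∈-range1⁻ 0∈) of λ ()) i)) x∈ of λ ()
    go (inj₂ (suc k , k≤ , i , refl)) _ p∤x = p∤x (≈-resp-∣ p p∣n (≈-sym (toℕ-residue (p ^ suc k * g ^ i)))
      (∣m⇒∣m*n (g ^ i) (m∣m*n (p ^ k))))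

  no-unit-supported : ∀ {Ω} → ¬ HasUnit Ω → SupportedOn (range1 m′) Ω
  no-unit-supported ¬u zero _ _ i = ¬true⇒false λ t → ¬u (el 0 i , t , el-p∤ i)
  no-unit-supported ¬u (suc k) k≤ k∉ i = ⊥-elim (k∉ (∈-range1⁺ (s≤s z≤n) k≤))

  -- The fixed symmetric zero-free sets are split by whether they contain a unit; those without one
  -- live on the layers 1, ..., m - 1. Stating it as a sum keeps truncated subtraction out of the
  -- counting.
  connection-fixed-count : {Q : ℕ → Set} (Q? : Decidable Q) →
    # Q? (subsums (weights allLayers)) ≡
    # (λ Ω → act r Ω ≟ˢ Ω) (filter (λ Ω → connection? Ω ×-dec Q? ∣ Ω ∣) (allSubsets n))
    + # Q? (subsums (weights (range1 m′)))
  connection-fixed-count {Q} Q? = begin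
    # Q? (subsums (weights allLayers))
      ≡⟨ sym (fixed-count all-unique all≤ Base? Q? (λ ((s , z) , fx) → (s , z) , fx , λ k k≤ k∉ → ⊥-elim (k∉ (layer∈ k k≤))) (λ (sz , fx , _) → sz , fx)) ⟩
    # (λ Ω → Base? Ω ×-dec Q? ∣ Ω ∣) (allSubsets n)
      ≡⟨ #-split _ hasUnit? (allSubsets n) ⟩
    # (λ Ω → (Base? Ω ×-dec Q? ∣ Ω ∣) ×-dec hasUnit? Ω) (allSubsets n)
    + # (λ Ω → (Base? Ω ×-dec Q? ∣ Ω ∣) ×-dec ¬? (hasUnit? Ω)) (allSubsets n)
      ≡⟨ cong₂ _+_ with-unit without-unit ⟩
    # (λ Ω → act r Ω ≟ˢ Ω) (filter (λ Ω → connection? Ω ×-dec Q? ∣ Ω ∣) (allSubsets n))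
    + # Q? (subsums (weights (range1 m′))) ∎
    where
    open ≡-Reasoning
    Base? : Decidable (λ Ω → (Symmetric Ω × ZeroFree Ω) × act r Ω ≡ Ω)
    Base? Ω = symmetric∧zeroFree? Ω ×-dec (act r Ω ≟ˢ Ω)
    range≤ : All (_≤ m′) (range1 m′)
    range≤ = All.tabulate (proj₂ ∘ ∈-range1⁻)
    all≤ : All (_≤ m′) allLayers
    all≤ = z≤n ∷ range≤
    all-unique : Unique allLayers
    all-unique = All.tabulate (λ k∈ 0≡k → case subst (1 ≤_) (sym 0≡k) (proj₁ (∈-range1⁻ k∈)) of λ ()) ∷ range1-unique m′
    layer∈ : ∀ k → k ≤ m′ → k ∈ˡ allLayers
    layer∈ zero _ = here refl
    layer∈ (suc k) k≤ = there (∈-range1⁺ (s≤s z≤n) k≤)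
    with-unit : # (λ Ω → (Base? Ω ×-dec Q? ∣ Ω ∣) ×-dec hasUnit? Ω) (allSubsets n) ≡
      # (λ Ω → act r Ω ≟ˢ Ω) (filter (λ Ω → connection? Ω ×-dec Q? ∣ Ω ∣) (allSubsets n))
    with-unit = #-bijection _ (λ Ω → act r Ω ≟ˢ Ω) id (allSubsets-unique n) (Unique.filter⁺ _ (allSubsets-unique n))
      (λ _ _ → id)
      (λ Ω∈ (((sz , fx) , q) , u) → ∈-filter⁺ (λ Ω → connection? Ω ×-dec Q? ∣ Ω ∣) Ω∈ ((sz , u) , q) , fx)
      λ {Ω} Ω∈ fx → back (∈-filter⁻ (λ Ω → connection? Ω ×-dec Q? ∣ Ω ∣) {xs = allSubsets n} Ω∈) fx
      where
      back : ∀ {Ω} → Ω ∈ˡ allSubsets n × Connection Ω × Q ∣ Ω ∣ → act r Ω ≡ Ω →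
        ∃ λ Ω′ → Ω′ ∈ˡ allSubsets n × ((((Symmetric Ω′ × ZeroFree Ω′) × act r Ω′ ≡ Ω′) × Q ∣ Ω′ ∣) × HasUnit Ω′) × Ω ≡ Ω′
      back {Ω} (Ω∈ , (sz , u) , q) fx = Ω , Ω∈ , (((sz , fx) , q) , u) , refl
    without-unit : # (λ Ω → (Base? Ω ×-dec Q? ∣ Ω ∣) ×-dec ¬? (hasUnit? Ω)) (allSubsets n) ≡
      # Q? (subsums (weights (range1 m′)))
    without-unit = trans
      (#-cong _ (λ Ω → (Base? Ω ×-dec ¬? (hasUnit? Ω)) ×-dec Q? ∣ Ω ∣) (allSubsets n)
        (λ _ ((b , q) , u) → (b , u) , q) (λ _ ((b , u) , q) → (b , q) , u))
      (fixed-count (range1-unique m′) range≤ (λ Ω → Base? Ω ×-dec ¬? (hasUnit? Ω)) Q?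
        (λ {Ω} ((sz , fx) , ¬u) → sz , fx , no-unit-supported {Ω} ¬u)
        (λ {Ω} (sz , fx , supp) → (sz , fx) , supported-no-unit {Ω} supp (proj₂ sz)))

-- Counting the weak equivalence classes

fromList-∈ : {A : Set} (xs : List A) (i : Fin (length xs)) → Vec.lookup (Vec.fromList xs) i ∈ˡ xs
fromList-∈ (x ∷ xs) zero = here refl
fromList-∈ (x ∷ xs) (suc i) = there (fromList-∈ xs i)

fromList-injective : {A : Set} {xs : List A} → Unique xs → ∀ i j →
  Vec.lookup (Vec.fromList xs) i ≡ Vec.lookup (Vec.fromList xs) j → i ≡ j
fromList-injective (_ ∷ _) zero zero _ = refl
fromList-injective {xs = x ∷ xs} u zero (suc j) eq = ⊥-elim (unique-head∉ u (subst (_∈ˡ xs) (sym eq) (fromList-∈ xs j)))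
fromList-injective {xs = x ∷ xs} u (suc i) zero eq = ⊥-elim (unique-head∉ u (subst (_∈ˡ xs) eq (fromList-∈ xs i)))
fromList-injective (_ ∷ u) (suc i) (suc j) eq = cong suc (fromList-injective u i j eq)

fromList-index : {A : Set} {xs : List A} {x : A} → x ∈ˡ xs → ∃ λ i → Vec.lookup (Vec.fromList xs) i ≡ x
fromList-index (here refl) = zero , refl
fromList-index (there x∈) with fromList-index x∈
... | i , eq = suc i , eq

-- Choosing nothing from `ss` recovers every sum of `ts`. Hence the truncated difference in
-- `sumsThroughUnits` is a true difference in ℤ.
subsums-++-≤ : {Q : ℕ → Set} (Q? : Decidable Q) (ss ts : List ℕ) → # Q? (subsums ts) ≤ # Q? (subsums (ss ++ ts))
subsums-++-≤ Q? [] ts = ≤-refl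
subsums-++-≤ Q? (s ∷ ss) ts = ≤-trans (subsums-++-≤ Q? ss ts)
  (≤-trans (m≤m+n _ _) (≤-reflexive (sym (#-++ Q? (subsums (ss ++ ts)) _))))

layerWeights : ℕ → ℕ → ℕ → List ℕ → List ℕ
layerWeights p m d = concatMap (λ k → replicate (gk p m k d) (divN (φ (p ^ (m ∸ k))) (gk p m k d)))

-- The number of sums satisfying Q that use at least one weight of layer 0.
sumsThroughUnits : {Q : ℕ → Set} → Decidable Q → ℕ → ℕ → ℕ → ℕ
sumsThroughUnits Q? p m′ d = # Q? (subsums (layerWeights p (suc m′) d (0 ∷ range1 m′)))
  ∸ # Q? (subsums (layerWeights p (suc m′) d (range1 m′)))

-- The condition `Q` on the size is instantiated twice: by equality with k for the coefficients, and
-- by the trivial condition for the total.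
module Classes (p : ℕ) (pp : Prime p) (p≢2 : p ≢ 2) (m′ : ℕ)
  (g : ℕ) (g-order : ∀ a → a ≤ m′ → IsOrder (p ^ suc a) g (p ^ a * (p ∸ 1)))
  {Q : ℕ → Set} (Q? : Decidable Q) where

  open Circulant p pp p≢2 m′ g g-order

  private
    instance
      h0≢0 : NonZero (h 0)
      h0≢0 = ℕ.>-nonZero (h>0 z≤n)

  P? : Decidable (λ Ω → Connection Ω × Q ∣ Ω ∣)
  P? Ω = connection? Ω ×-dec Q? ∣ Ω ∣

  X : List (Subset n)
  X = filter P? (allSubsets n)

  ∈-X⁻ : ∀ {Ω} → Ω ∈ˡ X → Connection Ω × Q ∣ Ω ∣
  ∈-X⁻ Ω∈ = proj₂ (∈-filter⁻ P? {xs = allSubsets n} Ω∈)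

  ∈-X⁺ : ∀ {Ω} → Connection Ω → Q ∣ Ω ∣ → Ω ∈ˡ X
  ∈-X⁺ {Ω} c q = ∈-filter⁺ P? (∈-allSubsets Ω) (c , q)

  open Burnside _≟ˢ_ (h 0) act X (Unique.filter⁺ P? (allSubsets-unique n)) act-+ act-0
    (λ Ω∈ → proj₁ (proj₁ (proj₁ (∈-X⁻ Ω∈))))
    (λ j {Ω} Ω∈ → ∈-X⁺ (Connection-act j (proj₁ (∈-X⁻ Ω∈))) (subst Q (sym (∣act∣ j Ω)) (proj₂ (∈-X⁻ Ω∈))))

  classCount : ℕ
  classCount = length reps

  fixed-number : ∀ r d → d ≡ gcd r (h 0) → # (λ Ω → act r Ω ≟ˢ Ω) X ≡ sumsThroughUnits Q? p m′ d
  fixed-number r d d≡ = sym (trans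
    (cong (_∸ # Q? (subsums (layerWeights p (suc m′) d (range1 m′)))) (connection-fixed-count Q?))
    (m+n∸n≡m (# (λ Ω → act r Ω ≟ˢ Ω) X) (# Q? (subsums (layerWeights p (suc m′) d (range1 m′))))))
    where
    open FixedSubsets p pp p≢2 m′ g g-order r (λ k → gk p (suc m′) k d) (λ k → cong (gk p (suc m′) k) d≡) using (connection-fixed-count)

  numClasses : NumClasses {n} (λ Ω → IsConnSet Ω × Q ∣ Ω ∣) classCount
  numClasses = Vec.fromList reps ,
    (λ i → Connection⇒IsConnSet (proj₁ (member i)) , proj₂ (member i)) ,
    (λ i j w → fromList-injective reps-unique i j (inequivalent i j (WeakEquiv⇒act {Vec.lookup (Vec.fromList reps) i} {Vec.lookup (Vec.fromList reps) j} w))) ,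
    λ Ω (conn , q) → cover (reps-cover (∈-X⁺ (IsConnSet⇒Connection conn) q))
    where
    member : ∀ i → Connection (Vec.lookup (Vec.fromList reps) i) × Q ∣ Vec.lookup (Vec.fromList reps) i ∣
    member i = ∈-X⁻ (reps-∈ (fromList-∈ reps i))
    inequivalent : ∀ i j →
      (∃ λ k → act k (Vec.lookup (Vec.fromList reps) j) ≡ Vec.lookup (Vec.fromList reps) i) →
      Vec.lookup (Vec.fromList reps) i ≡ Vec.lookup (Vec.fromList reps) j
    inequivalent i j (k , eq) = reps-inequivalent (fromList-∈ reps i) (fromList-∈ reps j)
      (∃⇒~ (reps-∈ (fromList-∈ reps j)) k eq)
    cover : ∀ {Ω} → (∃ λ Ω′ → Ω′ ∈ˡ reps × Ω ~ Ω′) → Σ (Fin (length reps)) λ i → WeakEquiv Ω (Vec.lookup (Vec.fromList reps) i)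
    cover {Ω} (Ω′ , Ω′∈ , Ω~Ω′) = cover′ (fromList-index Ω′∈) (~⇒∃ {Ω} {Ω′} Ω~Ω′)
      where
      cover′ : (∃ λ i → Vec.lookup (Vec.fromList reps) i ≡ Ω′) → (∃ λ j → act j Ω′ ≡ Ω) →
               Σ (Fin (length reps)) λ i → WeakEquiv Ω (Vec.lookup (Vec.fromList reps) i)
      cover′ (i , eq) (j , eq′) = i , subst (WeakEquiv Ω) (sym eq) (act⇒WeakEquiv j eq′)

  -- The factor 2 arises because p^(m-1)(p - 1) is the order of the unit group, twice the order h 0
  -- of the group used in `burnside`.
  classNumber : classCount * (p ^ m′ * (p ∸ 1)) ≡
    2 * ∑ (divisors (halfφ p (suc m′))) (λ d → φ (divN (halfφ p (suc m′)) d) * sumsThroughUnits Q? p m′ d)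
  classNumber = begin
    classCount * (p ^ m′ * (p ∸ 1))
      ≡⟨ cong (classCount *_) (trans (sym (N-value z≤n)) (N≡h*2 z≤n)) ⟩
    classCount * (h 0 * 2)
      ≡⟨ lem classCount (h 0) ⟩
    2 * (classCount * h 0)
      ≡⟨ cong (2 *_) burnside ⟩
    2 * ∑ (range1 (h 0)) (λ r → # (λ Ω → act r Ω ≟ˢ Ω) X)
      ≡⟨ cong (2 *_) (∑-cong (range1 (h 0)) (λ {r} _ → fixed-number r (gcd r (h 0)) refl)) ⟩
    2 * ∑ (range1 (h 0)) (λ r → sumsThroughUnits Q? p m′ (gcd r (h 0)))
      ≡⟨ cong (2 *_) (∑-gcd (h 0) (sumsThroughUnits Q? p m′)) ⟩
    2 * ∑ (divisors (h 0)) (λ d → φ (divN (h 0) d) * sumsThroughUnits Q? p m′ d) ∎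
    where
    open ≡-Reasoning
    lem : ∀ a b → a * (b * 2) ≡ 2 * (a * b)
    lem = solve-∀

-- The two formulas

gcd-divisor : ∀ {d h} → d ∈ˡ divisors h → gcd d h ≡ d
gcd-divisor {d} {h} d∈ = ∣-antisym (gcd[m,n]∣m d h)
  (gcd-greatest ∣-refl (proj₂ (∈-filter⁻ (_∣? h) {xs = range1 h} d∈)))

-- For k = 0 the number of classes gcd(d, h 0) is d itself, since d divides h 0; this is why the
-- first factor of the formula contains d and not a gcd.
unitLayer : ∀ p m′ {d} → d ∈ˡ divisors (halfφ p (suc m′)) →
  layerWeights p (suc m′) d (0 ∷ range1 m′)
    ≡ replicate d (divN (φ (p ^ suc m′)) d) ++ layerWeights p (suc m′) d (range1 m′)
unitLayer p m′ {d} d∈ = cong (λ e → replicate e (divN (φ (p ^ suc m′)) e) ++ layerWeights p (suc m′) d (range1 m′))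
  (gcd-divisor d∈)

coeff-Ssum : ∀ p m′ k → coeff (Ssum p (suc m′)) k ≡
  ℤ.+ ∑ (divisors (halfφ p (suc m′))) (λ d → φ (divN (halfφ p (suc m′)) d) * sumsThroughUnits (_≟ k) p m′ d)
coeff-Ssum p m′ k = coeff-psum _ _ (divisors (halfφ p (suc m′))) k λ {d} d∈ → term d d∈
  where
  m = suc m′
  unitFactor otherFactors : ℕ → Poly
  unitFactor d = ppow (padd pone (xpow (divN (φ (p ^ m)) d))) d
  otherFactors d = pprod (map (λ k → ppow (padd pone (xpow (divN (φ (p ^ (m ∸ k))) (gk p m k d)))) (gk p m k d)) (range1 m′))
  term : ∀ d → d ∈ˡ divisors (halfφ p m) →
    coeff (pscale (ℤ.+ φ (divN (halfφ p m) d)) (pmul (psub (unitFactor d) pone) (otherFactors d))) k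
      ≡ ℤ.+ (φ (divN (halfφ p m) d) * sumsThroughUnits (_≟ k) p m′ d)
  term d d∈ = begin
    coeff (pscale (ℤ.+ c) (pmul (psub (unitFactor d) pone) (otherFactors d))) k
      ≡⟨ coeff-pscale (ℤ.+ c) (pmul (psub (unitFactor d) pone) (otherFactors d)) k ⟩
    ℤ.+ c ℤ.* coeff (pmul (psub (unitFactor d) pone) (otherFactors d)) k
      ≡⟨ cong (λ z → ℤ.+ c ℤ.* z) (coeff-pmul-psub-one (unitFactor d) (otherFactors d) ss ts
           (coeff-ppow (divN (φ (p ^ m)) d) d)
           (coeff-pprod (λ k → divN (φ (p ^ (m ∸ k))) (gk p m k d)) (λ k → gk p m k d) (range1 m′)) k) ⟩
    ℤ.+ c ℤ.* (ℤ.+ # (_≟ k) (subsums (ss ++ ts)) ℤ.- ℤ.+ # (_≟ k) (subsums ts))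
      ≡⟨ cong (λ z → ℤ.+ c ℤ.* z) (trans (ℤₚ.m-n≡m⊖n (# (_≟ k) (subsums (ss ++ ts))) (# (_≟ k) (subsums ts)))
           (ℤₚ.⊖-≥ (subsums-++-≤ (_≟ k) ss ts))) ⟩
    ℤ.+ c ℤ.* ℤ.+ (# (_≟ k) (subsums (ss ++ ts)) ∸ # (_≟ k) (subsums ts))
      ≡⟨ sym (ℤₚ.pos-* c _) ⟩
    ℤ.+ (c * (# (_≟ k) (subsums (ss ++ ts)) ∸ # (_≟ k) (subsums ts)))
      ≡⟨ cong (λ ws → ℤ.+ (c * (# (_≟ k) (subsums ws) ∸ # (_≟ k) (subsums ts)))) (sym (unitLayer p m′ d∈)) ⟩
    ℤ.+ (c * sumsThroughUnits (_≟ k) p m′ d) ∎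
    where
    open ≡-Reasoning
    c = φ (divN (halfφ p m) d)
    ss = replicate d (divN (φ (p ^ m)) d)
    ts = layerWeights p m d (range1 m′)

-- Under the trivial condition each list of sublist sums is counted by its length, a power of 2, and
-- 2^(d+l) - 2^l = (2^d - 1) 2^l.
Esum-sums : ∀ p m′ → Esum p (suc m′) ≡
  ∑ (divisors (halfφ p (suc m′))) (λ d → φ (divN (halfφ p (suc m′)) d) * sumsThroughUnits {λ _ → ⊤} (λ _ → yes tt) p m′ d)
Esum-sums p m′ = ∑-cong (divisors (halfφ p (suc m′))) λ {d} d∈ → trans (*-assoc (φ (divN (halfφ p m) d)) (2 ^ d ∸ 1) _)
  (cong (φ (divN (halfφ p m) d) *_) (sym (term d d∈)))
  where
  m = suc m′
  2^length : ∀ d ks → 2 ^ length (layerWeights p m d ks) ≡ product (map (λ k → 2 ^ gk p m k d) ks)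
  2^length d [] = refl
  2^length d (k ∷ ks) = trans (cong (2 ^_) (trans (length-++ (replicate (gk p m k d) _)) (cong (_+ length (layerWeights p m d ks)) (length-replicate (gk p m k d)))))
    (trans (^-distribˡ-+-* 2 (gk p m k d) _) (cong (2 ^ gk p m k d *_) (2^length d ks)))
  term : ∀ d → d ∈ˡ divisors (halfφ p m) → sumsThroughUnits {λ _ → ⊤} (λ _ → yes tt) p m′ d
    ≡ (2 ^ d ∸ 1) * product (map (λ k → 2 ^ gk p m k d) (range1 m′))
  term d d∈ = begin
    sumsThroughUnits {λ _ → ⊤} (λ _ → yes tt) p m′ d
      ≡⟨ cong₂ _∸_ (trans (#-all (subsums all)) (trans (length-subsums all) (cong (λ ws → 2 ^ length ws) (unitLayer p m′ d∈))))
           (trans (#-all (subsums ts)) (length-subsums ts)) ⟩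
    2 ^ length (ss ++ ts) ∸ 2 ^ length ts
      ≡⟨ cong₂ _∸_ (trans (cong (2 ^_) (trans (length-++ ss) (cong (_+ length ts) (length-replicate d)))) (^-distribˡ-+-* 2 d (length ts)))
           (sym (*-identityˡ (2 ^ length ts))) ⟩
    2 ^ d * 2 ^ length ts ∸ 1 * 2 ^ length ts
      ≡⟨ sym (*-distribʳ-∸ (2 ^ length ts) (2 ^ d) 1) ⟩
    (2 ^ d ∸ 1) * 2 ^ length ts
      ≡⟨ cong ((2 ^ d ∸ 1) *_) (2^length d (range1 m′)) ⟩
    (2 ^ d ∸ 1) * product (map (λ k → 2 ^ gk p m k d) (range1 m′)) ∎
    where
    open ≡-Reasoning
    all = layerWeights p m d (0 ∷ range1 m′)
    ss = replicate d (divN (φ (p ^ m)) d)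
    ts = layerWeights p m d (range1 m′)

open import Data.Integer using (+_)

theorem4p3 : (p m : ℕ) → Prime p → p ≢ 2 → 1 ≤ m →
    ((k : ℕ) → Σ ℕ λ c →
        NumClasses {p ^ m} (λ Ω → IsConnSet Ω × ∣ Ω ∣ ≡ k) c ×
        (+ c) ℤ.* (+ (p ^ (m ∸ 1) * (p ∸ 1))) ≡ (+ 2) ℤ.* coeff (Ssum p m) k) ×
    (Σ ℕ λ e → NumClasses {p ^ m} IsConnSet e × e * (p ^ (m ∸ 1) * (p ∸ 1)) ≡ 2 * Esum p m)
theorem4p3 p (suc m′) pp p≢2 _ = (λ k → byDegree k (primitive-root-power pp p≢2 m′)) , total (primitive-root-power pp p≢2 m′)
  where
  Generator : Set
  Generator = ∃ λ g → ∀ a → a ≤ m′ → IsOrder (p ^ suc a) g (p ^ a * (p ∸ 1))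
  cast : ∀ a b c d → a * b ≡ c * d → + a ℤ.* + b ≡ + c ℤ.* + d
  cast a b c d eq = trans (sym (ℤₚ.pos-* a b)) (trans (cong +_ eq) (ℤₚ.pos-* c d))
  byDegree : ∀ k → Generator → Σ ℕ λ c →
    NumClasses {p ^ suc m′} (λ Ω → IsConnSet Ω × ∣ Ω ∣ ≡ k) c ×
    (+ c) ℤ.* (+ (p ^ m′ * (p ∸ 1))) ≡ (+ 2) ℤ.* coeff (Ssum p (suc m′)) k
  byDegree k (g , g-order) = classCount , numClasses ,
    trans (cast classCount (p ^ m′ * (p ∸ 1)) 2 (∑ (divisors (halfφ p (suc m′))) (λ d → φ (divN (halfφ p (suc m′)) d) * sumsThroughUnits (_≟ k) p m′ d)) classNumber) (cong (λ z → + 2 ℤ.* z) (sym (coeff-Ssum p m′ k)))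
    where open Classes p pp p≢2 m′ g g-order (_≟ k)
  total : Generator → Σ ℕ λ e → NumClasses {p ^ suc m′} IsConnSet e × e * (p ^ m′ * (p ∸ 1)) ≡ 2 * Esum p (suc m′)
  total (g , g-order) = classCount , forget numClasses , trans classNumber (cong (2 *_) (sym (Esum-sums p m′)))
    where
    open Classes p pp p≢2 m′ g g-order {λ _ → ⊤} (λ _ → yes tt)
    forget : ∀ {c} → NumClasses {p ^ suc m′} (λ Ω → IsConnSet Ω × ⊤) c → NumClasses {p ^ suc m′} IsConnSet c
    forget (R , conn , distinct , cover) = R , proj₁ ∘ conn , distinct , λ Ω c → cover Ω (c , tt)
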